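{- Every 3-edge-connected quartic planar graph other than the octahedron has a 4-locally self-avoiding Eulerian circuit.
   Context: All graphs are finite and simple; quartic means 4-regular. A circuit is a closed trail (no repeated edges), Eulerian if it uses every edge. A subcycle of a circuit $x_1\ldots x_n$ is a subtrail $x_i\ldots x_j$ of consecutive vertices (read cyclically) with $x_i=x_j$ and $x_i,\ldots,x_{j-1}$ distinct; a circuit is 4-locally self-avoiding if it has no subcycle of length at most 4. The octahedron is $K_6$ minus a perfect matching. -}

module Defs where

open import Data.Bool using (Bool; true; false; not; _∧_; if_then_else_)
open import Data.Nat using (ℕ; zero; suc; _+_; _*_; _≤_; _<_; _/_; _≡ᵇ_; _<ᵇ_)
open import Data.Nat.DivMod using (_mod_)
open import Data.Fin using (Fin; toℕ)
open import Data.List using (List; []; _∷_; length; map; allFin)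
open import Data.Nat.ListAction using (sum)
open import Data.List.Relation.Unary.Any using (Any)
open import Data.Product using (Σ; ∃; ∃-syntax; _×_; _,_; proj₁; proj₂)
open import Data.Sum using (_⊎_)
open import Function using (_∘_; id)
open import Function.Definitions using (Bijective)
open import Relation.Binary.PropositionalEquality using (_≡_; _≢_)
open import Relation.Nullary using (¬_)

record Graph (n : ℕ) : Set where
  field
    adj   : Fin n → Fin n → Bool
    sym   : ∀ u v → adj u v ≡ adj v u
    irref : ∀ u → adj u u ≡ false
open Graph public

Adj : ∀ {n} → Graph n → Fin n → Fin n → Set
Adj G u v = adj G u v ≡ true

b2n : Bool → ℕ
b2n true  = 1
b2n false = 0

degree : ∀ {n} → Graph n → Fin n → ℕ
degree {n} G v = sum (map (λ w → b2n (adj G v w)) (allFin n))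

edgeCount : ∀ {n} → Graph n → ℕ
edgeCount {n} G =
  sum (map (λ u → sum (map (λ v → b2n (adj G u v ∧ (toℕ u <ᵇ toℕ v))) (allFin n))) (allFin n))

Quartic : ∀ {n} → Graph n → Set
Quartic G = ∀ v → degree G v ≡ 4

Removed : ∀ {n} → List (Fin n × Fin n) → Fin n → Fin n → Set
Removed F u v = Any (λ e → (proj₁ e ≡ u × proj₂ e ≡ v) ⊎ (proj₁ e ≡ v × proj₂ e ≡ u)) F

data Reach {n} (G : Graph n) (F : List (Fin n × Fin n)) : Fin n → Fin n → Set where
  here : ∀ {u} → Reach G F u u
  step : ∀ {u w v} → Adj G u w → ¬ Removed F u w → Reach G F w v → Reach G F u v

-- G is k-edge-connected: deleting any set of fewer than k edges leaves G connected
-- (a list of length < k of pairs covers every edge set of size < k)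
EdgeConnected : ∀ {n} → ℕ → Graph n → Set
EdgeConnected {n} k G =
  (F : List (Fin n × Fin n)) → suc (length F) ≤ k → ∀ u v → Reach G F u v

iterate : ∀ {A : Set} → (A → A) → ℕ → A → A
iterate f zero    x = x
iterate f (suc k) x = f (iterate f k x)

record RotationSystem {n} (G : Graph n) : Set where
  field
    next       : Fin n → Fin n → Fin n
    next-adj   : ∀ v u → Adj G v u → Adj G v (next v u)
    next-cycle : ∀ v u u' → Adj G v u → Adj G v u' →
                 ∃[ k ] iterate (next v) k (next v u) ≡ u'

  -- face-tracing permutation on darts (u,v)
  φ : Fin n × Fin n → Fin n × Fin n
  φ (u , v) = (v , next v u)
open RotationSystem public

HasFaces : ∀ {n} {G : Graph n} → RotationSystem G → ℕ → Set
HasFaces {n} {G} ρ f =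
  Σ (Fin n → Fin n → Fin f) λ face →
    (∀ u v u' v' → Adj G u v → Adj G u' v' →
       (face u v ≡ face u' v' → ∃[ k ] iterate (φ ρ) k (u , v) ≡ (u' , v'))
     × (∃[ k ] iterate (φ ρ) k (u , v) ≡ (u' , v') → face u v ≡ face u' v'))
    × (∀ x → ∃[ u ] ∃[ v ] (Adj G u v × face u v ≡ x))

-- planar (for connected graphs): some rotation system satisfies V - E + F = 2
Planar : ∀ {n} → Graph n → Set
Planar {n} G = Σ (RotationSystem G) λ ρ → ∃[ f ] (HasFaces ρ f × n + f ≡ edgeCount G + 2)

-- The octahedron K6 minus the perfect matching {01,23,45}

octahedron : Graph 6
octahedron = record
  { adj   = λ i j → not ((toℕ i / 2) ≡ᵇ (toℕ j / 2))
  ; sym   = λ { i j → lemma (toℕ i / 2) (toℕ j / 2) }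
  ; irref = λ i → refl-lemma (toℕ i / 2)
  }
  where
  open import Relation.Binary.PropositionalEquality using (refl; cong)
  lemma : ∀ a b → not (a ≡ᵇ b) ≡ not (b ≡ᵇ a)
  lemma zero zero = refl
  lemma zero (suc b) = refl
  lemma (suc a) zero = refl
  lemma (suc a) (suc b) = lemma a b
  refl-lemma : ∀ a → not (a ≡ᵇ a) ≡ false
  refl-lemma zero = refl
  refl-lemma (suc a) = refl-lemma a

Isomorphic : ∀ {n m} → Graph n → Graph m → Set
Isomorphic {n} {m} G H =
  Σ (Fin n → Fin m) λ f → Bijective _≡_ _≡_ f × (∀ u v → adj G u v ≡ adj H (f u) (f v))

record Circuit {n} (G : Graph n) : Set where
  field
    len-1 : ℕ
    seq   : Fin (suc len-1) → Fin n
  len : ℕ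
  len = suc len-1
  at : ℕ → Fin n
  at i = seq (i mod len)
  field
    walk  : ∀ i → Adj G (at i) (at (suc i))
    trail : ∀ i j → i < j → j < len →
            ¬ ((at i ≡ at j × at (suc i) ≡ at (suc j)) ⊎ (at i ≡ at (suc j) × at (suc i) ≡ at j))
open Circuit public

Eulerian : ∀ {n} {G : Graph n} → Circuit G → Set
Eulerian {n} {G} c = ∀ u v → Adj G u v →
  ∃[ i ] ((at c i ≡ u × at c (suc i) ≡ v) ⊎ (at c i ≡ v × at c (suc i) ≡ u))

-- subcycle x_i ... x_{i+k} (indices cyclic) of length k:
-- x_i = x_{i+k} and x_i, ..., x_{i+k-1} distinct; as a subtrail, 1 ≤ k ≤ len
Subcycle : ∀ {n} {G : Graph n} → Circuit G → ℕ → ℕ → Set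
Subcycle c i k =
  1 ≤ k × k ≤ len c × at c i ≡ at c (i + k)
  × (∀ a b → a < k → b < k → a ≢ b → at c (i + a) ≢ at c (i + b))

LocallySelfAvoiding : ∀ {n} {G : Graph n} → ℕ → Circuit G → Set
LocallySelfAvoiding r c = ∀ i k → k ≤ r → ¬ Subcycle c i k

{-# OPTIONS --safe #-}
module Submission where

-- An Eulerian circuit of G is a cyclic word in which every vertex occurs twice; it is 4-locally
-- self-avoiding iff no letter recurs after three or four steps, shorter recurrences being excluded
-- because G is simple.  Reversing the stretch between the two occurrences of a letter (a flip)
-- yields another Eulerian circuit.  Let a recurrence after three steps cost 2 and one after four
-- steps cost 1.  Unless G is K₅, the octahedron, K̄₃ + 2K₂ or K₄,₄, a circuit of positive cost
-- becomes cheaper by at most four flips of letters close to some recurrence.  This is a finite case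
-- distinction over patterns, i.e. cyclic words with hidden segments: a pattern is refined by
-- uncovering the end of a hidden segment, by locating the second occurrence of a letter or by
-- deciding whether two letters agree, until some flips pay off whatever the hidden segments are.
-- The tree of cases was found by computer search and is replayed here by a verified checker.
-- Edge-connectivity rules out that a proper factor of the circuit contains both occurrences of all
-- its letters; planarity only serves to exclude three of the four exceptional graphs, by counting
-- the darts of their n + 2 faces.

open import Defs hiding (sym; len; at; seq; walk; trail; next; next-adj; next-cycle; φ)
open import Data.Bool using (Bool; true; false; not; _∧_; _∨_; if_then_else_; T)
open import Data.Nat hiding (_≟_)
open import Data.Nat.Properties hiding (_≟_)
import Data.Nat.Properties as ℕₚ
open import Data.Nat.DivMod using (_mod_; m%n<n; m<n⇒m%n≡m; [m+n]%n≡m%n)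
open import Data.Nat.ListAction using (sum)
open import Data.Nat.Tactic.RingSolver using (solve-∀)
open import Data.Fin using (Fin; zero; suc; toℕ; _≟_; fromℕ<)
open import Data.Fin.Properties using (toℕ-fromℕ<; toℕ<n; toℕ-injective; injective⇒≤; all?; ¬∀⟶∃¬)
open import Data.Char using () renaming (toℕ to charCode)
open import Data.String using (String; toList)
open import Data.List using (List; []; _∷_; _++_; [_]; length; map; concatMap; reverse; take; drop; lookup; allFin; initLast; _∷ʳ′_)
open import Data.List.Properties using (++-assoc; ++-identityʳ; unfold-reverse; reverse-involutive; length-reverse; reverse-++; length-++; take++drop≡id; map-++; map-tabulate)
open import Data.List.Relation.Unary.All as All using (All; []; _∷_)
import Data.List.Relation.Unary.All.Properties as Allₚ
open import Data.List.Relation.Unary.Any using (here; there)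
open import Data.List.Membership.Propositional using (_∈_; _∉_)
open import Data.List.Membership.Propositional.Properties using (∈-++⁺ʳ; ∈-++⁻; ∈-∃++; ∈-allFin)
open import Data.Maybe using (Maybe; just; nothing; _>>=_; is-just)
open import Data.Maybe.Properties using (just-injective)
open import Data.Product using (Σ; ∃-syntax; ∃₂; _×_; _,_; proj₁; proj₂)
open import Data.Sum using (_⊎_; inj₁; inj₂)
open import Data.Empty using (⊥; ⊥-elim)
open import Function using (_∘_)
open import Relation.Binary using (tri<; tri≈; tri>)
open import Relation.Binary.PropositionalEquality hiding ([_])
open import Relation.Nullary
open import Relation.Nullary.Decidable using (_⊎-dec_)

-- What makes two circuits comparable without knowledge of the hidden segments is cancellation. A
-- sequence of flips cuts the cyclic word into runs that are merely permuted and reversed.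
-- Recurrences inside a run survive, so only pairs of letters straddling a joint matter. There the
-- old circuit is bounded from below (only visible pairs with the same name count) and the new one
-- from above (every pair counts unless its members are known to differ); a pattern is settled when
-- the upper bound is the smaller one. The weights 2 and 1 make it profitable to trade a recurrence
-- after three steps for one after four. Recurrences after three steps are removed as long as there
-- are any, so the treatment of those after four steps may assume that there are none; this is the
-- Boolean flag of the checker. The cost being a natural number, the descent stops; it starts at an
-- Eulerian circuit found by Hierholzer's argument. The checker branches on patterns and codes only,
-- never on the graph, and therefore evaluates while the graph is a variable. Heuristic ingredients
-- such as the division into runs are verified on each of their outputs.

infixl 9 _!?_
_!?_ : ∀ {A : Set} → List A → ℕ → Maybe A
[]       !? _     = nothing
(x ∷ xs) !? zero  = just x
(x ∷ xs) !? suc i = xs !? i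

!?-++ˡ : ∀ {A : Set} (xs : List A) {ys d} → d < length xs → (xs ++ ys) !? d ≡ xs !? d
!?-++ˡ (x ∷ xs) {d = zero}  _       = refl
!?-++ˡ (x ∷ xs) {d = suc d} (s≤s h) = !?-++ˡ xs h

-- Words: counting recurrences and traversed edges.

module Words {n : ℕ} where

  V : Set
  V = Fin n

  δ : V → V → ℕ
  δ x y = b2n (does (x ≟ y))

  δ-refl : ∀ x → δ x x ≡ 1
  δ-refl x with x ≟ x
  ... | yes _ = refl
  ... | no ¬p = ⊥-elim (¬p refl)

  δ-≢ : ∀ {x y} → x ≢ y → δ x y ≡ 0
  δ-≢ {x} {y} x≢y with x ≟ y
  ... | yes p = ⊥-elim (x≢y p)
  ... | no _  = refl

  δ-≡1 : ∀ {x y} → x ≡ y → δ x y ≡ 1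
  δ-≡1 {x} refl = δ-refl x

  δ-sym : ∀ x y → δ x y ≡ δ y x
  δ-sym x y with x ≟ y
  ... | yes refl = sym (δ-refl x)
  ... | no x≢y   = sym (δ-≢ (λ e → x≢y (sym e)))

  δ≤1 : ∀ x y → δ x y ≤ 1
  δ≤1 x y with x ≟ y
  ... | yes _ = s≤s z≤n
  ... | no _  = z≤n

  δ? : Maybe V → Maybe V → ℕ
  δ? (just x) (just y) = δ x y
  δ? _        _        = 0

  δ?-sym : ∀ x y → δ? x y ≡ δ? y x
  δ?-sym (just x) (just y) = δ-sym x y
  δ?-sym (just x) nothing  = refl
  δ?-sym nothing  (just y) = refl
  δ?-sym nothing  nothing  = refl

  δ?-nothingʳ : ∀ x → δ? x nothing ≡ 0
  δ?-nothingʳ (just x) = refl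
  δ?-nothingʳ nothing  = refl

  -- lin d counts the equal letters at distance d + 1 inside a word, cross d those that
  -- straddle the cut between a word (given reversed) and its continuation.
  lin : ℕ → List V → ℕ
  lin d []       = 0
  lin d (x ∷ xs) = δ? (just x) (xs !? d) + lin d xs

  cross : ℕ → List V → List V → ℕ
  cross d       []       ys = 0
  cross zero    (x ∷ xr) ys = δ? (just x) (ys !? 0)
  cross (suc d) (x ∷ xr) ys = δ? (just x) (ys !? suc d) + cross d xr ys

  -- A straddling pair either ends at `x` or skips it; in the latter case its members come one step
  -- closer once `x` is dropped.
  cross-∷ʳ : ∀ d xr x ys → cross (suc d) xr (x ∷ ys) ≡ cross (suc d) xr [ x ] + cross d xr ys
  cross-∷ʳ d       []       x ys = refl
  cross-∷ʳ zero    (z ∷ [])     x ys = +-comm (δ? (just z) (ys !? 0)) 0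
  cross-∷ʳ zero    (z ∷ w ∷ xr) x ys = +-comm (δ? (just z) (ys !? 0)) (δ w x)
  cross-∷ʳ (suc d) (z ∷ xr) x ys
    rewrite cross-∷ʳ d xr x ys
    = lem (δ? (just z) (ys !? suc d)) (cross (suc d) xr [ x ]) (cross d xr ys)
    where lem : ∀ a b c → a + (b + c) ≡ b + (a + c)
          lem = solve-∀

  cross-last : ∀ d xs x → cross d xs [ x ] ≡ δ? (xs !? d) (just x)
  cross-last d       []       x = refl
  cross-last zero    (y ∷ xs) x = refl
  cross-last (suc d) (y ∷ xs) x = cross-last d xs x

  -- The prefix is given reversed because the induction moves the letter next to the cut to the
  -- other side, and this is the letter that `cross` meets first.
  lin-revapp : ∀ d xr ys → lin d (reverse xr ++ ys) ≡ lin d (reverse xr) + lin d ys + cross d xr ys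
  lin-revapp d []       ys = sym (+-identityʳ _)
  lin-revapp d (x ∷ xr) ys = begin
    lin d (reverse (x ∷ xr) ++ ys)       ≡⟨ cong (λ l → lin d (l ++ ys)) (unfold-reverse x xr) ⟩
    lin d ((reverse xr ++ [ x ]) ++ ys)  ≡⟨ cong (lin d) (++-assoc (reverse xr) [ x ] ys) ⟩
    lin d (reverse xr ++ x ∷ ys)         ≡⟨ lin-revapp d xr (x ∷ ys) ⟩
    L + (h + lin d ys) + cross d xr (x ∷ ys)  ≡⟨ lem₁ L h (lin d ys) _ ⟩
    L + lin d ys + (h + cross d xr (x ∷ ys))  ≡⟨ cong (L + lin d ys +_) (key d) ⟩
    L + lin d ys + (cross d xr [ x ] + cross d (x ∷ xr) ys)  ≡⟨ lem₂ L (lin d ys) _ _ ⟩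
    (L + (0 + 0) + cross d xr [ x ]) + lin d ys + cross d (x ∷ xr) ys
      ≡⟨ cong (λ k → k + lin d ys + cross d (x ∷ xr) ys) (sym (lin-revapp d xr [ x ])) ⟩
    lin d (reverse xr ++ [ x ]) + lin d ys + cross d (x ∷ xr) ys
      ≡⟨ cong (λ l → lin d l + lin d ys + cross d (x ∷ xr) ys) (sym (unfold-reverse x xr)) ⟩
    lin d (reverse (x ∷ xr)) + lin d ys + cross d (x ∷ xr) ys ∎
    where
    open ≡-Reasoning
    L = lin d (reverse xr)
    h = δ? (just x) (ys !? d)
    lem₁ : ∀ a b c e → a + (b + c) + e ≡ a + c + (b + e)
    lem₁ = solve-∀
    lem₂ : ∀ a b c e → a + b + (c + e) ≡ (a + (0 + 0) + c) + b + e
    lem₂ = solve-∀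
    key : ∀ d → δ? (just x) (ys !? d) + cross d xr (x ∷ ys) ≡ cross d xr [ x ] + cross d (x ∷ xr) ys
    key zero = lem₄ xr
      where lem₄ : ∀ xr → δ? (just x) (ys !? 0) + cross 0 xr (x ∷ ys) ≡ cross 0 xr [ x ] + δ? (just x) (ys !? 0)
            lem₄ []      = +-comm (δ? (just x) (ys !? 0)) 0
            lem₄ (z ∷ _) = +-comm (δ? (just x) (ys !? 0)) (δ z x)
    key (suc d) rewrite cross-∷ʳ d xr x ys = lem₃ (δ? (just x) (ys !? suc d)) (cross (suc d) xr [ x ]) (cross d xr ys)
      where lem₃ : ∀ a b c → a + (b + c) ≡ b + (a + c)
            lem₃ = solve-∀

  lin-++ : ∀ d xs ys → lin d (xs ++ ys) ≡ lin d xs + lin d ys + cross d (reverse xs) ys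
  lin-++ d xs ys = subst (λ l → lin d (l ++ ys) ≡ lin d l + lin d ys + cross d (reverse xs) ys)
                         (reverse-involutive xs) (lin-revapp d (reverse xs) ys)

  lin-reverse : ∀ d xs → lin d (reverse xs) ≡ lin d xs
  lin-reverse d []       = refl
  lin-reverse d (x ∷ xs) = begin
    lin d (reverse (x ∷ xs))                       ≡⟨ cong (lin d) (unfold-reverse x xs) ⟩
    lin d (reverse xs ++ [ x ])                    ≡⟨ lin-revapp d xs [ x ] ⟩
    lin d (reverse xs) + (0 + 0) + cross d xs [ x ]  ≡⟨ cong₂ (λ a b → a + (0 + 0) + b) (lin-reverse d xs) (cross-last d xs x) ⟩
    lin d xs + (0 + 0) + δ? (xs !? d) (just x)      ≡⟨ lem (lin d xs) _ ⟩
    δ? (xs !? d) (just x) + lin d xs                ≡⟨ cong (_+ lin d xs) (δ?-sym (xs !? d) (just x)) ⟩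
    δ? (just x) (xs !? d) + lin d xs ∎
    where
    open ≡-Reasoning
    lem : ∀ a b → a + (0 + 0) + b ≡ b + a
    lem = solve-∀

  cross-++ˡ : ∀ d xr zs ys → d < length xr → cross d (xr ++ zs) ys ≡ cross d xr ys
  cross-++ˡ zero    (x ∷ xr) zs ys _       = refl
  cross-++ˡ (suc d) (x ∷ xr) zs ys (s≤s h) = cong (δ? (just x) (ys !? suc d) +_) (cross-++ˡ d xr zs ys h)

  cross-++ʳ : ∀ d xr ys zs → d < length ys → cross d xr (ys ++ zs) ≡ cross d xr ys
  cross-++ʳ d       []       ys zs h = refl
  cross-++ʳ zero    (x ∷ xr) ys zs h = cong (δ? (just x)) (!?-++ˡ ys h)
  cross-++ʳ (suc d) (x ∷ xr) ys zs h =
    cong₂ _+_ (cong (δ? (just x)) (!?-++ˡ ys h)) (cross-++ʳ d xr ys zs (<-trans (n<1+n d) h))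

  -- The number of positions of the cyclic word whose letter recurs d + 1 steps later.
  gaps : ℕ → List V → ℕ
  gaps d w = lin d w + cross d (reverse w) w

  -- Pairs that begin at `x` turn from inner into straddling ones, pairs that end at `x` from
  -- straddling into inner ones. The bound on the length keeps these two kinds from interfering
  -- around the cycle.
  gaps-rotate₁ : ∀ d x ys → suc d < length ys → gaps (suc d) (x ∷ ys) ≡ gaps (suc d) (ys ++ [ x ])
  gaps-rotate₁ d x ys h = begin
    hd + lin e ys + cross e (reverse (x ∷ ys)) (x ∷ ys)
      ≡⟨ cong (λ l → hd + lin e ys + cross e l (x ∷ ys)) (unfold-reverse x ys) ⟩
    hd + lin e ys + cross e (reverse ys ++ [ x ]) (x ∷ ys)
      ≡⟨ cong (hd + lin e ys +_) (cross-++ˡ e (reverse ys) [ x ] (x ∷ ys) (subst (e <_) (sym (length-reverse ys)) h)) ⟩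
    hd + lin e ys + cross e (reverse ys) (x ∷ ys)
      ≡⟨ cong (hd + lin e ys +_) (cross-∷ʳ d (reverse ys) x ys) ⟩
    hd + lin e ys + (cross e (reverse ys) [ x ] + cross d (reverse ys) ys)
      ≡⟨ lem hd (lin e ys) _ _ ⟩
    (lin e ys + (0 + 0) + cross e (reverse ys) [ x ]) + (hd + cross d (reverse ys) ys)
      ≡⟨ cong₂ _+_ (sym (lin-++ e ys [ x ])) (cong₂ _+_ (cong (δ? (just x)) (sym (!?-++ˡ ys h)))
                        (sym (cross-++ʳ d (reverse ys) ys [ x ] (<-trans (n<1+n d) h)))) ⟩
    lin e (ys ++ [ x ]) + (δ? (just x) ((ys ++ [ x ]) !? e) + cross d (reverse ys) (ys ++ [ x ]))
      ≡⟨ cong (λ l → lin e (ys ++ [ x ]) + cross e l (ys ++ [ x ])) (sym (reverse-++ ys [ x ])) ⟩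
    gaps e (ys ++ [ x ]) ∎
    where
    open ≡-Reasoning
    e = suc d
    hd = δ? (just x) (ys !? e)
    lem : ∀ a b c f → a + b + (c + f) ≡ (b + (0 + 0) + c) + (a + f)
    lem = solve-∀

  gaps-rotate : ∀ d xs ys → suc (suc d) < length (xs ++ ys) → gaps (suc d) (xs ++ ys) ≡ gaps (suc d) (ys ++ xs)
  gaps-rotate d []       ys h = cong (gaps (suc d)) (sym (++-identityʳ ys))
  gaps-rotate d (x ∷ xs) ys (s≤s h) = begin
    gaps (suc d) (x ∷ xs ++ ys)      ≡⟨ gaps-rotate₁ d x (xs ++ ys) h ⟩
    gaps (suc d) ((xs ++ ys) ++ [ x ])  ≡⟨ cong (gaps (suc d)) (++-assoc xs ys [ x ]) ⟩
    gaps (suc d) (xs ++ ys ++ [ x ])  ≡⟨ gaps-rotate d xs (ys ++ [ x ]) (subst (suc (suc d) <_) len-eq h′) ⟩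
    gaps (suc d) ((ys ++ [ x ]) ++ xs) ≡⟨ cong (gaps (suc d)) (++-assoc ys [ x ] xs) ⟩
    gaps (suc d) (ys ++ x ∷ xs) ∎
    where
    open ≡-Reasoning
    h′ : suc (suc d) < suc (length (xs ++ ys))
    h′ = s≤s h
    len-eq : suc (length (xs ++ ys)) ≡ length (xs ++ ys ++ [ x ])
    len-eq = begin
      suc (length (xs ++ ys))              ≡⟨ +-comm 1 _ ⟩
      length (xs ++ ys) + 1                ≡⟨ sym (length-++ (xs ++ ys)) ⟩
      length ((xs ++ ys) ++ [ x ])         ≡⟨ cong length (++-assoc xs ys [ x ]) ⟩
      length (xs ++ ys ++ [ x ]) ∎

  -- A circuit w is a list whose last letter is followed by its first one.
  close : List V → List V
  close []       = []
  close (x ∷ xs) = x ∷ xs ++ [ x ]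

  steps : V → V → List V → ℕ
  steps u v []           = 0
  steps u v (x ∷ [])     = 0
  steps u v (x ∷ y ∷ ys) = δ u x * δ v y + steps u v (y ∷ ys)

  uses : V → V → List V → ℕ
  uses u v w = steps u v w + steps v u w

  occ : V → List V → ℕ
  occ u []       = 0
  occ u (x ∷ xs) = δ u x + occ u xs

  steps-++ : ∀ u v xs a ys → steps u v (xs ++ a ∷ ys) ≡ steps u v (xs ++ [ a ]) + steps u v (a ∷ ys)
  steps-++ u v []           a ys = refl
  steps-++ u v (x ∷ [])     a ys = cong (_+ steps u v (a ∷ ys)) (sym (+-identityʳ (δ u x * δ v a)))
  steps-++ u v (x ∷ y ∷ xs) a ys =
    trans (cong (δ u x * δ v y +_) (steps-++ u v (y ∷ xs) a ys)) (sym (+-assoc (δ u x * δ v y) _ _))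

  steps-reverse : ∀ u v xs → steps u v (reverse xs) ≡ steps v u xs
  steps-reverse u v []           = refl
  steps-reverse u v (x ∷ [])     = refl
  steps-reverse u v (x ∷ y ∷ ys) = begin
    steps u v (reverse (x ∷ y ∷ ys))          ≡⟨ cong (steps u v) (unfold-reverse x (y ∷ ys)) ⟩
    steps u v (reverse (y ∷ ys) ++ [ x ])     ≡⟨ cong (λ l → steps u v (l ++ [ x ])) (unfold-reverse y ys) ⟩
    steps u v ((reverse ys ++ [ y ]) ++ [ x ])  ≡⟨ cong (steps u v) (++-assoc (reverse ys) [ y ] [ x ]) ⟩
    steps u v (reverse ys ++ y ∷ x ∷ [])      ≡⟨ steps-++ u v (reverse ys) y [ x ] ⟩
    steps u v (reverse ys ++ [ y ]) + (δ u y * δ v x + 0)  ≡⟨ cong (λ l → steps u v l + (δ u y * δ v x + 0)) (sym (unfold-reverse y ys)) ⟩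
    steps u v (reverse (y ∷ ys)) + (δ u y * δ v x + 0)  ≡⟨ cong (_+ (δ u y * δ v x + 0)) (steps-reverse u v (y ∷ ys)) ⟩
    steps v u (y ∷ ys) + (δ u y * δ v x + 0)  ≡⟨ lem (steps v u (y ∷ ys)) (δ u y) (δ v x) ⟩
    δ v x * δ u y + steps v u (y ∷ ys) ∎
    where
    open ≡-Reasoning
    lem : ∀ a b c → a + (b * c + 0) ≡ c * b + a
    lem = solve-∀

  uses-++ : ∀ u v xs a ys → uses u v (xs ++ a ∷ ys) ≡ uses u v (xs ++ [ a ]) + uses u v (a ∷ ys)
  uses-++ u v xs a ys rewrite steps-++ u v xs a ys | steps-++ v u xs a ys =
    lem (steps u v (xs ++ [ a ])) (steps u v (a ∷ ys)) (steps v u (xs ++ [ a ])) (steps v u (a ∷ ys))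
    where lem : ∀ a b c d → a + b + (c + d) ≡ a + c + (b + d)
          lem = solve-∀

  uses-reverse : ∀ u v xs → uses u v (reverse xs) ≡ uses u v xs
  uses-reverse u v xs rewrite steps-reverse u v xs | steps-reverse v u xs = +-comm (steps v u xs) _

  -- The stretch from `a` to `a` is a closed trail; read backwards it passes the same undirected
  -- edges.
  uses-flip : ∀ u v xs a ys zs →
    uses u v (xs ++ a ∷ reverse ys ++ a ∷ zs) ≡ uses u v (xs ++ a ∷ ys ++ a ∷ zs)
  uses-flip u v xs a ys zs = begin
    uses u v (xs ++ a ∷ reverse ys ++ a ∷ zs)  ≡⟨ uses-++ u v xs a _ ⟩
    uses u v (xs ++ [ a ]) + uses u v ((a ∷ reverse ys) ++ a ∷ zs)
      ≡⟨ cong (uses u v (xs ++ [ a ]) +_) (trans (uses-++ u v (a ∷ reverse ys) a zs)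
           (trans (cong (_+ uses u v (a ∷ zs)) middle) (sym (uses-++ u v (a ∷ ys) a zs)))) ⟩
    uses u v (xs ++ [ a ]) + uses u v ((a ∷ ys) ++ a ∷ zs)  ≡⟨ sym (uses-++ u v xs a _) ⟩
    uses u v (xs ++ a ∷ ys ++ a ∷ zs) ∎
    where
    open ≡-Reasoning
    middle : uses u v ((a ∷ reverse ys) ++ [ a ]) ≡ uses u v ((a ∷ ys) ++ [ a ])
    middle = begin
      uses u v (a ∷ reverse ys ++ [ a ])  ≡⟨ cong (λ l → uses u v (a ∷ l)) (sym (unfold-reverse a ys)) ⟩
      uses u v (a ∷ reverse (a ∷ ys))     ≡⟨ cong (uses u v) (sym (reverse-++ (a ∷ ys) [ a ])) ⟩
      uses u v (reverse (a ∷ ys ++ [ a ]))  ≡⟨ uses-reverse u v (a ∷ ys ++ [ a ]) ⟩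
      uses u v (a ∷ ys ++ [ a ]) ∎

  occ-++ : ∀ u xs ys → occ u (xs ++ ys) ≡ occ u xs + occ u ys
  occ-++ u []       ys = refl
  occ-++ u (x ∷ xs) ys = trans (cong (δ u x +_) (occ-++ u xs ys)) (sym (+-assoc (δ u x) _ _))

-- Patterns and the words they stand for.

-- A pattern is a cyclic word of letters and of hidden segments, possibly reversed.
data Tok : Set where
  L : ℕ → Tok
  Z : ℕ → Bool → Tok

flipT : Tok → Tok
flipT (L a)   = L a
flipT (Z k r) = Z k (not r)

revT : List Tok → List Tok
revT []      = []
revT (t ∷ P) = revT P ++ [ flipT t ]

cnt : ℕ → List Tok → ℕ
cnt a []            = 0
cnt a (L b ∷ P)     = b2n (a ≡ᵇ b) + cnt a P
cnt a (Z _ _ ∷ P)   = cnt a P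

closeT : List Tok → List Tok
closeT []      = []
closeT (t ∷ P) = t ∷ P ++ [ t ]

-- Only steps between neighbouring visible letters are certain: across a hidden segment nothing is
-- known, not even whether the segment is empty.
vsteps : ℕ → ℕ → List Tok → ℕ
vsteps a b (L x ∷ L y ∷ P) = b2n ((a ≡ᵇ x) ∧ (b ≡ᵇ y)) + vsteps a b (L y ∷ P)
vsteps a b (_ ∷ P)         = vsteps a b P
vsteps a b []              = 0

upd : {A : Set} → (ℕ → A) → ℕ → A → ℕ → A
upd f k x j = if j ≡ᵇ k then x else f j

upd-same : ∀ {A : Set} (f : ℕ → A) k x → upd f k x k ≡ x
upd-same f zero x = refl
upd-same f (suc k) x = upd-same (λ j → f (suc j)) k x

State : Set
State = List Tok × List (ℕ × ℕ)

rename : ℕ → ℕ → ℕ → ℕ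
rename a b x = if x ≡ᵇ b then a else x

mergeT : ℕ → ℕ → List Tok → List Tok
mergeT a b []          = []
mergeT a b (L x ∷ P)   = L (rename a b x) ∷ mergeT a b P
mergeT a b (Z k r ∷ P) = Z k r ∷ mergeT a b P

mergeD : ℕ → ℕ → List (ℕ × ℕ) → List (ℕ × ℕ)
mergeD a b []            = []
mergeD a b ((x , y) ∷ D) = (rename a b x , rename a b y) ∷ mergeD a b D

merge : ℕ → ℕ → State → State
merge a b (P , D) = mergeT a b P , mergeD a b D

T≡ : ∀ {a b} → (a ≡ᵇ b) ≡ true → a ≡ b
T≡ {a} {b} h = ≡ᵇ⇒≡ a b (subst T (sym h) _)

-- The knowledge about the letter at some offset. Once the count runs into a hidden segment, the
-- rest of the pattern and of the offset are kept, since a complete letter may still be excluded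
-- there.
data Look : Set where
  none   : Look
  letter : ℕ → Look
  hidden : List Tok → ℕ → Look

look : List Tok → ℕ → Look
look []          d       = none
look (L a ∷ P)   zero    = letter a
look (L a ∷ P)   (suc d) = look P d
look (Z k r ∷ P) d       = hidden (Z k r ∷ P) d

-- The letter c is not among the next d + 1 letters of P, hidden segments being skipped.
avoids : ℕ → List Tok → ℕ → Bool
avoids c []          d       = true
avoids c (Z _ _ ∷ P) d       = avoids c P d
avoids c (L x ∷ P)   zero    = not (c ≡ᵇ x)
avoids c (L x ∷ P)   (suc d) = not (c ≡ᵇ x) ∧ avoids c P d

low : Look → Look → ℕ
low (letter a) (letter b) = b2n (a ≡ᵇ b)
low _          _          = 0

-- The sum of the two offsets, before and behind a cut, stays constant: these are the pairs at one
-- distance that straddle the cut. The estimate `f` is `low` or `up`.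
sumT : (Look → Look → ℕ) → ℕ → ℕ → List Tok → List Tok → ℕ
sumT f i zero    X Y = f (look X i) (look Y 0)
sumT f i (suc d) X Y = f (look X i) (look Y (suc d)) + sumT f (suc i) d X Y

crossT : (Look → Look → ℕ) → ℕ → List Tok → List Tok → ℕ
crossT f d X Y = sumT f 0 d X Y

linLow : ℕ → List Tok → ℕ
linLow d []          = 0
linLow d (L a ∷ P)   = low (letter a) (look P d) + linLow d P
linLow d (Z _ _ ∷ P) = linLow d P

gapsLow : ℕ → List Tok → ℕ
gapsLow d P = linLow d P + crossT low d (revT P) P

module Sem {n : ℕ} where
  open Words {n}

  tok : (ℕ → V) → (ℕ → List V) → Tok → List V
  tok σ ζ (L a)       = [ σ a ]
  tok σ ζ (Z k false) = ζ k
  tok σ ζ (Z k true)  = reverse (ζ k)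

  ev : (ℕ → V) → (ℕ → List V) → List Tok → List V
  ev σ ζ []      = []
  ev σ ζ (t ∷ P) = tok σ ζ t ++ ev σ ζ P

  Apart : (ℕ → V) → List (ℕ × ℕ) → Set
  Apart σ = All (λ p → σ (proj₁ p) ≢ σ (proj₂ p))

  module _ (σ : ℕ → V) (ζ : ℕ → List V) where

    private
      ⟦_⟧ : List Tok → List V
      ⟦ P ⟧ = ev σ ζ P

    ev-++ : ∀ P Q → ⟦ P ++ Q ⟧ ≡ ⟦ P ⟧ ++ ⟦ Q ⟧
    ev-++ []      Q = refl
    ev-++ (t ∷ P) Q = trans (cong (tok σ ζ t ++_) (ev-++ P Q)) (sym (++-assoc (tok σ ζ t) _ _))

    tok-flip : ∀ t → tok σ ζ (flipT t) ≡ reverse (tok σ ζ t)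
    tok-flip (L a)       = refl
    tok-flip (Z k false) = refl
    tok-flip (Z k true)  = sym (reverse-involutive (ζ k))

    ev-rev : ∀ P → ⟦ revT P ⟧ ≡ reverse ⟦ P ⟧
    ev-rev []      = refl
    ev-rev (t ∷ P) = begin
      ⟦ revT P ++ [ flipT t ] ⟧             ≡⟨ ev-++ (revT P) [ flipT t ] ⟩
      ⟦ revT P ⟧ ++ tok σ ζ (flipT t) ++ []  ≡⟨ cong₂ _++_ (ev-rev P) (trans (++-identityʳ _) (tok-flip t)) ⟩
      reverse ⟦ P ⟧ ++ reverse (tok σ ζ t)  ≡⟨ sym (reverse-++ (tok σ ζ t) ⟦ P ⟧) ⟩
      reverse ⟦ t ∷ P ⟧ ∎
      where open ≡-Reasoning

    ev-close : ∀ a P → ⟦ closeT (L a ∷ P) ⟧ ≡ close ⟦ L a ∷ P ⟧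
    ev-close a P = cong (σ a ∷_) (ev-++ P [ L a ])

    -- Only an inequality, because the vertex may also be present under other names or inside hidden
    -- segments.
    cnt≤occ : ∀ a P → cnt a P ≤ occ (σ a) ⟦ P ⟧
    cnt≤occ a []          = z≤n
    cnt≤occ a (Z k r ∷ P) = ≤-trans (cnt≤occ a P)
      (≤-trans (m≤n+m _ (occ (σ a) (tok σ ζ (Z k r)))) (≤-reflexive (sym (occ-++ (σ a) (tok σ ζ (Z k r)) ⟦ P ⟧))))
    cnt≤occ a (L b ∷ P) with a ≡ᵇ b in eq
    ... | false = ≤-trans (cnt≤occ a P) (m≤n+m _ (δ (σ a) (σ b)))
    ... | true  = +-mono-≤ (≤-reflexive (sym (δ-≡1 (cong σ (T≡ {a} {b} eq))))) (cnt≤occ a P)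

    steps-∷ : ∀ u v x xs → steps u v xs ≤ steps u v (x ∷ xs)
    steps-∷ u v x []       = z≤n
    steps-∷ u v x (y ∷ xs) = m≤n+m _ _

    steps-++ʳ : ∀ u v xs ys → steps u v ys ≤ steps u v (xs ++ ys)
    steps-++ʳ u v []       ys = ≤-refl
    steps-++ʳ u v (x ∷ xs) ys = ≤-trans (steps-++ʳ u v xs ys) (steps-∷ u v x (xs ++ ys))

    vsteps≤steps : ∀ a b P → vsteps a b P ≤ steps (σ a) (σ b) ⟦ P ⟧
    vsteps≤steps a b [] = z≤n
    vsteps≤steps a b (Z k r ∷ P) =
      ≤-trans (vsteps≤steps a b P) (steps-++ʳ (σ a) (σ b) (tok σ ζ (Z k r)) ⟦ P ⟧)
    vsteps≤steps a b (L x ∷ []) = z≤n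
    vsteps≤steps a b (L x ∷ Z k r ∷ P) =
      ≤-trans (vsteps≤steps a b (Z k r ∷ P)) (steps-∷ (σ a) (σ b) (σ x) ⟦ Z k r ∷ P ⟧)
    vsteps≤steps a b (L x ∷ L y ∷ P) = +-mono-≤ head (vsteps≤steps a b (L y ∷ P))
      where
      head : b2n ((a ≡ᵇ x) ∧ (b ≡ᵇ y)) ≤ δ (σ a) (σ x) * δ (σ b) (σ y)
      head with a ≡ᵇ x in e₁ | b ≡ᵇ y in e₂
      ... | false | _     = z≤n
      ... | true  | false = z≤n
      ... | true  | true  = ≤-reflexive (sym (cong₂ _*_ (δ-≡1 (cong σ (T≡ {a} {x} e₁))) (δ-≡1 (cong σ (T≡ {b} {y} e₂)))))

    rename-σ : ∀ a b → σ a ≡ σ b → ∀ x → σ (rename a b x) ≡ σ x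
    rename-σ a b e x with x ≡ᵇ b in eq
    ... | false = refl
    ... | true  = trans e (cong σ (sym (T≡ {x} {b} eq)))

    ev-merge : ∀ a b → σ a ≡ σ b → ∀ P → ⟦ mergeT a b P ⟧ ≡ ⟦ P ⟧
    ev-merge a b e []          = refl
    ev-merge a b e (L x ∷ P)   = cong₂ _∷_ (rename-σ a b e x) (ev-merge a b e P)
    ev-merge a b e (Z k r ∷ P) = cong (tok σ ζ (Z k r) ++_) (ev-merge a b e P)

    apart-merge : ∀ a b → σ a ≡ σ b → ∀ {D} → Apart σ D → Apart σ (mergeD a b D)
    apart-merge a b e []       = []
    apart-merge a b e (p ∷ ps) =
      (λ q → p (trans (sym (rename-σ a b e _)) (trans q (rename-σ a b e _)))) ∷ apart-merge a b e ps

    Sees : Look → Maybe V → Set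
    Sees none         m = m ≡ nothing
    Sees (letter a)   m = m ≡ just (σ a)
    Sees (hidden P d) m = m ≡ ⟦ P ⟧ !? d

    look-sees : ∀ P d → Sees (look P d) (⟦ P ⟧ !? d)
    look-sees []          d       = refl
    look-sees (L a ∷ P)   zero    = refl
    look-sees (L a ∷ P)   (suc d) = look-sees P d
    look-sees (Z k r ∷ P) d       = refl

    low≤ : ∀ l l′ {m m′} → Sees l m → Sees l′ m′ → low l l′ ≤ δ? m m′
    low≤ none         l′           _    _ = z≤n
    low≤ (hidden _ _) l′           _    _ = z≤n
    low≤ (letter a)   none         _    _ = z≤n
    low≤ (letter a)   (hidden _ _) _    _ = z≤n
    low≤ (letter a)   (letter b)   refl refl with a ≡ᵇ b in eq
    ... | false = z≤n
    ... | true  = ≤-reflexive (sym (δ-≡1 (cong σ (T≡ {a} {b} eq))))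

    -- `cross` with explicit offsets, brought into the shape of `sumT`.
    sumP : ℕ → ℕ → List V → List V → ℕ
    sumP i zero    xr ys = δ? (xr !? i) (ys !? 0)
    sumP i (suc d) xr ys = δ? (xr !? i) (ys !? suc d) + sumP (suc i) d xr ys

    sumP-[] : ∀ i d ys → sumP i d [] ys ≡ 0
    sumP-[] i zero    ys = refl
    sumP-[] i (suc d) ys = sumP-[] (suc i) d ys

    sumP-suc : ∀ i d x xr ys → sumP (suc i) d (x ∷ xr) ys ≡ sumP i d xr ys
    sumP-suc i zero    x xr ys = refl
    sumP-suc i (suc d) x xr ys = cong (δ? (xr !? i) (ys !? suc d) +_) (sumP-suc (suc i) d x xr ys)

    cross≡sumP : ∀ d xr ys → cross d xr ys ≡ sumP 0 d xr ys
    cross≡sumP zero    []       ys = refl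
    cross≡sumP (suc d) []       ys = sym (sumP-[] 1 d ys)
    cross≡sumP zero    (x ∷ xr) ys = refl
    cross≡sumP (suc d) (x ∷ xr) ys =
      cong (δ? (just x) (ys !? suc d) +_) (trans (cross≡sumP d xr ys) (sym (sumP-suc 0 d x xr ys)))

    sumLow≤ : ∀ i d X Y → sumT low i d X Y ≤ sumP i d ⟦ X ⟧ ⟦ Y ⟧
    sumLow≤ i zero    X Y = low≤ (look X i) (look Y 0) (look-sees X i) (look-sees Y 0)
    sumLow≤ i (suc d) X Y = +-mono-≤ (low≤ (look X i) (look Y (suc d)) (look-sees X i) (look-sees Y (suc d)))
                                     (sumLow≤ (suc i) d X Y)

    crossLow≤ : ∀ d X Y → crossT low d X Y ≤ cross d ⟦ X ⟧ ⟦ Y ⟧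
    crossLow≤ d X Y = ≤-trans (sumLow≤ 0 d X Y) (≤-reflexive (sym (cross≡sumP d ⟦ X ⟧ ⟦ Y ⟧)))

    lin-++ʳ : ∀ d xs ys → lin d ys ≤ lin d (xs ++ ys)
    lin-++ʳ d []       ys = ≤-refl
    lin-++ʳ d (x ∷ xs) ys = ≤-trans (lin-++ʳ d xs ys) (m≤n+m _ _)

    linLow≤ : ∀ d P → linLow d P ≤ lin d ⟦ P ⟧
    linLow≤ d []          = z≤n
    linLow≤ d (L a ∷ P)   = +-mono-≤ (low≤ (letter a) (look P d) refl (look-sees P d)) (linLow≤ d P)
    linLow≤ d (Z k r ∷ P) = ≤-trans (linLow≤ d P) (lin-++ʳ d (tok σ ζ (Z k r)) ⟦ P ⟧)

    gapsLow≤ : ∀ d P → gapsLow d P ≤ gaps d ⟦ P ⟧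
    gapsLow≤ d P = +-mono-≤ (linLow≤ d P)
      (subst (λ l → crossT low d (revT P) P ≤ cross d l ⟦ P ⟧) (ev-rev P) (crossLow≤ d (revT P) P))

    -- c stands for no other letter of the pattern and for no vertex of a hidden segment.
    Ok : ℕ → Tok → Set
    Ok c (L x)   = σ x ≡ σ c → x ≡ c
    Ok c (Z k r) = σ c ∉ ζ k

    Ok-flip : ∀ c t → Ok c t → Ok c (flipT t)
    Ok-flip c (L x)   o = o
    Ok-flip c (Z k r) o = o

    occ≡0⇒∉ : ∀ {u xs} → occ u xs ≡ 0 → u ∉ xs
    occ≡0⇒∉ {u} {x ∷ xs} e (here refl) with () ← trans (sym (cong (_+ occ u xs) (δ-refl u))) e
    occ≡0⇒∉ {u} {x ∷ xs} e (there i) = occ≡0⇒∉ (m+n≡0⇒n≡0 (δ u x) e) i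

    occ-reverse : ∀ u xs → occ u (reverse xs) ≡ occ u xs
    occ-reverse u []       = refl
    occ-reverse u (x ∷ xs) = begin
      occ u (reverse (x ∷ xs))            ≡⟨ cong (occ u) (unfold-reverse x xs) ⟩
      occ u (reverse xs ++ [ x ])         ≡⟨ occ-++ u (reverse xs) [ x ] ⟩
      occ u (reverse xs) + (δ u x + 0)    ≡⟨ cong₂ _+_ (occ-reverse u xs) (+-identityʳ _) ⟩
      occ u xs + δ u x                    ≡⟨ +-comm (occ u xs) _ ⟩
      δ u x + occ u xs ∎
      where open ≡-Reasoning

    -- When the occurrences named `c` account for all occurrences of the vertex, nothing is left for
    -- other names and for hidden segments.
    complete⇒Ok : ∀ c P → occ (σ c) ⟦ P ⟧ ≤ cnt c P → All (Ok c) P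
    complete⇒Ok c []          h = []
    complete⇒Ok c (Z k r ∷ P) h = occ≡0⇒∉ (trans (occZ r) zero-occ) ∷ complete⇒Ok c P (≤-trans (m≤n+m _ (occ (σ c) (tok σ ζ (Z k r)))) h′)
      where
      h′ : occ (σ c) (tok σ ζ (Z k r)) + occ (σ c) ⟦ P ⟧ ≤ cnt c P
      h′ = subst (_≤ cnt c P) (occ-++ (σ c) (tok σ ζ (Z k r)) ⟦ P ⟧) h
      zero-occ : occ (σ c) (tok σ ζ (Z k r)) ≡ 0
      zero-occ = n≤0⇒n≡0 (+-cancelʳ-≤ (cnt c P) _ 0 (≤-trans (+-monoʳ-≤ (occ (σ c) (tok σ ζ (Z k r))) (cnt≤occ c P)) h′))
      occZ : ∀ r → occ (σ c) (ζ k) ≡ occ (σ c) (tok σ ζ (Z k r))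
      occZ false = refl
      occZ true  = sym (occ-reverse (σ c) (ζ k))
    complete⇒Ok c (L x ∷ P) h with c ≡ᵇ x in eq
    ... | true  = (λ _ → sym (T≡ {c} {x} eq)) ∷
                  complete⇒Ok c P (s≤s⁻¹ (subst (λ k → k + occ (σ c) ⟦ P ⟧ ≤ suc (cnt c P)) (δ-≡1 (cong σ (T≡ {c} {x} eq))) h))
    ... | false = (λ e → ⊥-elim (1+n≰n (≤-trans (+-monoʳ-≤ 1 (cnt≤occ c P)) (subst (λ k → k + occ (σ c) ⟦ P ⟧ ≤ cnt c P) (δ-≡1 (sym e)) h)))) ∷
                  complete⇒Ok c P (≤-trans (m≤n+m _ (δ (σ c) (σ x))) h)

    !?-split : ∀ (xs ys : List V) d v → (xs ++ ys) !? d ≡ just v → (v ∈ xs) ⊎ ∃[ e ] (e ≤ d × ys !? e ≡ just v)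
    !?-split []       ys d       v e = inj₂ (d , ≤-refl , e)
    !?-split (x ∷ xs) ys zero    v refl = inj₁ (here refl)
    !?-split (x ∷ xs) ys (suc d) v e with !?-split xs ys d v e
    ... | inj₁ i             = inj₁ (there i)
    ... | inj₂ (e′ , le , q) = inj₂ (e′ , m≤n⇒m≤1+n le , q)

    ∈-reverse : ∀ {v} (xs : List V) → v ∈ reverse xs → v ∈ xs
    ∈-reverse (x ∷ xs) i with ∈-++⁻ (reverse xs) (subst (_ ∈_) (unfold-reverse x xs) i)
    ... | inj₁ j           = there (∈-reverse xs j)
    ... | inj₂ (here refl) = here refl

    ∈-tok : ∀ {v} k r → v ∈ tok σ ζ (Z k r) → v ∈ ζ k
    ∈-tok k false i = i
    ∈-tok k true  i = ∈-reverse (ζ k) i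

    -- All offsets `e` up to `d` are treated at once, since a hidden segment consumes an unknown
    -- part of the offset.
    avoids-sound : ∀ c P d e → All (Ok c) P → avoids c P d ≡ true → e ≤ d → ⟦ P ⟧ !? e ≢ just (σ c)
    avoids-sound c (Z k r ∷ P) d e (o ∷ os) h le q with !?-split (tok σ ζ (Z k r)) ⟦ P ⟧ e (σ c) q
    ... | inj₁ i              = o (∈-tok k r i)
    ... | inj₂ (e′ , le′ , q′) = avoids-sound c P d e′ os h (≤-trans le′ le) q′
    avoids-sound c (L x ∷ P) zero zero (o ∷ os) h z≤n q with c ≡ᵇ x in eq
    ... | false = subst T eq (≡⇒≡ᵇ c x (sym (o (just-inj q))))
      where just-inj : ∀ {a b : V} → just a ≡ just b → a ≡ b
            just-inj refl = refl
    avoids-sound c (L x ∷ P) (suc d) zero (o ∷ os) h le q with c ≡ᵇ x in eq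
    ... | false = subst T eq (≡⇒≡ᵇ c x (sym (o (just-inj q))))
      where just-inj : ∀ {a b : V} → just a ≡ just b → a ≡ b
            just-inj refl = refl
    avoids-sound c (L x ∷ P) (suc d) (suc e) (o ∷ os) h (s≤s le) q with c ≡ᵇ x
    ... | false = avoids-sound c P d e os h le q

dec : ∀ {A : Set} → Dec A → Maybe A
dec (yes p) = just p
dec (no _)  = nothing

infixr 1 _orElse_
_orElse_ : ∀ {A : Set} → Maybe A → Maybe A → Maybe A
just x  orElse _ = just x
nothing orElse y = y

∀<? : ∀ {Q : ℕ → Set} m → (∀ i → Maybe (Q i)) → Maybe (∀ i → i < m → Q i)
∀<? zero    f = just λ _ ()
∀<? {Q} (suc m) f = do
  q  ← f m
  qs ← ∀<? m f
  just (ext q qs)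
  where
  ext : Q m → (∀ i → i < m → Q i) → ∀ i → i < suc m → Q i
  ext q qs i (s≤s h) with ℕₚ.m≤n⇒m<n∨m≡n h
  ... | inj₁ lt   = qs i lt
  ... | inj₂ refl = q

toks≟ : (P Q : List Tok) → Maybe (P ≡ Q)
toks≟ []      []      = just refl
toks≟ (L a ∷ P) (L b ∷ Q) = do
  e  ← dec (a ℕₚ.≟ b)
  e′ ← toks≟ P Q
  just (cong₂ (λ x y → L x ∷ y) e e′)
toks≟ (Z k false ∷ P) (Z l false ∷ Q) = do
  e  ← dec (k ℕₚ.≟ l)
  e′ ← toks≟ P Q
  just (cong₂ (λ x y → Z x false ∷ y) e e′)
toks≟ (Z k true ∷ P) (Z l true ∷ Q) = do
  e  ← dec (k ℕₚ.≟ l)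
  e′ ← toks≟ P Q
  just (cong₂ (λ x y → Z x true ∷ y) e e′)
toks≟ _ _ = nothing

-- Runs: the division of a flipped pattern.

-- Maximal stretches of a pattern that a sequence of flips moves as a whole; the key is the
-- original position, and the body is kept in its original orientation.
record Run : Set where
  constructor run
  field
    key  : ℕ
    rev  : Bool
    body : List Tok

val : Run → List Tok
val (run _ false b) = b
val (run _ true  b) = revT b

cat : List Run → List Tok
cat []       = []
cat (r ∷ rs) = val r ++ cat rs

insertRun : Run → List Run → List Run
insertRun r []       = [ r ]
insertRun r (s ∷ rs) = if Run.key r ≤ᵇ Run.key s then r ∷ s ∷ rs else s ∷ insertRun r rs

-- Undoes the flips: the runs return to their original order and orientation.
restore : List Run → List Run
restore []       = []
restore (r ∷ rs) = insertRun (run (Run.key r) false (Run.body r)) (restore rs)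

Tagged : Set
Tagged = ℕ × Tok

untag : List Tagged → List Tok
untag = map proj₂

tagFrom : ℕ → List Tok → List Tagged
tagFrom i []      = []
tagFrom i (t ∷ P) = (i , t) ∷ tagFrom (suc i) P

untag-tagFrom : ∀ i P → untag (tagFrom i P) ≡ P
untag-tagFrom i []      = refl
untag-tagFrom i (t ∷ P) = cong (t ∷_) (untag-tagFrom (suc i) P)

revTagged : List Tagged → List Tagged
revTagged []            = []
revTagged ((i , t) ∷ P) = revTagged P ++ [ (i , flipT t) ]

untag-rev : ∀ P → untag (revTagged P) ≡ revT (untag P)
untag-rev []            = refl
untag-rev ((i , t) ∷ P) = trans (map-++ proj₂ (revTagged P) _) (cong (_++ [ flipT t ]) (untag-rev P))

-- A heuristic whose answers are verified in `better?`: the runs must concatenate to the flipped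
-- pattern and, after `restore`, to the original one, in both cases up to the proposed rotation.
module Plan (N : ℕ) where

  nxt : ℕ → ℕ
  nxt k = if suc k ≡ᵇ N then 0 else suc k

  forward backward : Tok → Bool
  forward (L _)   = true
  forward (Z _ r) = not r
  backward (L _)   = true
  backward (Z _ r) = r

  up down : Tagged → Tagged → Bool
  up   (i , t) (j , u) = (j ≡ᵇ nxt i) ∧ forward t ∧ forward u
  down (i , t) (j , u) = (i ≡ᵇ nxt j) ∧ backward t ∧ backward u

  -- The first joint: a place where neighbours in the flipped pattern were not neighbours before.
  -- Rotating to it keeps the start of the list from cutting a run in two.
  breakAt : Tagged → List Tagged → ℕ
  breakAt t []      = 0
  breakAt t (u ∷ P) = if up t u ∨ down t u then suc (breakAt u P) else 1

  ascending descending : Tagged → List Tagged → List Tagged × List Tagged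
  ascending t []      = [ t ] , []
  ascending t (u ∷ P) = if up t u then (let (a , b) = ascending u P in t ∷ a , b) else ([ t ] , u ∷ P)
  descending t []      = [ t ] , []
  descending t (u ∷ P) = if down t u then (let (a , b) = descending u P in t ∷ a , b) else ([ t ] , u ∷ P)

  runFwd : List Tagged → Run
  runFwd []            = run 0 false []
  runFwd ((i , t) ∷ P) = run i false (t ∷ untag P)

  runBwd : List Tagged → Run
  runBwd P with revTagged P
  ... | []            = run 0 true []
  ... | ((i , t) ∷ Q) = run i true (t ∷ untag Q)

  runs : ℕ → List Tagged → List Run
  runs zero    _       = []
  runs (suc f) []      = []
  runs (suc f) (t ∷ []) = if forward (proj₂ t) then [ runFwd [ t ] ] else [ runBwd [ t ] ]
  runs (suc f) (t ∷ u ∷ P) =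
    if up t u then (let (a , b) = ascending t (u ∷ P) in runFwd a ∷ runs f b)
    else if down t u then (let (a , b) = descending t (u ∷ P) in runBwd a ∷ runs f b)
    else (if forward (proj₂ t) then runFwd [ t ] else runBwd [ t ]) ∷ runs f (u ∷ P)

  -- Original positions are counted cyclically from `s`, the start of a run, so that sorting by key
  -- does not tear a run that passes the end of the pattern.
  shift : ℕ → Run → Run
  shift s (run k r b) = run (if s ≤ᵇ k then k ∸ s else k + N ∸ s) r b

rotate : ∀ {A : Set} → ℕ → List A → List A
rotate k P = drop k P ++ take k P

-- The rotations of the flipped and of the original pattern that start at a cut, and the runs of
-- the former.
plan : List Tagged → ℕ × ℕ × List Run
plan []      = 0 , 0 , []
plan (t ∷ Q) = r , s , map (Plan.shift N s) rs
  where
  N = length (t ∷ Q)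
  r = Plan.breakAt N t Q
  rs = Plan.runs N N (rotate r (t ∷ Q))
  s : ℕ
  s with rs
  ... | []        = 0
  ... | (run k _ _ ∷ _) = k

crosses : (Look → Look → ℕ) → ℕ → List Run → ℕ
crosses g d []       = 0
crosses g d (r ∷ rs) = crossT g d (revT (val r)) (cat rs) + crosses g d rs

total : (Look → Look → ℕ) → ℕ → List Run → ℕ
total g d rs = crosses g d rs + crossT g d (revT (cat rs)) (cat rs)

-- A pair counts unless it is excluded. A letter cannot equal a member of a hidden stretch if both
-- its occurrences are visible and neither can be reached within the offset.
up : (ℕ → ℕ → Bool) → (ℕ → Bool) → Look → Look → ℕ
up dist comp none         _            = 0
up dist comp (letter a)   none         = 0
up dist comp (hidden _ _) none         = 0
up dist comp (letter a)   (letter b)   = if dist a b then 0 else 1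
up dist comp (letter c)   (hidden Q d) = if comp c ∧ avoids c Q d then 0 else 1
up dist comp (hidden Q d) (letter c)   = if comp c ∧ avoids c Q d then 0 else 1
up dist comp (hidden _ _) (hidden _ _) = 1

-- Bounds for recurrences that hold whatever the hidden segments are.

module Bounds {n : ℕ} (σ : ℕ → Fin n) (ζ : ℕ → List (Fin n)) where
  open Words {n}
  open Sem {n}

  private
    ⟦_⟧ : List Tok → List V
    ⟦ P ⟧ = ev σ ζ P

  linsum : ℕ → List Run → ℕ
  linsum d []       = 0
  linsum d (r ∷ rs) = lin d ⟦ Run.body r ⟧ + linsum d rs

  lin-val : ∀ d r → lin d ⟦ val r ⟧ ≡ lin d ⟦ Run.body r ⟧
  lin-val d (run _ false b) = refl
  lin-val d (run _ true  b) = trans (cong (lin d) (ev-rev σ ζ b)) (lin-reverse d ⟦ b ⟧)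

  linsum-insert : ∀ d r rs → linsum d (insertRun r rs) ≡ lin d ⟦ Run.body r ⟧ + linsum d rs
  linsum-insert d r []       = refl
  linsum-insert d r (s ∷ rs) with Run.key r ≤ᵇ Run.key s
  ... | true  = refl
  ... | false = trans (cong (lin d ⟦ Run.body s ⟧ +_) (linsum-insert d r rs))
                      (lem (lin d ⟦ Run.body s ⟧) (lin d ⟦ Run.body r ⟧) (linsum d rs))
    where lem : ∀ a b c → a + (b + c) ≡ b + (a + c)
          lem = solve-∀

  -- The unknown part of the count. Recurrences within runs depend neither on the order nor on the
  -- orientation of the runs, so this term cancels when the old and the new circuit are compared.
  linsum-restore : ∀ d rs → linsum d (restore rs) ≡ linsum d rs
  linsum-restore d []       = refl
  linsum-restore d (r ∷ rs) =
    trans (linsum-insert d _ (restore rs)) (cong (lin d ⟦ Run.body r ⟧ +_) (linsum-restore d rs))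

  lin-cat : ∀ d r rs → lin d ⟦ cat (r ∷ rs) ⟧ ≡
            lin d ⟦ Run.body r ⟧ + lin d ⟦ cat rs ⟧ + cross d ⟦ revT (val r) ⟧ ⟦ cat rs ⟧
  lin-cat d r rs = begin
    lin d ⟦ val r ++ cat rs ⟧                   ≡⟨ cong (lin d) (ev-++ σ ζ (val r) (cat rs)) ⟩
    lin d (⟦ val r ⟧ ++ ⟦ cat rs ⟧)             ≡⟨ lin-++ d ⟦ val r ⟧ ⟦ cat rs ⟧ ⟩
    lin d ⟦ val r ⟧ + lin d ⟦ cat rs ⟧ + cross d (reverse ⟦ val r ⟧) ⟦ cat rs ⟧
      ≡⟨ cong₂ (λ a l → a + lin d ⟦ cat rs ⟧ + cross d l ⟦ cat rs ⟧) (lin-val d r) (sym (ev-rev σ ζ (val r))) ⟩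
    lin d ⟦ Run.body r ⟧ + lin d ⟦ cat rs ⟧ + cross d ⟦ revT (val r) ⟧ ⟦ cat rs ⟧ ∎
    where open ≡-Reasoning

  private
    shuffle : ∀ a b c e → a + b + (c + e) ≡ a + (b + e) + c
    shuffle = solve-∀

  lin-low : ∀ d rs → linsum d rs + crosses low d rs ≤ lin d ⟦ cat rs ⟧
  lin-low d []       = z≤n
  lin-low d (r ∷ rs) = begin
    lin d ⟦ Run.body r ⟧ + linsum d rs + (crossT low d (revT (val r)) (cat rs) + crosses low d rs)
      ≡⟨ shuffle (lin d ⟦ Run.body r ⟧) (linsum d rs) _ _ ⟩
    lin d ⟦ Run.body r ⟧ + (linsum d rs + crosses low d rs) + crossT low d (revT (val r)) (cat rs)
      ≤⟨ +-mono-≤ (+-monoʳ-≤ (lin d ⟦ Run.body r ⟧) (lin-low d rs)) (crossLow≤ σ ζ d (revT (val r)) (cat rs)) ⟩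
    lin d ⟦ Run.body r ⟧ + lin d ⟦ cat rs ⟧ + cross d ⟦ revT (val r) ⟧ ⟦ cat rs ⟧
      ≡⟨ sym (lin-cat d r rs) ⟩
    lin d ⟦ cat (r ∷ rs) ⟧ ∎
    where open ≤-Reasoning

  gaps-low : ∀ d rs → linsum d rs + total low d rs ≤ gaps d ⟦ cat rs ⟧
  gaps-low d rs = begin
    linsum d rs + (crosses low d rs + crossT low d (revT (cat rs)) (cat rs))
      ≡⟨ sym (+-assoc (linsum d rs) _ _) ⟩
    linsum d rs + crosses low d rs + crossT low d (revT (cat rs)) (cat rs)
      ≤⟨ +-mono-≤ (lin-low d rs) (crossLow≤ σ ζ d (revT (cat rs)) (cat rs)) ⟩
    lin d ⟦ cat rs ⟧ + cross d ⟦ revT (cat rs) ⟧ ⟦ cat rs ⟧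
      ≡⟨ cong (λ l → lin d ⟦ cat rs ⟧ + cross d l ⟦ cat rs ⟧) (ev-rev σ ζ (cat rs)) ⟩
    gaps d ⟦ cat rs ⟧ ∎
    where open ≤-Reasoning

  module _ (dist : ℕ → ℕ → Bool) (comp : ℕ → Bool)
           (dist-sound : ∀ a b → dist a b ≡ true → σ a ≢ σ b) where

    Fine : Tok → Set
    Fine t = ∀ c → comp c ≡ true → Ok σ ζ c t

    fine-rev : ∀ {P} → All Fine P → All Fine (revT P)
    fine-rev []       = []
    fine-rev {t ∷ P} (f ∷ fs) = Allₚ.++⁺ (fine-rev fs) ((λ c h → Ok-flip σ ζ c t (f c h)) ∷ [])

    FineLook : Look → Set
    FineLook (hidden Q _) = All Fine Q
    FineLook _            = T true

    fine-look : ∀ P d → All Fine P → FineLook (look P d)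
    fine-look []          d       _        = _
    fine-look (L a ∷ P)   zero    _        = _
    fine-look (L a ∷ P)   (suc d) (_ ∷ fs) = fine-look P d fs
    fine-look (Z k r ∷ P) d       fs       = fs

    δ?≤1 : ∀ m m′ → δ? m m′ ≤ 1
    δ?≤1 (just x) (just y) = δ≤1 x y
    δ?≤1 (just x) nothing  = z≤n
    δ?≤1 nothing  (just y) = z≤n
    δ?≤1 nothing  nothing  = z≤n

    δ?-avoid : ∀ c Q d → All Fine Q → comp c ≡ true → avoids c Q d ≡ true → δ? (just (σ c)) (⟦ Q ⟧ !? d) ≡ 0
    δ?-avoid c Q d fs h h′ with ⟦ Q ⟧ !? d in eq
    ... | nothing = refl
    ... | just v  = δ-≢ (λ e → avoids-sound σ ζ c Q d d (All.map (λ f → f c h) fs) h′ ≤-refl (trans eq (cong just (sym e))))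

    up≥ : ∀ l l′ {m m′} → Sees σ ζ l m → Sees σ ζ l′ m′ → FineLook l → FineLook l′ → δ? m m′ ≤ up dist comp l l′
    up≥ none         l′           refl _ _ _ = z≤n
    up≥ (letter a)   none         refl refl _ _ = z≤n
    up≥ (hidden Q d) none {m}     refl refl _ _ = ≤-reflexive (δ?-nothingʳ m)
    up≥ (letter a)   (letter b)   refl refl _ _ with dist a b in eq
    ... | true  = ≤-reflexive (δ-≢ (dist-sound a b eq))
    ... | false = δ≤1 (σ a) (σ b)
    up≥ (letter c)   (hidden Q d) refl refl _ fs with comp c in e₁ | avoids c Q d in e₂
    ... | true  | true  = ≤-reflexive (δ?-avoid c Q d fs e₁ e₂)
    ... | true  | false = δ?≤1 (just (σ c)) (⟦ Q ⟧ !? d)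
    ... | false | _     = δ?≤1 (just (σ c)) (⟦ Q ⟧ !? d)
    up≥ (hidden Q d) (letter c)   refl refl fs _ with comp c in e₁ | avoids c Q d in e₂
    ... | true  | true  = ≤-reflexive (trans (δ?-sym (⟦ Q ⟧ !? d) _) (δ?-avoid c Q d fs e₁ e₂))
    ... | true  | false = δ?≤1 (⟦ Q ⟧ !? d) (just (σ c))
    ... | false | _     = δ?≤1 (⟦ Q ⟧ !? d) (just (σ c))
    up≥ (hidden _ _) (hidden _ _) {m} {m′} _ _ _ _ = δ?≤1 m m′

    private
      g : Look → Look → ℕ
      g = up dist comp

    sumUp≥ : ∀ i d X Y → All Fine X → All Fine Y → sumP σ ζ i d ⟦ X ⟧ ⟦ Y ⟧ ≤ sumT g i d X Y
    sumUp≥ i zero    X Y fx fy = up≥ (look X i) (look Y 0) (look-sees σ ζ X i) (look-sees σ ζ Y 0) (fine-look X i fx) (fine-look Y 0 fy)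
    sumUp≥ i (suc d) X Y fx fy =
      +-mono-≤ (up≥ (look X i) (look Y (suc d)) (look-sees σ ζ X i) (look-sees σ ζ Y (suc d)) (fine-look X i fx) (fine-look Y (suc d) fy))
               (sumUp≥ (suc i) d X Y fx fy)

    crossUp≥ : ∀ d X Y → All Fine X → All Fine Y → cross d ⟦ X ⟧ ⟦ Y ⟧ ≤ crossT g d X Y
    crossUp≥ d X Y fx fy = ≤-trans (≤-reflexive (cross≡sumP σ ζ d ⟦ X ⟧ ⟦ Y ⟧)) (sumUp≥ 0 d X Y fx fy)

    lin-up : ∀ d rs → All Fine (cat rs) → lin d ⟦ cat rs ⟧ ≤ linsum d rs + crosses g d rs
    lin-up d []       _  = z≤n
    lin-up d (r ∷ rs) fs = begin
      lin d ⟦ cat (r ∷ rs) ⟧ ≡⟨ lin-cat d r rs ⟩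
      lin d ⟦ Run.body r ⟧ + lin d ⟦ cat rs ⟧ + cross d ⟦ revT (val r) ⟧ ⟦ cat rs ⟧
        ≤⟨ +-mono-≤ (+-monoʳ-≤ (lin d ⟦ Run.body r ⟧) (lin-up d rs (Allₚ.++⁻ʳ (val r) fs)))
                    (crossUp≥ d (revT (val r)) (cat rs) (fine-rev (Allₚ.++⁻ˡ (val r) fs)) (Allₚ.++⁻ʳ (val r) fs)) ⟩
      lin d ⟦ Run.body r ⟧ + (linsum d rs + crosses g d rs) + crossT g d (revT (val r)) (cat rs)
        ≡⟨ sym (shuffle (lin d ⟦ Run.body r ⟧) (linsum d rs) _ _) ⟩
      lin d ⟦ Run.body r ⟧ + linsum d rs + (crossT g d (revT (val r)) (cat rs) + crosses g d rs) ∎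
      where open ≤-Reasoning

    gaps-up : ∀ d rs → All Fine (cat rs) → gaps d ⟦ cat rs ⟧ ≤ linsum d rs + total g d rs
    gaps-up d rs fs = begin
      gaps d ⟦ cat rs ⟧
        ≡⟨ cong (λ l → lin d ⟦ cat rs ⟧ + cross d l ⟦ cat rs ⟧) (sym (ev-rev σ ζ (cat rs))) ⟩
      lin d ⟦ cat rs ⟧ + cross d ⟦ revT (cat rs) ⟧ ⟦ cat rs ⟧
        ≤⟨ +-mono-≤ (lin-up d rs fs) (crossUp≥ d (revT (cat rs)) (cat rs) (fine-rev fs) fs) ⟩
      linsum d rs + crosses g d rs + crossT g d (revT (cat rs)) (cat rs)
        ≡⟨ +-assoc (linsum d rs) _ _ ⟩
      linsum d rs + total g d rs ∎
      where open ≤-Reasoning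

-- The checker and its soundness.

record Exceptional : Set where
  field
    size : ℕ
    adjacent : ℕ → ℕ → Bool
open Exceptional public

module Check {n : ℕ} (G : Graph n) (exceptional : ℕ → Exceptional) where
  open Words {n}
  open Sem {n}

  -- Both directions are added up, so each edge is passed exactly once. For `u = v` the equation
  -- forbids equal neighbours in the word, `adj G u u` being false.
  Euler : List V → Set
  Euler w = ∀ u v → uses u v (close w) ≡ b2n (adj G u v)

  cost : List V → ℕ
  cost w = 2 * gaps 2 w + gaps 3 w

  -- In effect an isomorphism: `f` is also onto, and it preserves non-adjacency.
  record Embeds (h : Exceptional) : Set where
    field
      f    : ℕ → V
      inj  : ∀ i j → i < size h → j < size h → f i ≡ f j → i ≡ j
      surj : ∀ v → ∃[ i ] (i < size h × f i ≡ v)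
      adjf : ∀ i j → i < size h → j < size h → adj G (f i) (f j) ≡ adjacent h i j

  Exc : Set
  Exc = ∃[ i ] Embeds (exceptional i)

  uses-rotate₁ : ∀ u v x ys → uses u v (close (x ∷ ys)) ≡ uses u v (close (ys ++ [ x ]))
  uses-rotate₁ u v x []       = refl
  uses-rotate₁ u v x (y ∷ ys) = begin
    uses u v ([ x ] ++ y ∷ ys ++ [ x ])                   ≡⟨ uses-++ u v [ x ] y (ys ++ [ x ]) ⟩
    uses u v (x ∷ y ∷ []) + uses u v (y ∷ ys ++ [ x ])    ≡⟨ +-comm (uses u v (x ∷ y ∷ [])) _ ⟩
    uses u v ((y ∷ ys) ++ [ x ]) + uses u v (x ∷ y ∷ [])  ≡⟨ sym (uses-++ u v (y ∷ ys) x [ y ]) ⟩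
    uses u v ((y ∷ ys) ++ x ∷ y ∷ [])                     ≡⟨ cong (uses u v) (cong (y ∷_) (sym (++-assoc ys [ x ] [ y ]))) ⟩
    uses u v (close (y ∷ ys ++ [ x ])) ∎
    where open ≡-Reasoning

  uses-rotate : ∀ u v xs ys → uses u v (close (xs ++ ys)) ≡ uses u v (close (ys ++ xs))
  uses-rotate u v []       ys = cong (λ l → uses u v (close l)) (sym (++-identityʳ ys))
  uses-rotate u v (x ∷ xs) ys = begin
    uses u v (close (x ∷ xs ++ ys))        ≡⟨ uses-rotate₁ u v x (xs ++ ys) ⟩
    uses u v (close ((xs ++ ys) ++ [ x ]))  ≡⟨ cong (λ l → uses u v (close l)) (++-assoc xs ys [ x ]) ⟩
    uses u v (close (xs ++ ys ++ [ x ]))   ≡⟨ uses-rotate u v xs (ys ++ [ x ]) ⟩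
    uses u v (close ((ys ++ [ x ]) ++ xs))  ≡⟨ cong (λ l → uses u v (close l)) (++-assoc ys [ x ] xs) ⟩
    uses u v (close (ys ++ x ∷ xs)) ∎
    where open ≡-Reasoning

  euler-rotate : ∀ xs ys → Euler (xs ++ ys) → Euler (ys ++ xs)
  euler-rotate xs ys E u v = trans (sym (uses-rotate u v xs ys)) (E u v)

  euler-flip : ∀ xs a ys zs → Euler (xs ++ a ∷ ys ++ a ∷ zs) → Euler (xs ++ a ∷ reverse ys ++ a ∷ zs)
  euler-flip []       a ys zs E u v = trans (trans (cong (uses u v) (cong (a ∷_) (++-assoc (reverse ys) (a ∷ zs) [ a ])))
    (trans (uses-flip u v [] a ys (zs ++ [ a ])) (cong (uses u v) (cong (a ∷_) (sym (++-assoc ys (a ∷ zs) [ a ])))))) (E u v)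
  euler-flip (x ∷ xs) a ys zs E u v = trans (trans (cong (uses u v) (cong (x ∷_) (assoc (reverse ys))))
    (trans (uses-flip u v (x ∷ xs) a ys (zs ++ [ x ])) (cong (uses u v) (cong (x ∷_) (sym (assoc ys)))))) (E u v)
    where
    assoc : ∀ ws → (xs ++ a ∷ ws ++ a ∷ zs) ++ [ x ] ≡ xs ++ a ∷ ws ++ a ∷ zs ++ [ x ]
    assoc ws = trans (++-assoc xs (a ∷ ws ++ a ∷ zs) [ x ]) (cong (λ l → xs ++ a ∷ l) (++-assoc ws (a ∷ zs) [ x ]))

  -- What the checker takes from 4-regularity (`occ2` and `long`) and from 3-edge-connectivity
  -- (`nocut`).
  module _ (occ2 : ∀ w → Euler w → ∀ u → occ u w ≡ 2)
           (long : ∀ w → Euler w → 4 < length w)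
           (nocut : ∀ F C {x y} → Euler (F ++ C) → x ∈ F → y ∈ C →
                    (∀ {z} → z ∈ F → occ z F ≡ 2) → ⊥) where

    Outcome : List V → Set
    Outcome w = Exc ⊎ ∃[ w′ ] (Euler w′ × cost w′ < cost w)

    -- The flag f restricts to circuits without recurrences after three steps.
    record Good (f : Bool) (w : List V) : Set where
      field
        euler : Euler w
        no3   : f ≡ true → gaps 2 w ≡ 0
    open Good

    Models : State → (ℕ → V) → (ℕ → List V) → List V → Set
    Models (P , D) σ ζ w = ev σ ζ P ≡ w × Apart σ D

    Void Refuted : Bool → State → Set
    Void    f S = ∀ w → Good f w → ∀ σ ζ → Models S σ ζ w → ⊥
    Refuted f S = ∀ w → Good f w → ∀ σ ζ → Models S σ ζ w → Outcome w

    b2n≤1 : ∀ b → b2n b ≤ 1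
    b2n≤1 true  = s≤s z≤n
    b2n≤1 false = z≤n

    occ≤2 : ∀ {f w} → Good f w → ∀ u → occ u w ≤ 2
    occ≤2 {w = w} g u = ≤-reflexive (occ2 w (euler g) u)

    uses≤1 : ∀ {f w} → Good f w → ∀ u v → uses u v (close w) ≤ 1
    uses≤1 g u v = subst (_≤ 1) (sym (euler g u v)) (b2n≤1 (adj G u v))

    thrice : ∀ f P D a → 3 ≤ cnt a P → Void f (P , D)
    thrice f P D a h .(ev σ ζ P) g σ ζ (refl , _) = 1+n≰n (≤-trans h (≤-trans (cnt≤occ σ ζ a P) (occ≤2 g (σ a))))

    thrice? : ∀ f S (a : ℕ) → Maybe (Void f S)
    thrice? f (P , D) a with 3 ≤? cnt a P
    ... | yes h = just (thrice f P D a h)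
    ... | no _  = nothing

    -- An Eulerian circuit passes an edge only once. For `a = b` a single step is counted in both
    -- summands, so equal neighbours are excluded too; a recurrence after two steps passes one edge
    -- back and forth.
    twice : ∀ f c P D a b → 2 ≤ vsteps a b (closeT (L c ∷ P)) + vsteps b a (closeT (L c ∷ P)) → Void f (L c ∷ P , D)
    twice f c P D a b h .(ev σ ζ (L c ∷ P)) g σ ζ (refl , _) = 1+n≰n (begin
      2 ≤⟨ h ⟩
      vsteps a b Q + vsteps b a Q ≤⟨ +-mono-≤ (vsteps≤steps σ ζ a b Q) (vsteps≤steps σ ζ b a Q) ⟩
      uses (σ a) (σ b) (ev σ ζ Q) ≡⟨ cong (uses (σ a) (σ b)) (ev-close σ ζ c P) ⟩
      uses (σ a) (σ b) (close (ev σ ζ (L c ∷ P))) ≤⟨ uses≤1 g (σ a) (σ b) ⟩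
      1 ∎)
      where
      open ≤-Reasoning
      Q = closeT (L c ∷ P)

    twice? : ∀ f S (a b : ℕ) → Maybe (Void f S)
    twice? f ([]        , D) a b = nothing
    twice? f (Z _ _ ∷ _ , D) a b = nothing
    twice? f (L c ∷ P   , D) a b with 2 ≤? vsteps a b (closeT (L c ∷ P)) + vsteps b a (closeT (L c ∷ P))
    ... | yes h = just (twice f c P D a b h)
    ... | no _  = nothing

    -- Inspects the steps at `a`, where merging another letter into `a` can create a repeated edge.
    doubleAt? : ∀ f S (a : ℕ) → List Tok → Maybe (Void f S)
    doubleAt? f S a []                 = nothing
    doubleAt? f S a (Z _ _ ∷ Q)        = doubleAt? f S a Q
    doubleAt? f S a (L x ∷ [])         = nothing
    doubleAt? f S a (L x ∷ Z _ _ ∷ Q)  = doubleAt? f S a Q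
    doubleAt? f S a (L x ∷ L y ∷ Q)    =
      (if (a ≡ᵇ x) ∨ (a ≡ᵇ y) then twice? f S x y else nothing) orElse doubleAt? f S a (L y ∷ Q)

    clash-∷ : ∀ f P p D → Void f (P , D) → Void f (P , p ∷ D)
    clash-∷ f P p D h w g σ ζ (e , _ ∷ qs) = h w g σ ζ (e , qs)

    clash : ∀ f P a D → Void f (P , (a , a) ∷ D)
    clash f P a D w g σ ζ (e , q ∷ _) = q refl

    clash? : ∀ f P D → Maybe (Void f (P , D))
    clash? f P []            = nothing
    clash? f P ((a , b) ∷ D) with a ℕₚ.≟ b | clash? f P D
    ... | yes refl | _      = just (clash f P a D)
    ... | no _     | just h = just (clash-∷ f P (a , b) D h)
    ... | no _     | nothing = nothing

    triangle : ∀ P D → 1 ≤ gapsLow 2 P → Void true (P , D)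
    triangle P D h .(ev σ ζ P) g σ ζ (refl , _) =
      1+n≰n (≤-trans h (≤-trans (gapsLow≤ σ ζ 2 P) (≤-reflexive (no3 g refl))))

    triangle? : ∀ f S → Maybe (Void f S)
    triangle? false S = nothing
    triangle? true (P , D) with 1 ≤? gapsLow 2 P
    ... | yes h = just (triangle P D h)
    ... | no _  = nothing

    void? : ∀ f S (a : ℕ) → Maybe (Void f S)
    void? f S a = thrice? f S a orElse doubleAt? f S a (closeT (proj₁ S)) orElse clash? f (proj₁ S) (proj₂ S) orElse triangle? f S

    models-merge : ∀ {P D σ ζ w} a b → σ a ≡ σ b → Models (P , D) σ ζ w → Models (merge a b (P , D)) σ ζ w
    models-merge {P} {D} {σ} {ζ} a b eq (e , q) = trans (ev-merge σ ζ a b eq P) e , apart-merge σ ζ a b eq q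

    Distinct : Bool → State → ℕ → ℕ → Set
    Distinct f S a b = ∀ w → Good f w → ∀ σ ζ → Models S σ ζ w → σ a ≢ σ b

    -- If two letters were the same vertex, the pattern with the letters identified would describe
    -- the circuit as well.
    merged : ∀ f S a b → Void f (merge a b S) → Distinct f S a b
    merged f (P , D) a b h w g σ ζ m eq = h w g σ ζ (models-merge {P} {D} {σ} {ζ} {w} a b eq m)

    distinct? : ∀ f S a b → Maybe (Distinct f S a b)
    distinct? f S a b with a ≡ᵇ b | void? f (merge a b S) a
    ... | true  | _       = nothing
    ... | false | just h  = just (merged f S a b h)
    ... | false | nothing = nothing

    fresh : List Tok → ℕ
    fresh []          = 0
    fresh (L a ∷ P)   = suc a ⊔ fresh P
    fresh (Z k _ ∷ P) = fresh P

    freshZ : List Tok → ℕ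
    freshZ []          = 0
    freshZ (L a ∷ P)   = freshZ P
    freshZ (Z k _ ∷ P) = suc k ⊔ freshZ P

    upd-≢ : ∀ {A : Set} (f : ℕ → A) k x j → (j ≡ᵇ k) ≡ false → upd f k x j ≡ f j
    upd-≢ f k x j h rewrite h = refl

    false? : (b : Bool) → Maybe (b ≡ false)
    false? false = just refl
    false? true  = nothing

    NewL NewZ : ℕ → List Tok → Set
    NewL x P = ∀ σ ζ v → ev (upd σ x v) ζ P ≡ ev σ ζ P
    NewZ z P = ∀ σ ζ l → ev σ (upd ζ z l) P ≡ ev σ ζ P

    NewD : ℕ → List (ℕ × ℕ) → Set
    NewD x D = ∀ σ v → Apart σ D → Apart (upd σ x v) D

    newL? : ∀ x P → Maybe (NewL x P)
    newL? x []          = just λ _ _ _ → refl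
    newL? x (L a ∷ P)   with a ≡ᵇ x | newL? x P
    ... | false | just i = just λ σ ζ v → cong (σ a ∷_) (i σ ζ v)
    ... | _     | _      = nothing
    newL? x (Z k r ∷ P) with newL? x P
    ... | just i  = just λ σ ζ v → cong₂ _++_ (same r σ ζ v) (i σ ζ v)
      where same : ∀ r σ ζ v → tok (upd σ x v) ζ (Z k r) ≡ tok σ ζ (Z k r)
            same false σ ζ v = refl
            same true  σ ζ v = refl
    ... | nothing = nothing

    newZ? : ∀ z P → Maybe (NewZ z P)
    newZ? z []          = just λ _ _ _ → refl
    newZ? z (L a ∷ P)   with newZ? z P
    ... | just i  = just λ σ ζ l → cong (σ a ∷_) (i σ ζ l)
    ... | nothing = nothing
    newZ? z (Z k r ∷ P) with k ≡ᵇ z in eq | newZ? z P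
    ... | false | just i = just λ σ ζ l → cong₂ _++_ (same r σ ζ l) (i σ ζ l)
      where same : ∀ r σ ζ l → tok σ (upd ζ z l) (Z k r) ≡ tok σ ζ (Z k r)
            same false σ ζ l = upd-≢ ζ z l k eq
            same true  σ ζ l = cong reverse (upd-≢ ζ z l k eq)
    ... | _     | _      = nothing

    newD? : ∀ x D → Maybe (NewD x D)
    newD? x []            = just λ _ _ _ → []
    newD? x ((a , b) ∷ D) with a ≡ᵇ x in eq | b ≡ᵇ x in eq′ | newD? x D
    ... | false | false | just i = just λ { σ v (q ∷ qs) →
      (λ e → q (trans (sym (upd-≢ σ x v a eq)) (trans e (upd-≢ σ x v b eq′)))) ∷ i σ v qs }
    ... | _     | _     | _      = nothing

    splitZ : ℕ → (P : List Tok) → Maybe (∃[ A ] ∃[ k ] ∃[ C ] (P ≡ A ++ Z k false ∷ C))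
    splitZ j       []              = nothing
    splitZ zero    (Z k false ∷ P) = just ([] , k , P , refl)
    splitZ zero    (Z k true ∷ P)  = nothing
    splitZ (suc j) (Z k r ∷ P)     = do
      (A , l , C , e) ← splitZ j P
      just (Z k r ∷ A , l , C , cong (Z k r ∷_) e)
    splitZ j       (L a ∷ P)       = do
      (A , l , C , e) ← splitZ j P
      just (L a ∷ A , l , C , cong (L a ∷_) e)

    Checker : Bool → Set
    Checker f = ∀ S → List ℕ → Maybe (Refuted f S × List ℕ)

    opened : Bool → ℕ → ℕ → List Tok → List Tok
    opened false k x C = L x ∷ Z k false ∷ C
    opened true  k x C = Z k false ∷ L x ∷ C

    -- A hidden segment is empty or has a first and a last letter. The uncovered one receives the
    -- new name `x`, while the remainder of the segment keeps the name `k`.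
    expanded : ∀ f side A k C D x → Refuted f (A ++ C , D) → Refuted f (A ++ opened side k x C , D) →
               NewL x A → NewL x C → NewD x D → NewZ k A → NewZ k C → Refuted f (A ++ Z k false ∷ C , D)
    expanded f side A k C D x r₁ r₂ lA lC lD zA zC w g σ ζ (m , q) = go side r₂
      where
      m′ : ∀ l → ζ k ≡ l → ev σ ζ A ++ l ++ ev σ ζ C ≡ w
      m′ l e = trans (cong (λ l → ev σ ζ A ++ l ++ ev σ ζ C) (sym e)) (trans (sym (ev-++ σ ζ A (Z k false ∷ C))) m)
      empty : ζ k ≡ [] → Outcome w
      empty e = r₁ w g σ ζ (trans (ev-++ σ ζ A C) (m′ [] e) , q)
      new : ∀ Q v vs → NewL x Q → NewZ k Q → ev (upd σ x v) (upd ζ k vs) Q ≡ ev σ ζ Q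
      new Q v vs a b = trans (a σ (upd ζ k vs) v) (b σ ζ vs)
      go : ∀ side → Refuted f (A ++ opened side k x C , D) → Outcome w
      go false r₂ with ζ k in e
      ... | []     = empty e
      ... | v ∷ vs = r₂ w g (upd σ x v) (upd ζ k vs)
        (trans (ev-++ (upd σ x v) (upd ζ k vs) A _)
          (trans (cong₂ _++_ (new A v vs lA zA) (cong₂ _∷_ (upd-same σ x v) (cong₂ _++_ (upd-same ζ k vs) (new C v vs lC zC))))
                 (m′ (v ∷ vs) e)) , lD σ v q)
      go true r₂ = last (ζ k) refl
        where
        last : ∀ l → ζ k ≡ l → Outcome w
        last l e with initLast l
        ... | []       = empty e
        ... | vs ∷ʳ′ v = r₂ w g (upd σ x v) (upd ζ k vs)
          (trans (ev-++ (upd σ x v) (upd ζ k vs) A _)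
            (trans (cong₂ _++_ (new A v vs lA zA)
                      (trans (cong₂ _++_ (upd-same ζ k vs) (cong₂ _∷_ (upd-same σ x v) (new C v vs lC zC)))
                             (sym (++-assoc vs [ v ] (ev σ ζ C)))))
                   (m′ (vs ++ [ v ]) e)) , lD σ v q)

    expand : ∀ {f} → Checker f → Bool → ℕ → Checker f
    expand {f} rec side j (P , D) s with splitZ j P
    ... | nothing = nothing
    ... | just (A , k , C , refl) with rec (A ++ C , D) s
    ...   | nothing = nothing
    ...   | just (r₁ , s₁) with rec (A ++ opened side k (fresh P) C , D) s₁
    ...     | nothing = nothing
    ...     | just (r₂ , s₂) with newL? (fresh P) A | newL? (fresh P) C | newD? (fresh P) D | newZ? k A | newZ? k C
    ...       | just lA | just lC | just lD | just zA | just zC =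
                just (expanded f side A k C D (fresh P) r₁ r₂ lA lC lD zA zC , s₂)
    ...       | _ | _ | _ | _ | _ = nothing

    data Hit (σ : ℕ → V) (ζ : ℕ → List V) (a : ℕ) : List Tok → Set where
      twin   : ∀ {q P} → q ≢ a → σ q ≡ σ a → Hit σ ζ a (L q ∷ P)
      inside : ∀ {k r P} → σ a ∈ ζ k → Hit σ ζ a (Z k r ∷ P)
      later  : ∀ {t P} → Hit σ ζ a P → Hit σ ζ a (t ∷ P)

    occ>0⇒∈ : ∀ u xs → 0 < occ u xs → u ∈ xs
    occ>0⇒∈ u (x ∷ xs) h with u ≟ x
    ... | yes refl = here refl
    ... | no _     = there (occ>0⇒∈ u xs h)

    -- If the name `a` is seen less often than its vertex occurs, some token has to account for the
    -- difference.
    find-hit : ∀ σ ζ a P → cnt a P < occ (σ a) (ev σ ζ P) → Hit σ ζ a P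
    find-hit σ ζ a (Z k r ∷ P) h with occ (σ a) (tok σ ζ (Z k r)) in eq
    ... | zero  = later (find-hit σ ζ a P (subst (cnt a P <_)
                    (trans (occ-++ (σ a) (tok σ ζ (Z k r)) (ev σ ζ P)) (cong (_+ occ (σ a) (ev σ ζ P)) eq)) h))
    ... | suc _ = inside (∈-tok σ ζ k r (occ>0⇒∈ (σ a) (tok σ ζ (Z k r)) (subst (0 <_) (sym eq) (s≤s z≤n))))
    find-hit σ ζ a (L q ∷ P) h with σ a ≟ σ q | a ≡ᵇ q in eq
    ... | yes e | true  = later (find-hit σ ζ a P (s≤s⁻¹ h))
    ... | yes e | false = twin (λ { refl → subst T eq (≡⇒≡ᵇ a a refl) }) (sym e)
    ... | no ¬e | true  = ⊥-elim (¬e (cong σ (T≡ {a} {q} eq)))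
    ... | no _  | false = later (find-hit σ ζ a P h)

    HitRefuted : Bool → State → ℕ → List Tok → Set
    HitRefuted f S a Q = ∀ w → Good f w → ∀ σ ζ → Models S σ ζ w → Hit σ ζ a Q → Outcome w

    -- The occurrence splits the segment: the part before it keeps the name `k`, the part behind it
    -- is called `l`.
    located : ∀ f A k C D a l → Refuted f (A ++ Z k false ∷ L a ∷ Z l false ∷ C , D) →
              NewZ k A → NewZ k C → NewZ l A → NewZ l C → (k ≡ᵇ l) ≡ false →
              ∀ w → Good f w → ∀ σ ζ → Models (A ++ Z k false ∷ C , D) σ ζ w → σ a ∈ ζ k → Outcome w
    located f A k C D a l r kA kC lA lC k≢l w g σ ζ (m , q) i with ∈-∃++ i
    ... | xs , ys , e = r w g σ ζ′ (trans (ev-++ σ ζ′ A _) (trans (cong₂ _++_ (new A kA lA)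
            (trans (cong₂ _++_ first (cong (σ a ∷_) (cong₂ _++_ (upd-same (upd ζ k xs) l ys) (new C kC lC)))) (sym (++-assoc xs (σ a ∷ ys) (ev σ ζ C)))))
            (trans (cong (λ z → ev σ ζ A ++ z ++ ev σ ζ C) (sym e)) (trans (sym (ev-++ σ ζ A (Z k false ∷ C))) m))) , q)
      where
      ζ′ = upd (upd ζ k xs) l ys
      first : ζ′ k ≡ xs
      first = trans (upd-≢ (upd ζ k xs) l ys k k≢l) (upd-same ζ k xs)
      new : ∀ Q → NewZ k Q → NewZ l Q → ev σ ζ′ Q ≡ ev σ ζ Q
      new Q kQ lQ = trans (lQ σ (upd ζ k xs) ys) (kQ σ ζ xs)

    hitL : ∀ f S a q Q → (q ≢ a → Refuted f (merge a q S)) → HitRefuted f S a Q → HitRefuted f S a (L q ∷ Q)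
    hitL f (P , D) a q Q r h w g σ ζ m (twin q≢a e) = r q≢a w g σ ζ (models-merge {P} {D} {σ} {ζ} {w} a q (sym e) m)
    hitL f S       a q Q r h w g σ ζ m (later i)    = h w g σ ζ m i

    hitZ : ∀ f S a k Q → (∀ w → Good f w → ∀ σ ζ → Models S σ ζ w → σ a ∈ ζ k → Outcome w) →
           HitRefuted f S a Q → HitRefuted f S a (Z k false ∷ Q)
    hitZ f S a k Q r h w g σ ζ m (inside i) = r w g σ ζ m i
    hitZ f S a k Q r h w g σ ζ m (later i)  = h w g σ ζ m i

    absurd : ∀ f S → Void f S → Refuted f S
    absurd f S v w g σ ζ m = ⊥-elim (v w g σ ζ m)

    -- Each token is a candidate for the missing occurrence, `A` being the part already passed. An
    -- identification that is contradictory at once consumes nothing of the certificate, which thus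
    -- lists only the remaining identifications and the hidden segments.
    places : ∀ {f} → Checker f → (P A Q : List Tok) (D : List (ℕ × ℕ)) → P ≡ A ++ Q → ∀ a → List ℕ →
             Maybe (HitRefuted f (P , D) a Q × List ℕ)
    places rec P A [] D e a s = just ((λ { _ _ _ _ _ () }) , s)
    places {f} rec P A (L q ∷ Q) D e a s with q ℕₚ.≟ a
    ... | yes q≡a with places rec P (A ++ [ L q ]) Q D (trans e (sym (++-assoc A [ L q ] Q))) a s
    ...   | nothing       = nothing
    ...   | just (h , s′) = just (hitL f (P , D) a q Q (λ q≢a → ⊥-elim (q≢a q≡a)) h , s′)
    places {f} rec P A (L q ∷ Q) D e a s | no _ with void? f (merge a q (P , D)) a
    ...   | just v with places rec P (A ++ [ L q ]) Q D (trans e (sym (++-assoc A [ L q ] Q))) a s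
    ...     | nothing       = nothing
    ...     | just (h , s′) = just (hitL f (P , D) a q Q (λ _ → absurd f (merge a q (P , D)) v) h , s′)
    places {f} rec P A (L q ∷ Q) D e a s | no _ | nothing with rec (merge a q (P , D)) s
    ...     | nothing       = nothing
    ...     | just (r , s₁) with places rec P (A ++ [ L q ]) Q D (trans e (sym (++-assoc A [ L q ] Q))) a s₁
    ...       | nothing       = nothing
    ...       | just (h , s₂) = just (hitL f (P , D) a q Q (λ _ → r) h , s₂)
    places rec P A (Z k true ∷ Q) D e a s = nothing
    places {f} rec P A (Z k false ∷ Q) D e a s with rec (A ++ Z k false ∷ L a ∷ Z (freshZ P) false ∷ Q , D) s
    ... | nothing = nothing
    ... | just (r , s₁) with places rec P (A ++ [ Z k false ]) Q D (trans e (sym (++-assoc A [ Z k false ] Q))) a s₁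
                           | newZ? k A | newZ? k Q | newZ? (freshZ P) A | newZ? (freshZ P) Q | false? (k ≡ᵇ freshZ P)
    ...   | just (h , s₂) | just kA | just kQ | just lA | just lQ | just k≢l =
            just (hitZ f (P , D) a k Q (subst (λ P → ∀ w → Good f w → ∀ σ ζ → Models (P , D) σ ζ w → σ a ∈ ζ k → Outcome w) (sym e)
                   (located f A k Q D a (freshZ P) r kA kQ lA lQ k≢l)) h , s₂)
    ...   | _ | _ | _ | _ | _ | _ = nothing

    hit-all : ∀ f P D a → cnt a P < 2 → HitRefuted f (P , D) a P → Refuted f (P , D)
    hit-all f P D a h r w g σ ζ (m , q) = r w g σ ζ (m , q) (find-hit σ ζ a P
      (≤-trans h (≤-reflexive (sym (trans (cong (occ (σ a)) m) (occ2 w (euler g) (σ a)))))))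

    locate : ∀ {f} → Checker f → ℕ → Checker f
    locate {f} rec a (P , D) s with suc (cnt a P) ≤? 2 | places rec P [] P D refl a s
    ... | yes h | just (r , s′) = just (hit-all f P D a h r , s′)
    ... | _     | _             = nothing

    split : ∀ f p q S → Refuted f (proj₁ S , (p , q) ∷ proj₂ S) → Refuted f (merge p q S) → Refuted f S
    split f p q (P , D) r₁ r₂ w g σ ζ (m , ds) with σ p ≟ σ q
    ... | yes e = r₂ w g σ ζ (models-merge {P} {D} {σ} {ζ} {w} p q e (m , ds))
    ... | no ¬e = r₁ w g σ ζ (m , ¬e ∷ ds)

    decide : ∀ {f} → Checker f → ℕ → ℕ → Checker f
    decide {f} rec p q S s with rec (proj₁ S , (p , q) ∷ proj₂ S) s
    ... | nothing = nothing
    ... | just (r₁ , s₁) with rec (merge p q S) s₁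
    ...   | nothing = nothing
    ...   | just (r₂ , s₂) = just (split f p q S r₁ r₂ , s₂)

    -- A proper factor of the circuit that contains both passages through each of its vertices
    -- is attached to the rest by two edges only.
    data Closed (F : List Tok) : List Tok → Set where
      []  : Closed F []
      _∷_ : ∀ {a P} → 2 ≤ cnt a F → Closed F P → Closed F (L a ∷ P)

    closed? : ∀ F P → Maybe (Closed F P)
    closed? F []          = just []
    closed? F (Z _ _ ∷ P) = nothing
    closed? F (L a ∷ P) with 2 ≤? cnt a F | closed? F P
    ... | yes h | just c = just (h ∷ c)
    ... | _     | _      = nothing

    data HasLetter : List Tok → Set where
      here  : ∀ {a P} → HasLetter (L a ∷ P)
      there : ∀ {t P} → HasLetter P → HasLetter (t ∷ P)

    letter? : ∀ P → Maybe (HasLetter P)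
    letter? []          = nothing
    letter? (L _ ∷ _)   = just here
    letter? (Z _ _ ∷ P) with letter? P
    ... | just h  = just (there h)
    ... | nothing = nothing

    has-letter : ∀ σ ζ {P} → HasLetter P → ∃[ x ] x ∈ ev σ ζ P
    has-letter σ ζ (here {a})      = σ a , here refl
    has-letter σ ζ (there {t} h) with has-letter σ ζ h
    ... | x , i = x , ∈-++⁺ʳ (tok σ ζ t) i

    closed-letter : ∀ σ ζ F {P z} → Closed F P → z ∈ ev σ ζ P → ∃[ a ] (z ≡ σ a × 2 ≤ cnt a F)
    closed-letter σ ζ F (_∷_ {a} h c) (here e)  = a , e , h
    closed-letter σ ζ F (h ∷ c)       (there i) = closed-letter σ ζ F c i

    ev-rotate : ∀ σ ζ r P → ev σ ζ (rotate r P) ≡ ev σ ζ (drop r P) ++ ev σ ζ (take r P)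
    ev-rotate σ ζ r P = ev-++ σ ζ (drop r P) (take r P)

    ev-unrotate : ∀ σ ζ r P → ev σ ζ P ≡ ev σ ζ (take r P) ++ ev σ ζ (drop r P)
    ev-unrotate σ ζ r P = trans (cong (ev σ ζ) (sym (take++drop≡id r P))) (ev-++ σ ζ (take r P) (drop r P))

    euler-rotateT : ∀ σ ζ r P → Euler (ev σ ζ P) → Euler (ev σ ζ (rotate r P))
    euler-rotateT σ ζ r P E = subst Euler (sym (ev-rotate σ ζ r P))
      (euler-rotate (ev σ ζ (take r P)) (ev σ ζ (drop r P)) (subst Euler (ev-unrotate σ ζ r P) E))

    cut : ∀ f i l P D → HasLetter (take l (rotate i P)) → HasLetter (drop l (rotate i P)) →
          Closed (take l (rotate i P)) (take l (rotate i P)) → Void f (P , D)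
    cut f i l P D hF hC cF .(ev σ ζ P) g σ ζ (refl , _) =
      nocut (ev σ ζ F) (ev σ ζ C) E (proj₂ (has-letter σ ζ hF)) (proj₂ (has-letter σ ζ hC)) twice-in
      where
      F = take l (rotate i P)
      C = drop l (rotate i P)
      E : Euler (ev σ ζ F ++ ev σ ζ C)
      E = subst Euler (ev-unrotate σ ζ l (rotate i P)) (euler-rotateT σ ζ i P (euler g))
      twice-in : ∀ {z} → z ∈ ev σ ζ F → occ z (ev σ ζ F) ≡ 2
      twice-in {z} m with closed-letter σ ζ F cF m
      ... | a , refl , h = ≤-antisym part (≤-trans h (cnt≤occ σ ζ a F))
        where
        part : occ z (ev σ ζ F) ≤ 2
        part = begin
          occ z (ev σ ζ F) ≤⟨ m≤m+n _ _ ⟩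
          occ z (ev σ ζ F) + occ z (ev σ ζ C) ≡⟨ sym (occ-++ z (ev σ ζ F) _) ⟩
          occ z (ev σ ζ F ++ ev σ ζ C) ≡⟨ occ2 (ev σ ζ F ++ ev σ ζ C) E z ⟩
          2 ∎
          where open ≤-Reasoning

    cut? : ∀ f (i l : ℕ) S → Maybe (Void f S)
    cut? f i l (P , D) with letter? (take l (rotate i P)) | letter? (drop l (rotate i P))
                          | closed? (take l (rotate i P)) (take l (rotate i P))
    ... | just hF | just hC | just c = just (cut f i l P D hF hC c)
    ... | _       | _       | _      = nothing

    Flipped : List Tagged → List Tagged → Set
    Flipped Q Q′ = ∀ σ ζ → Euler (ev σ ζ (untag Q)) → Euler (ev σ ζ (untag Q′))

    find : ∀ a (Q : List Tagged) → Maybe (∃[ A ] ∃[ i ] ∃[ C ] Q ≡ A ++ (i , L a) ∷ C)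
    find a []                  = nothing
    find a ((i , Z k r) ∷ Q) with find a Q
    ... | nothing              = nothing
    ... | just (A , j , C , e) = just ((i , Z k r) ∷ A , j , C , cong ((i , Z k r) ∷_) e)
    find a ((i , L b) ∷ Q) with b ℕₚ.≟ a
    ... | yes refl = just ([] , i , Q , refl)
    ... | no _ with find a Q
    ...   | nothing              = nothing
    ...   | just (A , j , C , e) = just ((i , L b) ∷ A , j , C , cong ((i , L b) ∷_) e)

    ev-factors : ∀ σ ζ a i j A B C → ev σ ζ (untag (A ++ (i , L a) ∷ B ++ (j , L a) ∷ C)) ≡
                 ev σ ζ (untag A) ++ σ a ∷ ev σ ζ (untag B) ++ σ a ∷ ev σ ζ (untag C)
    ev-factors σ ζ a i j A B C = begin
      ev σ ζ (untag (A ++ (i , L a) ∷ B ++ (j , L a) ∷ C))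
        ≡⟨ cong (ev σ ζ) (trans (map-++ proj₂ A _) (cong (λ l → untag A ++ L a ∷ l) (map-++ proj₂ B _))) ⟩
      ev σ ζ (untag A ++ L a ∷ untag B ++ L a ∷ untag C)
        ≡⟨ trans (ev-++ σ ζ (untag A) _) (cong (λ l → ev σ ζ (untag A) ++ σ a ∷ l) (ev-++ σ ζ (untag B) _)) ⟩
      ev σ ζ (untag A) ++ σ a ∷ ev σ ζ (untag B) ++ σ a ∷ ev σ ζ (untag C) ∎
      where open ≡-Reasoning

    flipped : ∀ a i j A B C → Flipped (A ++ (i , L a) ∷ B ++ (j , L a) ∷ C) (A ++ (i , L a) ∷ revTagged B ++ (j , L a) ∷ C)
    flipped a i j A B C σ ζ E = subst Euler (sym (trans (ev-factors σ ζ a i j A (revTagged B) C)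
        (cong (λ l → ev σ ζ (untag A) ++ σ a ∷ l ++ σ a ∷ ev σ ζ (untag C)) (trans (cong (ev σ ζ) (untag-rev B)) (ev-rev σ ζ (untag B))))))
      (euler-flip (ev σ ζ (untag A)) (σ a) (ev σ ζ (untag B)) (ev σ ζ (untag C)) (subst Euler (ev-factors σ ζ a i j A B C) E))

    -- Tags travel with their tokens, so that the runs can be read off after several flips.
    flip? : ∀ a Q → Maybe (∃[ Q′ ] Flipped Q Q′)
    flip? a Q with find a Q
    ... | nothing = nothing
    ... | just (A , i , C , refl) with find a C
    ...   | nothing = nothing
    ...   | just (B , j , C′ , refl) = just (A ++ (i , L a) ∷ revTagged B ++ (j , L a) ∷ C′ , flipped a i j A B C′)

    flips? : List ℕ → ∀ Q → Maybe (∃[ Q′ ] Flipped Q Q′)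
    flips? []       Q = just (Q , λ _ _ E → E)
    flips? (a ∷ as) Q with flip? a Q
    ... | nothing = nothing
    ... | just (Q₁ , φ) with flips? as Q₁
    ...   | nothing = nothing
    ...   | just (Q₂ , ψ) = just (Q₂ , λ σ ζ E → ψ σ ζ (φ σ ζ E))

    gaps-rotateT : ∀ d σ ζ r P → suc (suc d) < length (ev σ ζ P) → gaps (suc d) (ev σ ζ (rotate r P)) ≡ gaps (suc d) (ev σ ζ P)
    gaps-rotateT d σ ζ r P h = trans (cong (gaps (suc d)) (ev-rotate σ ζ r P)) (trans
      (sym (gaps-rotate d (ev σ ζ (take r P)) (ev σ ζ (drop r P)) (subst (λ l → suc (suc d) < length l) (ev-unrotate σ ζ r P) h)))
      (cong (gaps (suc d)) (sym (ev-unrotate σ ζ r P))))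

    cost-rotateT : ∀ σ ζ r P → 4 < length (ev σ ζ P) → cost (ev σ ζ (rotate r P)) ≡ cost (ev σ ζ P)
    cost-rotateT σ ζ r P h = cong₂ (λ a b → 2 * a + b) (gaps-rotateT 1 σ ζ r P (<-trans (n<1+n 3) h)) (gaps-rotateT 2 σ ζ r P h)

    dist : Bool → State → ℕ → ℕ → Bool
    dist f S a b = is-just (distinct? f S a b)

    dist-sound : ∀ f S a b → dist f S a b ≡ true → Distinct f S a b
    dist-sound f S a b h with distinct? f S a b
    ... | just d = d

    comp : List Tok → ℕ → Bool
    comp P c = 2 ≤ᵇ cnt c P

    costT : (Look → Look → ℕ) → List Run → ℕ
    costT g rs = 2 * total g 2 rs + total g 3 rs

    -- Both circuits consist of the same runs, whose inner recurrences cancel; it remains to compare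
    -- the joints, from above for the new circuit and from below for the old one. Rotations are
    -- harmless, the cost being a cyclic quantity.
    better : ∀ f P D Q r s rs → Flipped (tagFrom 0 P) Q → cat rs ≡ rotate r (untag Q) → cat (restore rs) ≡ rotate s P →
             costT (up (dist f (P , D)) (comp (cat rs))) rs < costT low (restore rs) → Refuted f (P , D)
    better f P D Q r s rs φ e₁ e₂ lt .(ev σ ζ P) g σ ζ (refl , q) = inj₂ (ev σ ζ P′ , E′ , (begin-strict
      cost (ev σ ζ P′)  ≡⟨ sym (trans (cong (cost ∘ ev σ ζ) e₁) (cost-rotateT σ ζ r P′ (long (ev σ ζ P′) E′))) ⟩
      cost (ev σ ζ (cat rs)) ≤⟨ +-mono-≤ (*-monoʳ-≤ 2 (gaps-up δ₁ γ sound 2 rs fine)) (gaps-up δ₁ γ sound 3 rs fine) ⟩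
      2 * (linsum 2 rs + total g₁ 2 rs) + (linsum 3 rs + total g₁ 3 rs) ≡⟨ mix (linsum 2 rs) (total g₁ 2 rs) (linsum 3 rs) (total g₁ 3 rs) ⟩
      2 * linsum 2 rs + linsum 3 rs + costT g₁ rs <⟨ +-monoʳ-< (2 * linsum 2 rs + linsum 3 rs) lt ⟩
      2 * linsum 2 rs + linsum 3 rs + costT low rs₀
        ≡⟨ cong₂ (λ a b → 2 * a + b + costT low rs₀) (sym (linsum-restore 2 rs)) (sym (linsum-restore 3 rs)) ⟩
      2 * linsum 2 rs₀ + linsum 3 rs₀ + costT low rs₀ ≡⟨ sym (mix (linsum 2 rs₀) (total low 2 rs₀) (linsum 3 rs₀) (total low 3 rs₀)) ⟩
      2 * (linsum 2 rs₀ + total low 2 rs₀) + (linsum 3 rs₀ + total low 3 rs₀) ≤⟨ +-mono-≤ (*-monoʳ-≤ 2 (gaps-low 2 rs₀)) (gaps-low 3 rs₀) ⟩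
      cost (ev σ ζ (cat rs₀)) ≡⟨ trans (cong (cost ∘ ev σ ζ) e₂) (cost-rotateT σ ζ s P (long (ev σ ζ P) (euler g))) ⟩
      cost (ev σ ζ P) ∎))
      where
      open ≤-Reasoning
      open Bounds σ ζ
      P′  = untag Q
      rs₀ = restore rs
      δ₁  = dist f (P , D)
      γ   = comp (cat rs)
      g₁  = up δ₁ γ
      E′ : Euler (ev σ ζ P′)
      E′ = φ σ ζ (subst (λ l → Euler (ev σ ζ l)) (sym (untag-tagFrom 0 P)) (euler g))
      E″ : Euler (ev σ ζ (cat rs))
      E″ = subst (λ l → Euler (ev σ ζ l)) (sym e₁) (euler-rotateT σ ζ r P′ E′)
      sound : ∀ a b → δ₁ a b ≡ true → σ a ≢ σ b
      sound a b h = dist-sound f (P , D) a b h (ev σ ζ P) g σ ζ (refl , q)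
      -- The flipped circuit is again Eulerian, so two visible occurrences of a letter are all that
      -- its vertex has.
      fine : All (Fine δ₁ γ sound) (cat rs)
      fine = All.tabulate λ {t} i c h → All.lookup (complete⇒Ok σ ζ c (cat rs)
        (≤-trans (≤-reflexive (occ2 (ev σ ζ (cat rs)) E″ (σ c))) (≤ᵇ⇒≤ 2 (cnt c (cat rs)) (subst T (sym h) _)))) i
      mix : ∀ a b c d → 2 * (a + b) + (c + d) ≡ 2 * a + c + (2 * b + d)
      mix = solve-∀

    better? : ∀ f → List ℕ → ∀ S → Maybe (Refuted f S)
    better? f as (P , D) with flips? as (tagFrom 0 P)
    ... | nothing = nothing
    ... | just (Q , φ) with plan Q
    ...   | r , s , rs with toks≟ (cat rs) (rotate r (untag Q)) | toks≟ (cat (restore rs)) (rotate s P)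
                          | costT (up (dist f (P , D)) (comp (cat rs))) rs <? costT low (restore rs)
    ...     | just e₁ | just e₂ | yes lt = just (better f P D Q r s rs φ e₁ e₂ lt)
    ...     | _       | _       | _      = nothing

    -- With nothing hidden, and with `a` and `b` the only names of their vertices, no step escapes
    -- the count.
    vsteps-exact : ∀ σ ζ a b P {F} → Closed F P → All (Ok σ ζ a) P → All (Ok σ ζ b) P →
                   steps (σ a) (σ b) (ev σ ζ P) ≡ vsteps a b P
    vsteps-exact σ ζ a b []       []      _ _ = refl
    vsteps-exact σ ζ a b (L x ∷ []) (_ ∷ []) _ _ = refl
    vsteps-exact σ ζ a b (L x ∷ L y ∷ P) (_ ∷ c) (oa ∷ oas) (_ ∷ ob ∷ obs) =
      cong₂ _+_ head (vsteps-exact σ ζ a b (L y ∷ P) c oas (ob ∷ obs))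
      where
      δσ : ∀ p x → (σ x ≡ σ p → x ≡ p) → δ (σ p) (σ x) ≡ b2n (p ≡ᵇ x)
      δσ p x o with p ≡ᵇ x in eq
      ... | true  = δ-≡1 (cong σ (T≡ {p} {x} eq))
      ... | false = δ-≢ λ e → subst T eq (≡⇒≡ᵇ p x (sym (o (sym e))))
      head : δ (σ a) (σ x) * δ (σ b) (σ y) ≡ b2n ((a ≡ᵇ x) ∧ (b ≡ᵇ y))
      head rewrite δσ a x oa | δσ b y ob with a ≡ᵇ x | b ≡ᵇ y
      ... | true  | true  = refl
      ... | true  | false = refl
      ... | false | _     = refl

    nth : List ℕ → ℕ → ℕ
    nth []       _       = 0
    nth (x ∷ xs) zero    = x
    nth (x ∷ xs) (suc i) = nth xs i

    data Named (h : Exceptional) (as : List ℕ) : List Tok → Set where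
      []  : Named h as []
      _∷_ : ∀ {a P} → ∃[ i ] (i < size h × nth as i ≡ a) → Named h as P → Named h as (L a ∷ P)

    index? : ∀ (as : List ℕ) m a → Maybe (∃[ i ] (i < m × nth as i ≡ a))
    index? as zero    a = nothing
    index? as (suc m) a with nth as m ℕₚ.≟ a | index? as m a
    ... | yes e | _                  = just (m , ≤-refl , e)
    ... | no _  | just (i , lt , e)  = just (i , m≤n⇒m≤1+n lt , e)
    ... | no _  | nothing            = nothing

    named? : ∀ h as P → Maybe (Named h as P)
    named? h as []          = just []
    named? h as (Z _ _ ∷ P) = nothing
    named? h as (L a ∷ P) with index? as (size h) a | named? h as P
    ... | just i | just c = just (i ∷ c)
    ... | _      | _      = nothing

    Faithful : Exceptional → List ℕ → List Tok → ℕ → ℕ → Set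
    Faithful h as P i j = 2 ≤ cnt (nth as i) P × (nth as i ≡ nth as j → i ≡ j) ×
      vsteps (nth as i) (nth as j) (closeT P) + vsteps (nth as j) (nth as i) (closeT P) ≡ b2n (adjacent h i j)

    faithful? : ∀ h as P i j → Maybe (Faithful h as P i j)
    faithful? h as P i j
      with 2 ≤? cnt (nth as i) P | (nth as i ℕₚ.≟ nth as j) →-dec (i ℕₚ.≟ j)
         | vsteps (nth as i) (nth as j) (closeT P) + vsteps (nth as j) (nth as i) (closeT P) ℕₚ.≟ b2n (adjacent h i j)
    ... | yes p | yes q | yes r = just (p , q , r)
    ... | _     | _     | _     = nothing

    b2n-inj : ∀ b c → b2n b ≡ b2n c → b ≡ c
    b2n-inj true  true  _ = refl
    b2n-inj false false _ = refl

    -- A pattern without hidden segments in which each letter occurs twice spells the entire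
    -- circuit. Every vertex occurs in the circuit and adjacent vertices are those that follow one
    -- another in it, so the pattern determines the graph.
    recognised : ∀ f e as c P D → Closed (L c ∷ P) (L c ∷ P) → Named (exceptional e) as (L c ∷ P) →
                 (∀ i → i < size (exceptional e) → ∀ j → j < size (exceptional e) → Faithful (exceptional e) as (L c ∷ P) i j) →
                 Refuted f (L c ∷ P , D)
    recognised f e as c P D cP nP F .(ev σ ζ (L c ∷ P)) g σ ζ (refl , _) = inj₁ (e , record
      { f    = λ i → σ (nth as i)
      ; inj  = λ i j hi hj e → proj₁ (proj₂ (F i hi j hj)) (sym (same hi (member nP i hi j hj) (sym e)))
      ; surj = λ v → covers nP (occ>0⇒∈ v (ev σ ζ Q) (subst (0 <_) (sym (occ2 (ev σ ζ Q) (euler g) v)) (s≤s z≤n)))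
      ; adjf = λ i j hi hj → b2n-inj _ _ (begin
          b2n (adj G (σ (nth as i)) (σ (nth as j)))     ≡⟨ sym (euler g _ _) ⟩
          uses (σ (nth as i)) (σ (nth as j)) (close (ev σ ζ Q)) ≡⟨ cong (uses (σ (nth as i)) (σ (nth as j))) (sym (ev-close σ ζ c P)) ⟩
          uses (σ (nth as i)) (σ (nth as j)) (ev σ ζ (closeT Q))
            ≡⟨ cong₂ _+_ (vsteps-exact σ ζ _ _ (closeT Q) closedT (okT hi) (okT hj)) (vsteps-exact σ ζ _ _ (closeT Q) closedT (okT hj) (okT hi)) ⟩
          vsteps (nth as i) (nth as j) (closeT Q) + vsteps (nth as j) (nth as i) (closeT Q) ≡⟨ proj₂ (proj₂ (F i hi j hj)) ⟩
          b2n (adjacent (exceptional e) i j) ∎)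
      })
      where
      open ≡-Reasoning
      Q = L c ∷ P
      N = size (exceptional e)
      ok : ∀ {i} → i < N → All (Ok σ ζ (nth as i)) Q
      ok {i} hi = complete⇒Ok σ ζ (nth as i) Q
        (≤-trans (≤-reflexive (occ2 (ev σ ζ Q) (euler g) (σ (nth as i)))) (proj₁ (F i hi i hi)))
      okT : ∀ {i} → i < N → All (Ok σ ζ (nth as i)) (closeT Q)
      okT hi = Allₚ.++⁺ (ok hi) (All.head (ok hi) ∷ [])
      closed-++ : ∀ {F A B} → Closed F A → Closed F B → Closed F (A ++ B)
      closed-++ []      d = d
      closed-++ (h ∷ c) d = h ∷ closed-++ c d
      headC : ∀ {F a A} → Closed F (L a ∷ A) → Closed F (L a ∷ [])
      headC (h ∷ _) = h ∷ []
      closedT : Closed Q (closeT Q)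
      closedT = closed-++ cP (headC cP)
      occurs : ∀ a R → 1 ≤ cnt a R → L a ∈ R
      occurs a (Z k r ∷ R) h = there (occurs a R h)
      occurs a (L b ∷ R)   h with a ≡ᵇ b in eq
      ... | true  = here (cong L (T≡ {a} {b} eq))
      ... | false = there (occurs a R h)
      member : Named (exceptional e) as Q → ∀ i → i < N → ∀ j → j < N → L (nth as j) ∈ Q
      member _ i hi j hj = occurs (nth as j) Q (≤-trans (s≤s z≤n) (proj₁ (F j hj j hj)))
      same : ∀ {i j} → i < N → L (nth as j) ∈ Q → σ (nth as j) ≡ σ (nth as i) → nth as j ≡ nth as i
      same hi i e = All.lookup (ok hi) i e
      covers : ∀ {R v} → Named (exceptional e) as R → v ∈ ev σ ζ R → ∃[ i ] (i < N × σ (nth as i) ≡ v)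
      covers ((i , lt , refl) ∷ _) (here v≡) = i , lt , sym v≡
      covers (_ ∷ nR)              (there m) = covers nR m

    exceptional? : ∀ f → ℕ → List ℕ → ∀ S → Maybe (Refuted f S)
    exceptional? f e as ([] , D)        = nothing
    exceptional? f e as (Z _ _ ∷ _ , D) = nothing
    exceptional? f e as (L c ∷ P , D) with closed? (L c ∷ P) (L c ∷ P) | named? (exceptional e) as (L c ∷ P)
      | ∀<? (size (exceptional e)) (λ i → ∀<? (size (exceptional e)) (faithful? (exceptional e) as (L c ∷ P) i))
    ... | just cP | just nP | just F = just (recognised f e as c P D cP nP F)
    ... | _       | _       | _      = nothing

    infixr 1 _with-rest_
    _with-rest_ : ∀ {A : Set} → Maybe A → List ℕ → Maybe (A × List ℕ)
    just x  with-rest s = just (x , s)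
    nothing with-rest s = nothing

    voided : ∀ f S → Maybe (Void f S) → Maybe (Refuted f S)
    voided f S (just v) = just (absurd f S v)
    voided f S nothing  = nothing

    -- Codes: 0 contradiction at a letter; 1-4 number of flips, followed by their letters; 5 and 6
    -- uncover the left or right end of the j-th hidden segment; 7 locate the twin of a letter;
    -- 8 compare two letters; 9 two-edge cut, given by an offset and a length; 10 exceptional graph,
    -- with the letters that stand for its vertices.
    check : ℕ → ∀ f → Checker f
    check zero       f S s = nothing
    check (suc fuel) f S (0 ∷ a ∷ s)     = voided f S (void? f S a) with-rest s
    check (suc fuel) f S (1 ∷ a ∷ s)     = better? f (a ∷ []) S with-rest s
    check (suc fuel) f S (2 ∷ a ∷ b ∷ s) = better? f (a ∷ b ∷ []) S with-rest s
    check (suc fuel) f S (3 ∷ a ∷ b ∷ c ∷ s) = better? f (a ∷ b ∷ c ∷ []) S with-rest s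
    check (suc fuel) f S (4 ∷ a ∷ b ∷ c ∷ d ∷ s) = better? f (a ∷ b ∷ c ∷ d ∷ []) S with-rest s
    check (suc fuel) f S (5 ∷ j ∷ s)     = expand (check fuel f) false j S s
    check (suc fuel) f S (6 ∷ j ∷ s)     = expand (check fuel f) true j S s
    check (suc fuel) f S (7 ∷ a ∷ s)     = locate (check fuel f) a S s
    check (suc fuel) f S (8 ∷ p ∷ q ∷ s) = decide (check fuel f) p q S s
    check (suc fuel) f S (9 ∷ i ∷ l ∷ s) = voided f S (cut? f i l S) with-rest s
    check (suc fuel) f S (10 ∷ e ∷ s)    =
      exceptional? f e (take (size (exceptional e)) s) S with-rest drop (size (exceptional e)) s
    check (suc fuel) f S _ = nothing

-- Finite sums and the degrees of a trail.

∑ : ∀ {n} → (Fin n → ℕ) → ℕ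
∑ {n} f = sum (map f (allFin n))

module _ {A : Set} where
  sum-+ : ∀ (f g : A → ℕ) xs → sum (map (λ v → f v + g v) xs) ≡ sum (map f xs) + sum (map g xs)
  sum-+ f g []       = refl
  sum-+ f g (x ∷ xs) rewrite sum-+ f g xs = lem (f x) (g x) _ _
    where lem : ∀ a b c d → a + b + (c + d) ≡ a + c + (b + d)
          lem = solve-∀

  sum-* : ∀ c (f : A → ℕ) xs → sum (map (λ v → c * f v) xs) ≡ c * sum (map f xs)
  sum-* c f []       = sym (*-zeroʳ c)
  sum-* c f (x ∷ xs) rewrite sum-* c f xs = sym (*-distribˡ-+ c (f x) _)

  sum-0 : ∀ (xs : List A) → sum (map (λ _ → 0) xs) ≡ 0
  sum-0 []       = refl
  sum-0 (x ∷ xs) = sum-0 xs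

  sum-cong : ∀ {f g : A → ℕ} → (∀ v → f v ≡ g v) → ∀ xs → sum (map f xs) ≡ sum (map g xs)
  sum-cong h []       = refl
  sum-cong h (x ∷ xs) = cong₂ _+_ (h x) (sum-cong h xs)

  sum-≤ : ∀ {f g : A → ℕ} → (∀ v → f v ≤ g v) → ∀ xs → sum (map f xs) ≤ sum (map g xs)
  sum-≤ h []       = z≤n
  sum-≤ h (x ∷ xs) = +-mono-≤ (h x) (sum-≤ h xs)

  sum-swap : ∀ {B : Set} (f : A → B → ℕ) xs ys →
    sum (map (λ a → sum (map (f a) ys)) xs) ≡ sum (map (λ b → sum (map (λ a → f a b) xs)) ys)
  sum-swap f []       ys = sym (sum-0′ ys)
    where sum-0′ : ∀ ys → sum (map (λ _ → 0) ys) ≡ 0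
          sum-0′ []       = refl
          sum-0′ (y ∷ ys) = sum-0′ ys
  sum-swap {B} f (x ∷ xs) ys rewrite sum-swap f xs ys = sym (sum-+′ ys)
    where sum-+′ : ∀ ys → sum (map (λ b → f x b + sum (map (λ a → f a b) xs)) ys) ≡
                   sum (map (f x) ys) + sum (map (λ b → sum (map (λ a → f a b) xs)) ys)
          sum-+′ []       = refl
          sum-+′ (y ∷ ys) rewrite sum-+′ ys = lem (f x y) _ _ _
            where lem : ∀ a b c d → a + b + (c + d) ≡ a + c + (b + d)
                  lem = solve-∀

∑-suc : ∀ {n} (f : Fin (suc n) → ℕ) → ∑ f ≡ f zero + ∑ (f ∘ suc)
∑-suc {n} f = cong (λ l → f zero + sum l) (trans (map-tabulate suc f) (sym (map-tabulate (λ i → i) (f ∘ suc))))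

∑-const : ∀ n c → ∑ {n} (λ _ → c) ≡ n * c
∑-const zero    c = refl
∑-const (suc n) c = trans (∑-suc {n} (λ _ → c)) (cong (c +_) (∑-const n c))

≤∑ : ∀ {n} (f : Fin n → ℕ) u → f u ≤ ∑ f
≤∑ f u = go (∈-allFin u)
  where go : ∀ {xs} → u ∈ xs → f u ≤ sum (map f xs)
        go (here refl)          = m≤m+n _ _
        go {x ∷ xs} (there i)   = ≤-trans (go i) (m≤n+m _ (f x))

module Sums {n : ℕ} where
  open Words {n}

  δ-suc : ∀ {m} (x y : Fin m) → Words.δ {suc m} (suc x) (suc y) ≡ Words.δ {m} x y
  δ-suc x y with x ≟ y
  ... | yes _ = refl
  ... | no _  = refl

  ∑δ : ∀ {m} (y : Fin m) → ∑ (λ v → Words.δ {m} v y) ≡ 1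
  ∑δ {suc m} zero    = trans (∑-suc {m} (λ v → Words.δ v zero)) (cong suc (sum-0 (allFin m)))
  ∑δ {suc m} (suc y) = trans (∑-suc {m} (λ v → Words.δ v (suc y))) (trans (sum-cong (λ v → δ-suc v y) (allFin m)) (∑δ y))

  ∑δ* : ∀ c (y : V) → ∑ (λ v → c * δ v y) ≡ c
  ∑δ* c y = trans (sum-* c (λ v → δ v y) (allFin n)) (trans (cong (c *_) (∑δ y)) (*-identityʳ c))

  lastOf : V → List V → V
  lastOf a []      = a
  lastOf a (x ∷ M) = lastOf x M

  -- Every letter but the last has exactly one successor, whence the correction term.
  ∑steps-out : ∀ u a M → ∑ (λ v → steps u v (a ∷ M)) + δ u (lastOf a M) ≡ occ u (a ∷ M)
  ∑steps-out u a []      = trans (cong (_+ δ u a) (sum-0 (allFin n))) (sym (+-identityʳ (δ u a)))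
  ∑steps-out u a (x ∷ M) = begin
    ∑ (λ v → δ u a * δ v x + steps u v (x ∷ M)) + δ u (lastOf x M)
      ≡⟨ cong (_+ δ u (lastOf x M)) (trans (sum-+ (λ v → δ u a * δ v x) _ (allFin n)) (cong (_+ _) (∑δ* (δ u a) x))) ⟩
    δ u a + ∑ (λ v → steps u v (x ∷ M)) + δ u (lastOf x M)  ≡⟨ +-assoc (δ u a) _ _ ⟩
    δ u a + (∑ (λ v → steps u v (x ∷ M)) + δ u (lastOf x M))  ≡⟨ cong (δ u a +_) (∑steps-out u x M) ⟩
    occ u (a ∷ x ∷ M) ∎
    where open ≡-Reasoning

  ∑steps-in : ∀ u a M → ∑ (λ v → steps v u (a ∷ M)) ≡ occ u M
  ∑steps-in u a []      = sum-0 (allFin n)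
  ∑steps-in u a (x ∷ M) = begin
    ∑ (λ v → δ v a * δ u x + steps v u (x ∷ M))
      ≡⟨ trans (sum-+ (λ v → δ v a * δ u x) _ (allFin n)) (cong₂ _+_ (trans (sum-cong (λ v → *-comm (δ v a) (δ u x)) (allFin n)) (∑δ* (δ u x) a)) (∑steps-in u x M)) ⟩
    occ u (x ∷ M) ∎
    where open ≡-Reasoning

  -- The degree of `u` in an open trail: two for each occurrence of `u`, less one for each end of
  -- the trail that lies at `u`.
  ∑uses : ∀ u a M → ∑ (λ v → uses u v (a ∷ M)) + δ u (lastOf a M) ≡ occ u (a ∷ M) + occ u M
  ∑uses u a M = begin
    ∑ (λ v → steps u v (a ∷ M) + steps v u (a ∷ M)) + δ u (lastOf a M)
      ≡⟨ cong (_+ δ u (lastOf a M)) (sum-+ (λ v → steps u v (a ∷ M)) (λ v → steps v u (a ∷ M)) (allFin n)) ⟩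
    ∑ (λ v → steps u v (a ∷ M)) + ∑ (λ v → steps v u (a ∷ M)) + δ u (lastOf a M)
      ≡⟨ lem (∑ (λ v → steps u v (a ∷ M))) _ _ ⟩
    ∑ (λ v → steps u v (a ∷ M)) + δ u (lastOf a M) + ∑ (λ v → steps v u (a ∷ M))
      ≡⟨ cong₂ _+_ (∑steps-out u a M) (∑steps-in u a M) ⟩
    occ u (a ∷ M) + occ u M ∎
    where
    open ≡-Reasoning
    lem : ∀ a b c → a + b + c ≡ a + c + b
    lem = solve-∀

  lastOf-∷ʳ : ∀ a M x → lastOf a (M ++ [ x ]) ≡ x
  lastOf-∷ʳ a []      x = refl
  lastOf-∷ʳ a (y ∷ M) x = lastOf-∷ʳ y M x

  ∑uses-close : ∀ u w → ∑ (λ v → uses u v (close w)) ≡ occ u w + occ u w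
  ∑uses-close u []      = sum-0 (allFin n)
  ∑uses-close u (x ∷ w) = +-cancelʳ-≡ (δ u x) _ _ (begin
    ∑ (λ v → uses u v (close (x ∷ w))) + δ u x
      ≡⟨ cong (λ y → ∑ (λ v → uses u v (close (x ∷ w))) + δ u y) (sym (lastOf-∷ʳ x w x)) ⟩
    ∑ (λ v → uses u v (close (x ∷ w))) + δ u (lastOf x (w ++ [ x ]))  ≡⟨ ∑uses u x (w ++ [ x ]) ⟩
    δ u x + occ u (w ++ [ x ]) + occ u (w ++ [ x ])  ≡⟨ cong (λ k → δ u x + k + k) (occ-++ u w [ x ]) ⟩
    δ u x + (occ u w + (δ u x + 0)) + (occ u w + (δ u x + 0))  ≡⟨ lem (δ u x) (occ u w) ⟩
    δ u x + occ u w + (δ u x + occ u w) + δ u x ∎)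
    where
    open ≡-Reasoning
    lem : ∀ a b → a + (b + (a + 0)) + (b + (a + 0)) ≡ a + b + (a + b) + a
    lem = solve-∀

  ∑occ : ∀ w → ∑ (λ u → occ u w) ≡ length w
  ∑occ []      = sum-0 (allFin n)
  ∑occ (x ∷ w) = trans (sum-+ (λ u → δ u x) (λ u → occ u w) (allFin n)) (cong₂ _+_ (∑δ x) (∑occ w))

  ∈⇒occ : ∀ {u w} → u ∈ w → 1 ≤ occ u w
  ∈⇒occ {u} {x ∷ w} (here refl) = subst (λ k → 1 ≤ k + occ u w) (sym (δ-refl u)) (s≤s z≤n)
  ∈⇒occ {u} {x ∷ w} (there i)   = ≤-trans (∈⇒occ i) (m≤n+m _ (δ u x))

  steps⇒∈-∷ : ∀ u v x l → 1 ≤ steps u v (x ∷ l) → u ∈ x ∷ l × v ∈ x ∷ l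
  steps⇒∈-∷ u v x (y ∷ l) h with u ≟ x | v ≟ y
  ... | yes refl | yes refl = here refl , there (here refl)
  ... | yes _    | no _     = let (i , j) = steps⇒∈-∷ u v y l h in there i , there j
  ... | no _     | _        = let (i , j) = steps⇒∈-∷ u v y l h in there i , there j

  steps⇒∈ : ∀ u v l → 1 ≤ steps u v l → u ∈ l × v ∈ l
  steps⇒∈ u v (x ∷ l) h = steps⇒∈-∷ u v x l h

-- Eulerian words in 4-regular and 3-edge-connected graphs.

module EulerWords {n : ℕ} (G : Graph n) (quartic : Quartic G) (exceptional : ℕ → Exceptional) where
  open Words {n}
  open Sums {n}
  open Check G exceptional using (Euler; uses-rotate; euler-rotate)

  b2n≤1 : ∀ b → b2n b ≤ 1
  b2n≤1 true  = s≤s z≤n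
  b2n≤1 false = z≤n

  adj⇒ : ∀ {b} → b2n b ≡ 1 → b ≡ true
  adj⇒ {true} _ = refl

  -- Each passage through `u` takes two of its four edges.
  occ2 : ∀ w → Euler w → ∀ u → occ u w ≡ 2
  occ2 w E u = *-cancelˡ-≡ (occ u w) 2 2 (begin
    2 * occ u w                       ≡⟨ lem (occ u w) ⟩
    occ u w + occ u w                 ≡⟨ sym (∑uses-close u w) ⟩
    ∑ (λ v → uses u v (close w))      ≡⟨ sum-cong (λ v → E u v) (allFin n) ⟩
    degree G u                        ≡⟨ quartic u ⟩
    4 ∎)
    where
    open ≡-Reasoning
    lem : ∀ a → 2 * a ≡ a + a
    lem = solve-∀

  order≥4 : Fin n → 4 ≤ n
  order≥4 u = begin
    4          ≡⟨ sym (quartic u) ⟩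
    degree G u ≤⟨ sum-≤ (λ v → b2n≤1 (adj G u v)) (allFin n) ⟩
    ∑ {n} (λ _ → 1) ≡⟨ trans (∑-const n 1) (*-identityʳ n) ⟩
    n ∎
    where open ≤-Reasoning

  length-euler : ∀ w → Euler w → length w ≡ n * 2
  length-euler w E = trans (sym (∑occ w)) (trans (sum-cong (occ2 w E) (allFin n)) (∑-const n 2))

  -- Makes rotations preserve the number of recurrences after three and after four steps.
  long : Fin n → ∀ w → Euler w → 4 < length w
  long u w E = subst (4 <_) (sym (length-euler w E)) (≤-trans (s≤s (s≤s (s≤s (s≤s (s≤s z≤n))))) (*-monoˡ-≤ 2 (order≥4 u)))

  module Cut (conn : EdgeConnected 3 G) where

    -- Going round, only two steps join `F` and `C`: from the end of `F` to the start of `C`, and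
    -- from the end of `C` back to the start of `F`.
    crossing : ∀ f₀ Fs f₁ c₀ Cs c₁ C F → F ≡ Fs ++ [ f₁ ] → C ≡ Cs ++ [ c₁ ] → (∃[ Fr ] F ≡ f₀ ∷ Fr) → (∃[ Cr ] C ≡ c₀ ∷ Cr) →
               ∀ u v → steps u v (close (F ++ C)) ≤
               steps u v F + steps u v C + δ u f₁ * δ v c₀ + δ u c₁ * δ v f₀
    crossing f₀ Fs f₁ c₀ Cs c₁ C F eF eC (Fr , eF′) (Cr , eC′) u v = ≤-reflexive (begin
      steps u v (close (F ++ C))  ≡⟨ cong (steps u v) closed ⟩
      steps u v (Fs ++ f₁ ∷ c₀ ∷ Cr ++ [ f₀ ])  ≡⟨ steps-++ u v Fs f₁ (c₀ ∷ Cr ++ [ f₀ ]) ⟩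
      steps u v (Fs ++ [ f₁ ]) + (δ u f₁ * δ v c₀ + steps u v ((c₀ ∷ Cr) ++ [ f₀ ]))
        ≡⟨ cong₂ (λ l k → steps u v l + (δ u f₁ * δ v c₀ + k)) (sym eF)
             (trans (cong (λ l → steps u v (l ++ [ f₀ ])) (trans (sym eC′) eC))
               (trans (cong (steps u v) (++-assoc Cs [ c₁ ] [ f₀ ])) (trans (steps-++ u v Cs c₁ [ f₀ ]) (cong (λ l → steps u v l + (δ u c₁ * δ v f₀ + 0)) (sym eC))))) ⟩
      steps u v F + (δ u f₁ * δ v c₀ + (steps u v C + (δ u c₁ * δ v f₀ + 0)))
        ≡⟨ lem (steps u v F) (δ u f₁ * δ v c₀) (steps u v C) _ ⟩
      steps u v F + steps u v C + δ u f₁ * δ v c₀ + δ u c₁ * δ v f₀ ∎)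
      where
      open ≡-Reasoning
      lem : ∀ a b c d → a + (b + (c + (d + 0))) ≡ a + c + b + d
      lem = solve-∀
      closed : close (F ++ C) ≡ Fs ++ f₁ ∷ c₀ ∷ Cr ++ [ f₀ ]
      closed = begin
        close (F ++ C)               ≡⟨ cong (λ l → close (l ++ C)) eF′ ⟩
        (f₀ ∷ Fr ++ C) ++ [ f₀ ]     ≡⟨ cong (λ l → (l ++ C) ++ [ f₀ ]) (sym eF′) ⟩
        (F ++ C) ++ [ f₀ ]           ≡⟨ cong₂ (λ l k → (l ++ k) ++ [ f₀ ]) eF eC′ ⟩
        ((Fs ++ [ f₁ ]) ++ c₀ ∷ Cr) ++ [ f₀ ] ≡⟨ ++-assoc (Fs ++ [ f₁ ]) (c₀ ∷ Cr) [ f₀ ] ⟩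
        (Fs ++ [ f₁ ]) ++ c₀ ∷ Cr ++ [ f₀ ] ≡⟨ ++-assoc Fs [ f₁ ] (c₀ ∷ Cr ++ [ f₀ ]) ⟩
        Fs ++ f₁ ∷ c₀ ∷ Cr ++ [ f₀ ] ∎

    δδ⇒ : ∀ {u x v y} → δ u x * δ v y ≢ 0 → u ≡ x × v ≡ y
    δδ⇒ {u} {x} {v} {y} h with u ≟ x | v ≟ y
    ... | yes p | yes q = p , q
    ... | yes _ | no _  = ⊥-elim (h refl)
    ... | no _  | _     = ⊥-elim (h refl)

    head-last : ∀ (F : List V) {x} → x ∈ F → (∃[ f₀ ] ∃[ Fr ] F ≡ f₀ ∷ Fr) × (∃[ Fs ] ∃[ f₁ ] F ≡ Fs ++ [ f₁ ])
    head-last (f ∷ Fr) i = (f , Fr , refl) , snoc (f ∷ Fr) f Fr refl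
      where
      snoc : ∀ F f Fr → F ≡ f ∷ Fr → ∃[ Fs ] ∃[ f₁ ] F ≡ Fs ++ [ f₁ ]
      snoc F f Fr e with initLast F
      snoc .[] f Fr () | []
      ... | Fs ∷ʳ′ f₁ = Fs , f₁ , refl

    -- As `F` holds both occurrences of each of its vertices, no vertex lies in `F` and in `C`.
    -- Deleting the two edges at the joints therefore separates the vertices of `F` from those of
    -- `C`, contrary to 3-edge-connectivity.
    nocut : ∀ F C {x y} → Euler (F ++ C) → x ∈ F → y ∈ C → (∀ {z} → z ∈ F → occ z F ≡ 2) → ⊥
    nocut F C {x} {y} E i j closed with head-last F i | head-last C j
    ... | (f₀ , Fr , eF′) , (Fs , f₁ , eF) | (c₀ , Cr , eC′) , (Cs , c₁ , eC) =
      walk-out i j (conn ((f₁ , c₀) ∷ (c₁ , f₀) ∷ []) ≤-refl x y)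
      where
      outside : ∀ {z} → z ∈ F → z ∈ C → ⊥
      outside {z} p q = 1+n≰n (begin
        3                      ≡⟨ cong (_+ 1) (sym (closed p)) ⟩
        occ z F + 1            ≤⟨ +-monoʳ-≤ (occ z F) (∈⇒occ q) ⟩
        occ z F + occ z C      ≡⟨ sym (occ-++ z F C) ⟩
        occ z (F ++ C)         ≡⟨ occ2 (F ++ C) E z ⟩
        2 ∎)
        where open ≤-Reasoning
      f₀∈ : f₀ ∈ F
      f₀∈ = subst (f₀ ∈_) (sym eF′) (here refl)
      c₀∈ : c₀ ∈ C
      c₀∈ = subst (c₀ ∈_) (sym eC′) (here refl)
      pass : ∀ {u v} → 1 ≤ steps u v (close (F ++ C)) →
             (1 ≤ steps u v F) ⊎ (1 ≤ steps u v C) ⊎ (u ≡ f₁ × v ≡ c₀) ⊎ (u ≡ c₁ × v ≡ f₀)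
      pass {u} {v} h with steps u v F in e₁ | steps u v C in e₂ | δ u f₁ * δ v c₀ in e₃ | δ u c₁ * δ v f₀ in e₄
                        | crossing f₀ Fs f₁ c₀ Cs c₁ C F eF eC (Fr , eF′) (Cr , eC′) u v
      ... | suc _ | _     | _     | _     | _ = inj₁ (s≤s z≤n)
      ... | zero  | suc _ | _     | _     | _ = inj₂ (inj₁ (s≤s z≤n))
      ... | zero  | zero  | suc _ | _     | _ = inj₂ (inj₂ (inj₁ (δδ⇒ (λ z → 0≢1+n (trans (sym z) e₃)))))
      ... | zero  | zero  | zero  | suc _ | _ = inj₂ (inj₂ (inj₂ (δδ⇒ (λ z → 0≢1+n (trans (sym z) e₄)))))
      ... | zero  | zero  | zero  | zero  | le = ⊥-elim (1+n≰n (≤-trans h le))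
      leave : ∀ {u v} → u ∈ F → v ∈ C → Adj G u v → Removed ((f₁ , c₀) ∷ (c₁ , f₀) ∷ []) u v
      leave {u} {v} p q a with steps u v (close (F ++ C)) in e | trans (E u v) (cong b2n a)
      ... | suc k | _ with pass {u} {v} (subst (1 ≤_) (sym e) (s≤s z≤n))
      ...   | inj₁ s                      = ⊥-elim (outside (proj₂ (steps⇒∈ u v F s)) q)
      ...   | inj₂ (inj₁ s)               = ⊥-elim (outside p (proj₁ (steps⇒∈ u v C s)))
      ...   | inj₂ (inj₂ (inj₁ (eu , ev))) = here (inj₁ (sym eu , sym ev))
      ...   | inj₂ (inj₂ (inj₂ (eu , ev))) = ⊥-elim (outside (subst (_∈ F) (sym ev) f₀∈) q)
      leave {u} {v} p q a | zero | e′ with pass {v} {u} (subst (1 ≤_) (sym e′) (s≤s z≤n))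
      ...   | inj₁ s                      = ⊥-elim (outside (proj₁ (steps⇒∈ v u F s)) q)
      ...   | inj₂ (inj₁ s)               = ⊥-elim (outside p (proj₂ (steps⇒∈ v u C s)))
      ...   | inj₂ (inj₂ (inj₁ (ev , eu))) = ⊥-elim (outside p (subst (_∈ C) (sym eu) c₀∈))
      ...   | inj₂ (inj₂ (inj₂ (ev , eu))) = there (here (inj₂ (sym ev , sym eu)))
      everywhere : ∀ v → (v ∈ F) ⊎ (v ∈ C)
      everywhere v = ∈-++⁻ F (occ>0 (F ++ C) (subst (1 ≤_) (sym (occ2 (F ++ C) E v)) (s≤s z≤n)))
        where
        occ>0 : ∀ w → 1 ≤ occ v w → v ∈ w
        occ>0 (x ∷ w) h with v ≟ x
        ... | yes refl = here refl
        ... | no _     = there (occ>0 w h)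
      walk-out : ∀ {u v} → u ∈ F → v ∈ C → Reach G ((f₁ , c₀) ∷ (c₁ , f₀) ∷ []) u v → ⊥
      walk-out p q Reach.here = outside p q
      walk-out p q (Reach.step {w = w} a ¬r R) with everywhere w
      ... | inj₁ p′ = walk-out p′ q R
      ... | inj₂ q′ = ¬r (leave p q′ a)

-- Existence of an Eulerian circuit.

module Hierholzer {n : ℕ} (G : Graph n) (quartic : Quartic G) (conn : EdgeConnected 3 G) (exceptional : ℕ → Exceptional) where
  open Words {n}
  open Sums {n}
  open Check G exceptional using (Euler; uses-rotate; euler-rotate)
  open EulerWords G quartic exceptional

  Valid : List V → Set
  Valid l = ∀ u v → uses u v l ≤ b2n (adj G u v)

  Saturated : List V → V → Set
  Saturated l u = ∀ v → uses u v l ≡ b2n (adj G u v)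

  saturated? : ∀ l u → Dec (Saturated l u)
  saturated? l u = all? λ v → uses u v l ℕₚ.≟ b2n (adj G u v)

  steps-∷ʳ : ∀ u v a M x → steps u v (a ∷ M ++ [ x ]) ≡ steps u v (a ∷ M) + δ u (lastOf a M) * δ v x
  steps-∷ʳ u v a []      x = +-identityʳ _
  steps-∷ʳ u v a (y ∷ M) x = trans (cong (δ u a * δ v y +_) (steps-∷ʳ u v y M x)) (sym (+-assoc (δ u a * δ v y) _ _))

  extend : ∀ a M x → Valid (a ∷ M) → uses (lastOf a M) x (a ∷ M) < b2n (adj G (lastOf a M) x) → Valid (a ∷ M ++ [ x ])
  extend a M x ok lt u v = begin
    uses u v (a ∷ M ++ [ x ])
      ≡⟨ cong₂ _+_ (steps-∷ʳ u v a M x) (steps-∷ʳ v u a M x) ⟩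
    steps u v (a ∷ M) + δ u b * δ v x + (steps v u (a ∷ M) + δ v b * δ u x)
      ≡⟨ lem (steps u v (a ∷ M)) _ (steps v u (a ∷ M)) _ ⟩
    uses u v (a ∷ M) + (δ u b * δ v x + δ v b * δ u x) ≤⟨ bound ⟩
    b2n (adj G u v) ∎
    where
    open ≤-Reasoning
    b = lastOf a M
    lem : ∀ a b c d → a + b + (c + d) ≡ a + c + (b + d)
    lem = solve-∀
    -- The new step follows an edge, not a loop, so it counts in one direction only.
    b≢x : b ≢ x
    b≢x refl = n≮0 (subst (λ k → uses b b (a ∷ M) < b2n k) (irref G b) lt)
    bound : uses u v (a ∷ M) + (δ u b * δ v x + δ v b * δ u x) ≤ b2n (adj G u v)
    bound with u ≟ b | v ≟ x
    ... | yes refl | yes refl rewrite δ-≢ (λ e → b≢x (sym e)) = ≤-trans (≤-reflexive (+-comm (uses u v (a ∷ M)) 1)) lt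
    ... | yes refl | no v≢x   rewrite δ-≢ b≢x | *-zeroʳ (δ v u) = ≤-trans (≤-reflexive (+-identityʳ _)) (ok u v)
    ... | no u≢b   | _ with v ≟ b | u ≟ x
    ...   | no _     | _        = ≤-trans (≤-reflexive (+-identityʳ _)) (ok u v)
    ...   | yes refl | no _     = ≤-trans (≤-reflexive (+-identityʳ _)) (ok u v)
    ...   | yes refl | yes refl = begin
      uses u v (a ∷ M) + 1   ≡⟨ +-comm (uses u v (a ∷ M)) 1 ⟩
      suc (uses u v (a ∷ M)) ≡⟨ cong suc (+-comm (steps u v (a ∷ M)) _) ⟩
      suc (uses v u (a ∷ M)) ≤⟨ lt ⟩
      b2n (adj G v u)        ≡⟨ cong b2n (Graph.sym G v u) ⟩
      b2n (adj G u v) ∎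

  length-trail : ∀ a M → ∑ (λ u → ∑ (λ v → uses u v (a ∷ M))) ≡ length M + length M
  length-trail a M = suc-injective (begin
    suc (∑ X)                          ≡⟨ +-comm 1 (∑ X) ⟩
    ∑ X + 1                            ≡⟨ cong (∑ X +_) (sym (∑δ (lastOf a M))) ⟩
    ∑ X + ∑ (λ u → δ u (lastOf a M))   ≡⟨ sym (sum-+ X _ (allFin n)) ⟩
    ∑ (λ u → X u + δ u (lastOf a M))   ≡⟨ sum-cong (λ u → ∑uses u a M) (allFin n) ⟩
    ∑ (λ u → occ u (a ∷ M) + occ u M)  ≡⟨ sum-+ (λ u → occ u (a ∷ M)) (λ u → occ u M) (allFin n) ⟩
    ∑ (λ u → occ u (a ∷ M)) + ∑ (λ u → occ u M)  ≡⟨ cong₂ _+_ (∑occ (a ∷ M)) (∑occ M) ⟩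
    suc (length M + length M) ∎)
    where
    open ≡-Reasoning
    X : V → ℕ
    X u = ∑ (λ v → uses u v (a ∷ M))

  -- A trail has at most as many steps as there are edges, which is half the degree sum `4n`.
  short : ∀ a M → Valid (a ∷ M) → length M ≤ n * 2
  short a M ok = *-cancelˡ-≤ 2 (begin
    2 * length M                            ≡⟨ lem (length M) ⟩
    length M + length M                     ≡⟨ sym (length-trail a M) ⟩
    ∑ (λ u → ∑ (λ v → uses u v (a ∷ M)))    ≤⟨ sum-≤ (λ u → sum-≤ (ok u) (allFin n)) (allFin n) ⟩
    ∑ (λ u → degree G u)                    ≡⟨ sum-cong quartic (allFin n) ⟩
    ∑ {n} (λ _ → 4)                         ≡⟨ ∑-const n 4 ⟩
    n * 4                                   ≡⟨ lem′ n ⟩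
    2 * (n * 2) ∎)
    where
    open ≤-Reasoning
    lem : ∀ a → 2 * a ≡ a + a
    lem = solve-∀
    lem′ : ∀ a → a * 4 ≡ 2 * (a * 2)
    lem′ = solve-∀

  odd≢even : ∀ a → 5 ≢ a + a
  odd≢even 0 ()
  odd≢even 1 ()
  odd≢even 2 ()
  odd≢even (suc (suc (suc a))) e = impossible (trans e (lem a))
    where
    lem : ∀ a → suc (suc (suc a)) + suc (suc (suc a)) ≡ suc (suc (suc (suc (suc (suc (a + a))))))
    lem = solve-∀
    impossible : ∀ {b} → 5 ≢ suc (suc (suc (suc (suc (suc b)))))
    impossible ()

  -- A trail that cannot be prolonged has returned to its start, all degrees being even.
  returns : ∀ a M → Saturated (a ∷ M) (lastOf a M) → lastOf a M ≡ a
  returns a M sat with lastOf a M ≟ a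
  ... | yes e = e
  -- Each occurrence of `b` accounts for two edges, except that the last letter has no successor:
  -- the four used edges and the missing one would add up to an even number.
  ... | no b≢a = ⊥-elim (odd≢even (occ b M) (begin
    5                                        ≡⟨ cong (_+ 1) (sym (quartic b)) ⟩
    degree G b + 1                           ≡⟨ cong₂ _+_ (sum-cong (λ v → sym (sat v)) (allFin n)) (sym (δ-refl b)) ⟩
    ∑ (λ v → uses b v (a ∷ M)) + δ b b       ≡⟨ ∑uses b a M ⟩
    δ b a + occ b M + occ b M                ≡⟨ cong (λ k → k + occ b M + occ b M) (δ-≢ b≢a) ⟩
    occ b M + occ b M ∎))
    where
    open ≡-Reasoning
    b = lastOf a M

  uses⇒∈ : ∀ u v l → uses u v l ≡ 1 → v ∈ l
  uses⇒∈ u v l e with steps u v l in e₁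
  ... | suc _ = proj₂ (steps⇒∈ u v l (subst (1 ≤_) (sym e₁) (s≤s z≤n)))
  ... | zero  = proj₁ (steps⇒∈ v u l (subst (1 ≤_) (sym e) ≤-refl))

  occ>0⇒∈ : ∀ u l → occ u l ≢ 0 → u ∈ l
  occ>0⇒∈ u []      h = ⊥-elim (h refl)
  occ>0⇒∈ u (x ∷ l) h with u ≟ x
  ... | yes refl = here refl
  ... | no _     = there (occ>0⇒∈ u l h)

  -- The neighbours of a saturated vertex occur in the word too, so a word all of whose vertices are
  -- saturated spreads along every walk.
  covers : ∀ l → (∀ u → (occ u l ≡ 0) ⊎ Saturated l u) → ∀ {u v} → u ∈ l → Reach G [] u v → v ∈ l
  covers l sat i Reach.here = i
  covers l sat {u} i (Reach.step {w = w} a _ R) with sat u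
  ... | inj₁ z = ⊥-elim (1+n≢0 (trans (sym (≤-antisym (≤-trans (≤-reflexive z) z≤n) (∈⇒occ i))) z))
  ... | inj₂ s = covers l sat (uses⇒∈ u w l (trans (s w) (cong b2n a))) R

  unused : ∀ l u → Valid l → ¬ Saturated l u → ∃[ v ] uses u v l < b2n (adj G u v)
  unused l u ok ¬s with ¬∀⟶∃¬ n (λ v → uses u v l ≡ b2n (adj G u v)) (λ v → uses u v l ℕₚ.≟ b2n (adj G u v)) ¬s
  ... | v , ne = v , ≤∧≢⇒< (ok u v) ne

  ∈-close : ∀ {u} a (M : List V) → u ∈ a ∷ M ++ [ a ] → u ∈ a ∷ M
  ∈-close a M (here e) = here e
  ∈-close a M (there i) with ∈-++⁻ M i
  ... | inj₁ j        = there j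
  ... | inj₂ (here e) = here e

  not-empty : ∀ a → ¬ Saturated (a ∷ []) a
  not-empty a s = 1+n≢0 (trans (sym (quartic a)) (trans (sum-cong (λ v → sym (s v)) (allFin n)) (sum-0 (allFin n))))

  grow : ∀ k a M → Valid (a ∷ M) → n * 2 < length M + k → ∃[ w ] Euler w
  grow zero a M ok h = ⊥-elim (<⇒≱ (subst (n * 2 <_) (+-identityʳ _) h) (short a M ok))
  grow (suc k) a M ok h with saturated? (a ∷ M) (lastOf a M)
  ... | no ¬s with unused (a ∷ M) (lastOf a M) ok ¬s
  ...   | v , lt = grow k a (M ++ [ v ]) (extend a M v ok lt)
                     (subst (n * 2 <_) (trans (+-suc (length M) k) (cong (_+ k) (trans (+-comm 1 (length M)) (sym (length-++ M))))) h)
  grow (suc k) a M ok h | yes s with initLast M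
  ... | []       = ⊥-elim (not-empty a s)
  ... | M′ ∷ʳ′ z with trans (sym (lastOf-∷ʳ a M′ z)) (returns a (M′ ++ [ z ]) s)
  ...   | refl with all? (λ u → (occ u (close (a ∷ M′)) ℕₚ.≟ 0) ⊎-dec saturated? (close (a ∷ M′)) u)
  ...     | yes sat = a ∷ M′ , euler
    where
    euler : Euler (a ∷ M′)
    euler u with sat u
    ... | inj₂ s = s
    ... | inj₁ z = ⊥-elim (1+n≰n (≤-trans (∈⇒occ (covers (close (a ∷ M′)) sat (here refl) (conn [] (s≤s z≤n) a u))) (≤-reflexive z)))
  ...     | no ¬sat with ¬∀⟶∃¬ n _ (λ u → (occ u (close (a ∷ M′)) ℕₚ.≟ 0) ⊎-dec saturated? (close (a ∷ M′)) u) ¬sat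
  ...       | u , ¬d with ∈-∃++ (∈-close a M′ (occ>0⇒∈ u (close (a ∷ M′)) (λ z → ¬d (inj₁ z))))
  ...         | A , B , e with unused (close (a ∷ M′)) u ok (λ s → ¬d (inj₂ s))
  ...           | v , lt = grow k u ((B ++ A ++ [ u ]) ++ [ v ])
                   (extend u (B ++ A ++ [ u ]) v (λ x y → subst (_≤ b2n (adj G x y)) (same x y) (ok x y))
                     (subst (λ z → uses z v (u ∷ B ++ A ++ [ u ]) < b2n (adj G z v)) (sym lastu) (subst (_< b2n (adj G u v)) (same u v) lt)))
                   (subst (n * 2 <_) len-eq h)
    where
    same : ∀ x y → uses x y (close (a ∷ M′)) ≡ uses x y (u ∷ B ++ A ++ [ u ])
    same x y = trans (cong (λ l → uses x y (close l)) e) (trans (uses-rotate x y A (u ∷ B)) (cong (λ l → uses x y (u ∷ l)) (++-assoc B A [ u ])))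
    lastu : lastOf u (B ++ A ++ [ u ]) ≡ u
    lastu = trans (cong (lastOf u) (sym (++-assoc B A [ u ]))) (lastOf-∷ʳ u (B ++ A) u)
    len-eq : length (M′ ++ [ a ]) + suc k ≡ length ((B ++ A ++ [ u ]) ++ [ v ]) + k
    len-eq = begin
      length (M′ ++ [ a ]) + suc k   ≡⟨ cong (_+ suc k) (trans (length-++ M′) (+-comm (length M′) 1)) ⟩
      length (a ∷ M′) + suc k        ≡⟨ cong (λ l → length l + suc k) e ⟩
      length (A ++ u ∷ B) + suc k    ≡⟨ cong (_+ suc k) (length-++ A) ⟩
      length A + suc (length B) + suc k ≡⟨ lem (length A) (length B) k ⟩
      length B + (length A + 1) + 1 + k
        ≡⟨ cong (_+ k) (sym (trans (length-++ (B ++ A ++ [ u ])) (cong (_+ 1) (trans (length-++ B) (cong (length B +_) (length-++ A)))))) ⟩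
      length ((B ++ A ++ [ u ]) ++ [ v ]) + k ∎
      where
      open ≡-Reasoning
      lem : ∀ a b c → a + suc b + suc c ≡ b + (a + 1) + 1 + c
      lem = solve-∀

  eulerian : V → ∃[ w ] Euler w
  eulerian a = grow (suc (n * 2)) a [] (λ u v → z≤n) ≤-refl

-- Finding a recurrence and descending on the cost.

module _ {A : Set} where
  !?-++-just : ∀ (xs ys : List A) d {x} → xs !? d ≡ just x → (xs ++ ys) !? d ≡ just x
  !?-++-just (z ∷ xs) ys zero    e = e
  !?-++-just (z ∷ xs) ys (suc d) e = !?-++-just xs ys d e

  !?-++ʳ : ∀ (xs ys : List A) d → (xs ++ ys) !? (length xs + d) ≡ ys !? d
  !?-++ʳ []       ys d = refl
  !?-++ʳ (x ∷ xs) ys d = !?-++ʳ xs ys d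

  !?-splits : ∀ (l : List A) i {x} → l !? i ≡ just x → ∃₂ λ P Q → l ≡ P ++ x ∷ Q × length P ≡ i
  !?-splits (z ∷ l) zero    refl = [] , l , refl , refl
  !?-splits (z ∷ l) (suc i) e with !?-splits l i e
  ... | P , Q , e′ , h = z ∷ P , Q , cong (z ∷_) e′ , cong suc h

  !?-lookup : ∀ (l : List A) (i : Fin (length l)) → l !? toℕ i ≡ just (lookup l i)
  !?-lookup (x ∷ l) zero    = refl
  !?-lookup (x ∷ l) (suc i) = !?-lookup l i

-- The hidden segment is the whole remainder of the circuit, so these match every circuit that is
-- rotated to begin with a recurrence after three or four steps.
root₃ root₄ : State
root₃ = L 1 ∷ L 2 ∷ L 3 ∷ L 1 ∷ Z 0 false ∷ [] , []
root₄ = L 1 ∷ L 2 ∷ L 3 ∷ L 4 ∷ L 1 ∷ Z 0 false ∷ [] , []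

module Gaps {n : ℕ} where
  open Words {n}

  δ?>0 : ∀ m m′ → 1 ≤ δ? m m′ → ∃[ x ] (m ≡ just x × m′ ≡ just x)
  δ?>0 (just x) (just y) h with x ≟ y
  ... | yes refl = x , refl , refl

  lin>0 : ∀ d w → 1 ≤ lin d w → ∃[ xs ] ∃[ x ] ∃[ ys ] (w ≡ xs ++ x ∷ ys × ys !? d ≡ just x)
  lin>0 d (z ∷ w) h with δ? (just z) (w !? d) in eq
  ... | suc _ with δ?>0 (just z) (w !? d) (subst (1 ≤_) (sym eq) (s≤s z≤n))
  ...   | .z , refl , e = [] , z , w , refl , e
  lin>0 d (z ∷ w) h | zero with lin>0 d w h
  ... | xs , x , ys , e , e′ = z ∷ xs , x , ys , cong (z ∷_) e , e′

  cross>0 : ∀ d xr ys → 1 ≤ cross d xr ys → ∃[ i ] ∃[ j ] ∃[ x ] (i + j ≡ d × xr !? i ≡ just x × ys !? j ≡ just x)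
  cross>0 zero (z ∷ xr) ys h with δ?>0 (just z) (ys !? 0) h
  ... | x , e , e′ = 0 , 0 , x , refl , e , e′
  cross>0 (suc d) (z ∷ xr) ys h with δ? (just z) (ys !? suc d) in eq
  ... | suc _ with δ?>0 (just z) (ys !? suc d) (subst (1 ≤_) (sym eq) (s≤s z≤n))
  ...   | x , e , e′ = 0 , suc d , x , refl , e , e′
  cross>0 (suc d) (z ∷ xr) ys h | zero with cross>0 d xr ys h
  ... | i , j , x , s , e , e′ = suc i , j , x , cong suc s , e , e′

  -- Supplies the rotation that brings a recurrence to the front, as the root patterns demand.
  gaps>0 : ∀ d w → suc d < length w → 1 ≤ gaps d w → ∃[ xs ] ∃[ x ] ∃[ ys ] (w ≡ xs ++ x ∷ ys × (ys ++ xs) !? d ≡ just x)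
  gaps>0 d w h g with lin d w in eq
  ... | suc _ with lin>0 d w (subst (1 ≤_) (sym eq) (s≤s z≤n))
  ...   | xs , x , ys , e , e′ = xs , x , ys , e , !?-++-just ys xs d e′
  gaps>0 d w h g | zero with cross>0 d (reverse w) w g
  ... | i , j , x , s , e , e′ with !?-splits (reverse w) i e
  ...   | P , Q , r , len-P = reverse Q , x , reverse P , w≡ , (begin
      (reverse P ++ reverse Q) !? d                      ≡⟨ cong ((reverse P ++ reverse Q) !?_) (trans (sym s) (cong (_+ j) (sym (trans (length-reverse P) len-P)))) ⟩
      (reverse P ++ reverse Q) !? (length (reverse P) + j) ≡⟨ !?-++ʳ (reverse P) (reverse Q) j ⟩
      reverse Q !? j                                     ≡⟨ sym (!?-++ˡ (reverse Q) j<) ⟩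
      (reverse Q ++ x ∷ reverse P) !? j                  ≡⟨ cong (_!? j) (sym w≡) ⟩
      w !? j                                             ≡⟨ e′ ⟩
      just x ∎)
    where
    open ≡-Reasoning
    w≡ : w ≡ reverse Q ++ x ∷ reverse P
    w≡ = begin
      w                             ≡⟨ sym (reverse-involutive w) ⟩
      reverse (reverse w)           ≡⟨ cong reverse r ⟩
      reverse (P ++ x ∷ Q)          ≡⟨ reverse-++ P (x ∷ Q) ⟩
      reverse (x ∷ Q) ++ reverse P  ≡⟨ cong (_++ reverse P) (unfold-reverse x Q) ⟩
      (reverse Q ++ [ x ]) ++ reverse P ≡⟨ ++-assoc (reverse Q) [ x ] (reverse P) ⟩
      reverse Q ++ x ∷ reverse P ∎
    len-w : length w ≡ length (reverse Q) + suc i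
    len-w = trans (cong length w≡) (trans (length-++ (reverse Q)) (cong (λ k → length (reverse Q) + suc k) (trans (length-reverse P) len-P)))
    -- Since the word is longer than the distance, a pair that passes its end comes back to a
    -- position strictly before its first member.
    j< : j < length (reverse Q)
    j< = +-cancelʳ-< (suc i) j (length (reverse Q)) (subst₂ _<_ (trans (cong suc (trans (sym s) (+-comm i j))) (sym (+-suc j i))) len-w h)

module Descent {n : ℕ} (G : Graph n) (quartic : Quartic G) (conn : EdgeConnected 3 G) (exceptional : ℕ → Exceptional) (v₀ : Fin n) where
  open Words {n}
  open Gaps {n}
  open Sem {n}
  open Check G exceptional
  open EulerWords G quartic exceptional
  open Cut conn
  open Hierholzer G quartic conn exceptional using (eulerian)

  cost-rotate : ∀ xs ys → 4 < length (xs ++ ys) → cost (xs ++ ys) ≡ cost (ys ++ xs)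
  cost-rotate xs ys h = cong₂ (λ a b → 2 * a + b) (gaps-rotate 1 xs ys (<-trans (n<1+n 3) h)) (gaps-rotate 2 xs ys h)

  NoGaps : List V → Set
  NoGaps w = gaps 2 w ≡ 0 × gaps 3 w ≡ 0

  module _ (refuted₃ : Refuted occ2 (long v₀) nocut false root₃)
           (refuted₄ : Refuted occ2 (long v₀) nocut true root₄) where

    improve₃ : ∀ w → Euler w → 1 ≤ gaps 2 w → Outcome occ2 (long v₀) nocut w
    improve₃ w E h with gaps>0 2 w (<-trans (n<1+n 3) (long v₀ w E)) h
    ... | xs , x , ys , refl , e = result (ys ++ xs) refl e
      where
      result : ∀ zs → ys ++ xs ≡ zs → zs !? 2 ≡ just x → Outcome occ2 (long v₀) nocut (xs ++ x ∷ ys)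
      result (a ∷ b ∷ .x ∷ rest) eq refl
        with refuted₃ (x ∷ a ∷ b ∷ x ∷ rest)
               (record { euler = subst (λ l → Euler (x ∷ l)) eq (euler-rotate xs (x ∷ ys) E) ; no3 = λ () })
               -- The values of names that do not occur in the root pattern are arbitrary.
               (λ { 1 → x ; 2 → a ; 3 → b ; _ → x }) (λ _ → rest)
               (cong (λ l → x ∷ a ∷ b ∷ x ∷ l) (++-identityʳ rest) , [])
      ... | inj₁ exc           = inj₁ exc
      ... | inj₂ (w′ , E′ , lt) = inj₂ (w′ , E′ , subst (cost w′ <_)
              (trans (cong (λ l → cost (x ∷ l)) (sym eq)) (sym (cost-rotate xs (x ∷ ys) (long v₀ (xs ++ x ∷ ys) E)))) lt)

    improve₄ : ∀ w → Euler w → gaps 2 w ≡ 0 → 1 ≤ gaps 3 w → Outcome occ2 (long v₀) nocut w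
    improve₄ w E z h with gaps>0 3 w (long v₀ w E) h
    ... | xs , x , ys , refl , e = result (ys ++ xs) refl e
      where
      result : ∀ zs → ys ++ xs ≡ zs → zs !? 3 ≡ just x → Outcome occ2 (long v₀) nocut (xs ++ x ∷ ys)
      result (a ∷ b ∷ c ∷ .x ∷ rest) eq refl
        with refuted₄ (x ∷ a ∷ b ∷ c ∷ x ∷ rest)
               (record { euler = subst (λ l → Euler (x ∷ l)) eq (euler-rotate xs (x ∷ ys) E)
                       ; no3 = λ _ → trans (cong (λ l → gaps 2 (x ∷ l)) (sym eq))
                                 (trans (sym (gaps-rotate 1 xs (x ∷ ys) (<-trans (n<1+n 3) (long v₀ (xs ++ x ∷ ys) E)))) z) })
               (λ { 1 → x ; 2 → a ; 3 → b ; 4 → c ; _ → x }) (λ _ → rest)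
               (cong (λ l → x ∷ a ∷ b ∷ c ∷ x ∷ l) (++-identityʳ rest) , [])
      ... | inj₁ exc           = inj₁ exc
      ... | inj₂ (w′ , E′ , lt) = inj₂ (w′ , E′ , subst (cost w′ <_)
              (trans (cong (λ l → cost (x ∷ l)) (sym eq)) (sym (cost-rotate xs (x ∷ ys) (long v₀ (xs ++ x ∷ ys) E)))) lt)

    -- Recurrences after three steps have priority, so `improve₄` is called only on circuits that
    -- satisfy the flag of its certificate.
    descend : ∀ k w → Euler w → cost w < k → Exc ⊎ ∃[ w ] (Euler w × NoGaps w)
    descend (suc k) w E (s≤s h) with gaps 2 w in e₂
    ... | suc _ with improve₃ w E (subst (1 ≤_) (sym e₂) (s≤s z≤n))
    ...   | inj₁ exc            = inj₁ exc
    ...   | inj₂ (w′ , E′ , lt) = descend k w′ E′ (<-≤-trans (subst (cost w′ <_) (cong (λ a → 2 * a + gaps 3 w) e₂) lt) h)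
    descend (suc k) w E (s≤s h) | zero with gaps 3 w in e₃
    ... | zero  = inj₂ (w , E , e₂ , e₃)
    ... | suc _ with improve₄ w E e₂ (subst (1 ≤_) (sym e₃) (s≤s z≤n))
    ...   | inj₁ exc            = inj₁ exc
    ...   | inj₂ (w′ , E′ , lt) = descend k w′ E′ (<-≤-trans (subst (cost w′ <_) (cong₂ (λ a b → 2 * a + b) e₂ e₃) lt) h)

    gapless : Exc ⊎ ∃[ w ] (Euler w × NoGaps w)
    gapless with eulerian v₀
    ... | w , E = descend (suc (cost w)) w E ≤-refl

-- From cyclic words to circuits.

module ToCircuit {n : ℕ} (G : Graph n) (quartic : Quartic G) (exceptional : ℕ → Exceptional) where
  open Words {n}
  open Check G exceptional using (Euler; euler-rotate)
  open EulerWords G quartic exceptional using (b2n≤1; adj⇒; long)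

  steps-!? : ∀ k l {a b} → l !? k ≡ just a → l !? suc k ≡ just b → 1 ≤ steps a b l
  steps-!? zero    (a ∷ b ∷ l) refl refl rewrite δ-refl a | δ-refl b = s≤s z≤n
  steps-!? (suc k) (x ∷ y ∷ l) {a} {b} e e′ = ≤-trans (steps-!? k (y ∷ l) e e′) (m≤n+m _ (δ a x * δ b y))

  steps-first : ∀ a b l → steps a b (a ∷ b ∷ l) ≡ suc (steps a b (b ∷ l))
  steps-first a b l rewrite δ-refl a | δ-refl b = refl

  steps⇒!?-∷ : ∀ a b x l → 1 ≤ steps a b (x ∷ l) → ∃[ k ] ((x ∷ l) !? k ≡ just a × (x ∷ l) !? suc k ≡ just b)
  steps⇒!?-∷ a b x (y ∷ l) h with a ≟ x | b ≟ y
  ... | yes refl | yes refl = 0 , refl , refl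
  ... | yes _    | no _     = let (k , e , e′) = steps⇒!?-∷ a b y l h in suc k , e , e′
  ... | no _     | _        = let (k , e , e′) = steps⇒!?-∷ a b y l h in suc k , e , e′

  !?-< : ∀ (l : List V) k {a} → l !? k ≡ just a → k < length l
  !?-< (x ∷ l) zero    _ = s≤s z≤n
  !?-< (x ∷ l) (suc k) e = s≤s (!?-< l k e)

  !?-last : ∀ (l : List V) x → (l ++ [ x ]) !? length l ≡ just x
  !?-last []      x = refl
  !?-last (y ∷ l) x = !?-last l x

  module _ (x : V) (xs : List V) (E₀ : Euler (x ∷ xs)) (gapless : gaps 2 (x ∷ xs) ≡ 0 × gaps 3 (x ∷ xs) ≡ 0) where

    N : ℕ
    N = suc (length xs)

    pos : ℕ → V
    pos i = lookup (x ∷ xs) (i mod N)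

    pos-% : ∀ i → (x ∷ xs) !? (i % N) ≡ just (pos i)
    pos-% i = trans (cong ((x ∷ xs) !?_) (sym (toℕ-fromℕ< (m%n<n i N)))) (!?-lookup (x ∷ xs) (i mod N))

    pos-≡ : ∀ {i j} → i % N ≡ j % N → pos i ≡ pos j
    pos-≡ {i} {j} e = just-injective (trans (sym (pos-% i)) (trans (cong ((x ∷ xs) !?_) e) (pos-% j)))

    pos-+N : ∀ i → pos (i + N) ≡ pos i
    pos-+N i = pos-≡ {i + N} {i} ([m+n]%n≡m%n i N)

    -- The circuit read from position i on.
    record Window (i : ℕ) : Set where
      constructor window
      field
        y     : V
        ys    : List V
        euler : Euler (y ∷ ys)
        no2   : gaps 2 (y ∷ ys) ≡ 0
        no3   : gaps 3 (y ∷ ys) ≡ 0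
        len-ys  : length ys ≡ length xs
        reads : ∀ k → k < N → (y ∷ ys) !? k ≡ just (pos (i + k))
      loops : ∀ k → k ≤ N → close (y ∷ ys) !? k ≡ just (pos (i + k))
      loops k h with m≤n⇒m<n∨m≡n h
      ... | inj₁ lt   = trans (!?-++ˡ (y ∷ ys) (subst (k <_) (cong suc (sym len-ys)) lt)) (reads k lt)
      ... | inj₂ refl = trans (trans (cong ((y ∷ ys ++ [ y ]) !?_) (cong suc (sym len-ys))) (!?-last (y ∷ ys) y))
                         (trans (reads 0 (s≤s z≤n)) (cong just (trans (cong pos (+-identityʳ i)) (sym (pos-+N i)))))
    open Window

    windows : ∀ i → Window i
    windows zero = window x xs E₀ (proj₁ gapless) (proj₂ gapless) refl
      (λ k h → trans (cong ((x ∷ xs) !?_) (sym (m<n⇒m%n≡m h))) (pos-% k))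
    windows (suc i) with windows i
    ... | window y [] E g₂ g₃ sz rd = ⊥-elim (n≮0 (s≤s⁻¹ (≤-trans (long y (y ∷ []) E) (s≤s z≤n))))
    ... | window y (z ∷ ys) E g₂ g₃ sz rd = window z (ys ++ [ y ]) (euler-rotate [ y ] (z ∷ ys) E)
        (trans (sym (gaps-rotate 1 [ y ] (z ∷ ys) (<-trans (n<1+n 3) (long y (y ∷ z ∷ ys) E)))) g₂)
        (trans (sym (gaps-rotate 2 [ y ] (z ∷ ys) (long y (y ∷ z ∷ ys) E))) g₃)
        (trans (length-++ ys) (trans (+-comm (length ys) 1) sz)) rd′
      where
      rd′ : ∀ k → k < N → (z ∷ ys ++ [ y ]) !? k ≡ just (pos (suc i + k))
      rd′ k h with m≤n⇒m<n∨m≡n h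
      ... | inj₁ lt   = trans (!?-++ˡ (z ∷ ys) (subst (k <_) (sym sz) (s≤s⁻¹ lt))) (trans (rd (suc k) lt) (cong (λ m → just (pos m)) (+-suc i k)))
      ... | inj₂ refl = trans (trans (cong ((z ∷ ys ++ [ y ]) !?_) (sym sz)) (!?-last (z ∷ ys) y))
                         (trans (rd 0 (s≤s z≤n)) (cong just (trans (cong pos (+-identityʳ i)) (trans (sym (pos-+N i)) (cong pos (+-suc i (length xs)))))))

    uses≤1 : ∀ w → Euler w → ∀ u v → uses u v (close w) ≤ 1
    uses≤1 w E u v = subst (_≤ 1) (sym (E u v)) (b2n≤1 (adj G u v))

    1<N : 1 < N
    1<N = <-trans (s≤s (s≤s z≤n)) (long x (x ∷ xs) E₀)

    adjacent⇐ : ∀ w → Euler w → ∀ u v → 1 ≤ steps u v (close w) → Adj G u v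
    adjacent⇐ w E u v h = adj⇒ (trans (sym (E u v)) (≤-antisym (uses≤1 w E u v) (≤-trans h (m≤m+n _ _))))

    first : ∀ {i} (W : Window i) → y W ≡ pos i
    first {i} W = just-injective (trans (reads W 0 (s≤s z≤n)) (cong (λ m → just (pos m)) (+-identityʳ i)))

    walks : ∀ i → Adj G (pos i) (pos (suc i))
    walks i = subst (λ m → Adj G (pos m) (pos (suc i))) (+-identityʳ i)
      (subst (λ m → Adj G (pos (i + 0)) (pos m)) (+-comm i 1)
        (adjacent⇐ (y W ∷ ys W) (euler W) _ _ (steps-!? 0 (close (y W ∷ ys W)) (loops W 0 z≤n) (loops W 1 (s≤s z≤n)))))
      where W = windows i

    -- In the window at `i` the two passages are the first step and a later one; together they would
    -- make an edge used twice.
    once : ∀ i k → suc k < N → ¬ ((pos i ≡ pos (i + suc k) × pos (i + 1) ≡ pos (i + suc (suc k))) ⊎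
                                   (pos i ≡ pos (i + suc (suc k)) × pos (i + 1) ≡ pos (i + suc k)))
    once i k h same with windows i
    ... | window y [] E _ _ sz _ = n≮0 (s≤s⁻¹ (≤-trans (long y (y ∷ []) E) (s≤s z≤n)))
    ... | W@(window y (z ∷ ys) E _ _ _ _) = contra same
      where
      l : List V
      l = z ∷ ys ++ [ y ]
      y≡ : y ≡ pos i
      y≡ = first W
      z≡ : z ≡ pos (i + 1)
      z≡ = just-injective (reads W 1 1<N)
      at₁ : l !? k ≡ just (pos (i + suc k))
      at₁ = loops W (suc k) (<⇒≤ h)
      at₂ : l !? suc k ≡ just (pos (i + suc (suc k)))
      at₂ = loops W (suc (suc k)) h
      contra : _ → ⊥
      contra (inj₁ (e , e′)) = 1+n≰n (≤-trans (≤-trans (s≤s (steps-!? k l (trans at₁ (cong just (sym (trans y≡ e)))) (trans at₂ (cong just (sym (trans z≡ e′))))))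
        (≤-reflexive (sym (steps-first y z (ys ++ [ y ]))))) (≤-trans (m≤m+n _ (steps z y (y ∷ l))) (uses≤1 (y ∷ z ∷ ys) E y z)))
      contra (inj₂ (e , e′)) = 1+n≰n (≤-trans (+-mono-≤ {1} {steps y z (y ∷ l)} {1} (≤-trans (s≤s z≤n) (≤-reflexive (sym (steps-first y z (ys ++ [ y ])))))
        (≤-trans (steps-!? k l (trans at₁ (cong just (sym (trans z≡ e′)))) (trans at₂ (cong just (sym (trans y≡ e))))) (m≤n+m _ (δ z y * δ y z))))
        (uses≤1 (y ∷ z ∷ ys) E y z))

    lin-head : ∀ d y ys → ys !? d ≡ just y → 1 ≤ gaps d (y ∷ ys)
    lin-head d y ys e rewrite e | δ-refl y = s≤s z≤n

    circuit : Circuit G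
    circuit = record
      { len-1 = length xs
      ; seq   = lookup (x ∷ xs)
      ; walk  = walks
      ; trail = λ i j i<j j<N → trail′ i j i<j j<N
      }
      where
      trail′ : ∀ i j → i < j → j < N → ¬ ((pos i ≡ pos j × pos (suc i) ≡ pos (suc j)) ⊎ (pos i ≡ pos (suc j) × pos (suc i) ≡ pos j))
      trail′ i j i<j j<N h with m≤n⇒∃[o]m+o≡n i<j
      ... | k , refl = once i k (≤-trans (s≤s (s≤s (m≤n+m k i))) j<N)
        (subst₂ (λ a b → (pos i ≡ pos a × pos (i + 1) ≡ pos b) ⊎ (pos i ≡ pos b × pos (i + 1) ≡ pos a))
          (sym (+-suc i k)) (sym (trans (+-suc i (suc k)) (cong suc (+-suc i k))))
          (subst (λ a → (pos i ≡ pos (suc i + k) × pos a ≡ pos (suc (suc i + k))) ⊎ (pos i ≡ pos (suc (suc i + k)) × pos a ≡ pos (suc i + k))) (+-comm 1 i) h))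

    eulerian : Eulerian circuit
    eulerian u v a with steps u v (close (x ∷ xs)) in e | trans (E₀ u v) (cong b2n a)
    ... | suc _ | _ = found (steps⇒!?-∷ u v x (xs ++ [ x ]) (subst (1 ≤_) (sym e) (s≤s z≤n)))
      where
      found : _ → ∃[ i ] ((pos i ≡ u × pos (suc i) ≡ v) ⊎ (pos i ≡ v × pos (suc i) ≡ u))
      found (k , p , q) = k , inj₁ (read k (≤-trans (n≤1+n k) (bound k q)) p , read (suc k) (bound k q) q)
        where
        bound : ∀ k {b} → close (x ∷ xs) !? suc k ≡ just b → suc k ≤ N
        bound k q = subst (suc k ≤_) (trans (length-++ xs) (+-comm (length xs) 1)) (s≤s⁻¹ (!?-< (close (x ∷ xs)) (suc k) q))
        read : ∀ k → k ≤ N → ∀ {b} → close (x ∷ xs) !? k ≡ just b → pos k ≡ b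
        read k h q = just-injective (trans (sym (loops (windows 0) k h)) q)
    ... | zero  | e′ = found (steps⇒!?-∷ v u x (xs ++ [ x ]) (subst (1 ≤_) (sym e′) (s≤s z≤n)))
      where
      found : _ → ∃[ i ] ((pos i ≡ u × pos (suc i) ≡ v) ⊎ (pos i ≡ v × pos (suc i) ≡ u))
      found (k , p , q) = k , inj₂ (read k (≤-trans (n≤1+n k) (bound k q)) p , read (suc k) (bound k q) q)
        where
        bound : ∀ k {b} → close (x ∷ xs) !? suc k ≡ just b → suc k ≤ N
        bound k q = subst (suc k ≤_) (trans (length-++ xs) (+-comm (length xs) 1)) (s≤s⁻¹ (!?-< (close (x ∷ xs)) (suc k) q))
        read : ∀ k → k ≤ N → ∀ {b} → close (x ∷ xs) !? k ≡ just b → pos k ≡ b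
        read k h q = just-injective (trans (sym (loops (windows 0) k h)) q)

    -- A return after one step would be a loop, after two steps a repeated edge. Returns after three
    -- and four steps are what `gaps 2` and `gaps 3` count, in the window at `i`.
    avoiding : LocallySelfAvoiding 4 circuit
    avoiding i 1 _ (_ , _ , e , _) = true≢false (trans (sym (subst (Adj G (pos i)) (sym (trans e (cong pos (+-comm i 1)))) (walks i))) (irref G (pos i)))
      where true≢false : true ≢ false
            true≢false ()
    avoiding i 2 _ (_ , _ , e , _) = once i 0 1<N (inj₂ (e , refl))
    avoiding i 3 _ (_ , _ , e , _) with windows i
    ... | W@(window y ys E g₂ _ _ _) = 1+n≰n (≤-trans (lin-head 2 y ys (trans (reads W 3 (<-trans (n<1+n 3) (long x (x ∷ xs) E₀))) (cong just (sym (trans (first W) e))))) (≤-reflexive g₂))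
    avoiding i 4 _ (_ , _ , e , _) with windows i
    ... | W@(window y ys E _ g₃ _ _) = 1+n≰n (≤-trans (lin-head 3 y ys (trans (reads W 4 (long x (x ∷ xs) E₀)) (cong just (sym (trans (first W) e))))) (≤-reflexive g₃))
    avoiding i (suc (suc (suc (suc (suc k))))) (s≤s (s≤s (s≤s (s≤s ()))))

-- Counting the darts of the faces.

∑-mono : ∀ {n} {f g : Fin n → ℕ} → (∀ v → f v ≤ g v) → ∑ f ≤ ∑ g
∑-mono h = sum-≤ h (allFin _)

module Picking {n : ℕ} (f : Fin n → ℕ) where
  open Words {n}
  open Sums {n}

  -- The term `f u * δ a u` is `f` cut down to the point `u`. At distinct points such terms do not
  -- overlap, so their sum stays below `f`.
  pick : ∀ u a {k} → (δ a u ≡ 0 → k ≤ f a) → (a ≡ u → k ≡ 0) → f u * δ a u + k ≤ f a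
  pick u a {k} h₀ h₁ with a ≟ u
  ... | yes refl rewrite h₁ refl = ≤-reflexive (trans (+-identityʳ _) (*-identityʳ (f a)))
  ... | no _     rewrite *-zeroʳ (f u) = h₀ refl

  off : ∀ {u a b} → a ≢ u → b ≡ a → f u * δ b u ≡ 0
  off {u} a≢u refl = trans (cong (f u *_) (δ-≢ a≢u)) (*-zeroʳ (f u))

  pick₁ : ∀ u a → f u * δ a u ≤ f a
  pick₁ u a with a ≟ u
  ... | yes refl = ≤-reflexive (*-identityʳ (f a))
  ... | no _     = ≤-trans (≤-reflexive (*-zeroʳ (f u))) z≤n

  three : ∀ {u v w} → u ≢ v → u ≢ w → v ≢ w → f u + (f v + f w) ≤ ∑ f
  three {u} {v} {w} uv uw vw = begin
    f u + (f v + f w)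
      ≡⟨ sym (cong₂ _+_ (∑δ* (f u) u) (cong₂ _+_ (∑δ* (f v) v) (∑δ* (f w) w))) ⟩
    ∑ (λ a → f u * δ a u) + (∑ (λ a → f v * δ a v) + ∑ (λ a → f w * δ a w))
      ≡⟨ sym (trans (sum-+ (λ a → f u * δ a u) _ (allFin n)) (cong (∑ (λ a → f u * δ a u) +_) (sum-+ (λ a → f v * δ a v) _ (allFin n)))) ⟩
    ∑ (λ a → f u * δ a u + (f v * δ a v + f w * δ a w))
      ≤⟨ ∑-mono {g = f} (λ a → pick u a (λ _ → pick v a (λ _ → pick₁ w a) (off vw)) (λ e → cong₂ _+_ (off uv e) (off uw e))) ⟩
    ∑ f ∎
    where open ≤-Reasoning

  four : ∀ {u v w z} → u ≢ v → u ≢ w → u ≢ z → v ≢ w → v ≢ z → w ≢ z → f u + (f v + (f w + f z)) ≤ ∑ f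
  four {u} {v} {w} {z} uv uw uz vw vz wz = begin
    f u + (f v + (f w + f z))
      ≡⟨ sym (cong₂ _+_ (∑δ* (f u) u) (cong₂ _+_ (∑δ* (f v) v) (cong₂ _+_ (∑δ* (f w) w) (∑δ* (f z) z)))) ⟩
    ∑ (λ a → f u * δ a u) + (∑ (λ a → f v * δ a v) + (∑ (λ a → f w * δ a w) + ∑ (λ a → f z * δ a z)))
      ≡⟨ sym (trans (sum-+ (λ a → f u * δ a u) _ (allFin n)) (cong (∑ (λ a → f u * δ a u) +_)
           (trans (sum-+ (λ a → f v * δ a v) _ (allFin n)) (cong (∑ (λ a → f v * δ a v) +_) (sum-+ (λ a → f w * δ a w) _ (allFin n)))))) ⟩
    ∑ (λ a → f u * δ a u + (f v * δ a v + (f w * δ a w + f z * δ a z)))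
      ≤⟨ ∑-mono {g = f} (λ a → pick u a (λ _ → pick v a (λ _ → pick w a (λ _ → pick₁ z a) (off wz))
                 (λ e → cong₂ _+_ (off vw e) (off vz e))) (λ e → cong₂ _+_ (off uv e) (cong₂ _+_ (off uw e) (off uz e)))) ⟩
    ∑ f ∎
    where open ≤-Reasoning

module Faces {n : ℕ} (G : Graph n) (quartic : Quartic G) (ρ : RotationSystem G) {F : ℕ} (faces : HasFaces ρ F)
             (formula : n + F ≡ edgeCount G + 2) where
  open Words {n}
  open Sums {n}
  open RotationSystem ρ using (next; next-adj; next-cycle)

  face : V → V → Fin F
  face = proj₁ faces

  flipAdj : ∀ {u v} → Adj G u v → Adj G v u
  flipAdj {u} {v} a = trans (Graph.sym G v u) a

  adj⇒≢ : ∀ {u v} → Adj G u v → u ≢ v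
  adj⇒≢ {u} a refl with () ← trans (sym a) (irref G u)

  -- Every dart or its reverse has its smaller end first, and `edgeCount` counts the darts of that
  -- kind.
  edges≥ : n * 4 ≤ edgeCount G + edgeCount G
  edges≥ = begin
    n * 4                                        ≡⟨ sym (trans (sum-cong quartic (allFin n)) (∑-const n 4)) ⟩
    ∑ (λ u → ∑ (λ v → b2n (adj G u v)))          ≤⟨ ∑-mono (λ u → ∑-mono (λ v → either u v)) ⟩
    ∑ (λ u → ∑ (λ v → lower u v + lower v u))    ≡⟨ sum-cong (λ u → sum-+ (lower u) (λ v → lower v u) (allFin n)) (allFin n) ⟩
    ∑ (λ u → ∑ (lower u) + ∑ (λ v → lower v u))  ≡⟨ sum-+ (λ u → ∑ (lower u)) (λ u → ∑ (λ v → lower v u)) (allFin n) ⟩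
    edgeCount G + ∑ (λ u → ∑ (λ v → lower v u))  ≡⟨ cong (edgeCount G +_) (sum-swap (λ u v → lower v u) (allFin n) (allFin n)) ⟩
    edgeCount G + edgeCount G ∎
    where
    open ≤-Reasoning
    lower : V → V → ℕ
    lower u v = b2n (adj G u v ∧ (toℕ u <ᵇ toℕ v))
    lt⇒ : ∀ {a b} → a < b → (a <ᵇ b) ≡ true
    lt⇒ {a} {b} h with a <ᵇ b | <⇒<ᵇ h
    ... | true | _ = refl
    either : ∀ u v → b2n (adj G u v) ≤ lower u v + lower v u
    either u v with adj G u v in e
    ... | false = z≤n
    ... | true with <-cmp (toℕ u) (toℕ v)
    ...   | tri< lt _ _ rewrite lt⇒ lt = s≤s z≤n
    ...   | tri≈ _ eq _ = ⊥-elim (adj⇒≢ e (toℕ-injective eq))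
    ...   | tri> _ _ gt rewrite trans (Graph.sym G v u) e | lt⇒ gt = m≤n+m 1 _

  -- Euler's formula together with at least `2n` edges, doubled to avoid a division.
  faces≥ : n + 2 ≤ F
  faces≥ = *-cancelˡ-≤ 2 (+-cancelˡ-≤ (n + n) _ _ (begin
    n + n + 2 * (n + 2)                        ≡⟨ lem₁ n ⟩
    n * 4 + 4                                  ≤⟨ +-monoˡ-≤ 4 edges≥ ⟩
    edgeCount G + edgeCount G + 4              ≡⟨ lem₂ (edgeCount G) ⟩
    (edgeCount G + 2) + (edgeCount G + 2)      ≡⟨ cong (λ k → k + k) (sym formula) ⟩
    (n + F) + (n + F)                          ≡⟨ lem₃ n F ⟩
    n + n + 2 * F ∎))
    where
    open ≤-Reasoning
    lem₁ : ∀ n → n + n + 2 * (n + 2) ≡ n * 4 + 4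
    lem₁ = solve-∀
    lem₂ : ∀ e → e + e + 4 ≡ (e + 2) + (e + 2)
    lem₂ = solve-∀
    lem₃ : ∀ n f → (n + f) + (n + f) ≡ n + n + 2 * f
    lem₃ = solve-∀

  -- `next v` runs through all neighbours of `v`, so a fixed one would be the only one.
  next-≢ : ∀ {v u} → Adj G v u → next v u ≢ u
  next-≢ {v} {u} a fixed = 1+n≰n (≤-trans (s≤s (s≤s z≤n)) (begin
    4                          ≡⟨ sym (quartic v) ⟩
    ∑ (λ w → b2n (adj G v w))  ≤⟨ ∑-mono (λ w → only w) ⟩
    ∑ (λ w → δ w u)            ≡⟨ ∑δ u ⟩
    1 ∎))
    where
    open ≤-Reasoning
    stuck : ∀ k → iterate (next v) k (next v u) ≡ u
    stuck zero    = fixed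
    stuck (suc k) = trans (cong (next v) (stuck k)) fixed
    only : ∀ w → b2n (adj G v w) ≤ δ w u
    only w with adj G v w in e
    ... | false = z≤n
    ... | true with next-cycle v u w a e
    ...   | k , e′ = ≤-reflexive (sym (δ-≡1 (trans (sym e′) (stuck k))))

  -- Weighted double counting: darts weigh at least 1, so a face with four darts weighs at least
  -- `B`, and triangles do so by hypothesis.
  module _ (ω : V → V → ℕ) (B : ℕ) (B≤4 : B ≤ 4) (positive : ∀ {u v} → Adj G u v → 1 ≤ ω u v)
           (triangles : ∀ {u v w} → Adj G u v → Adj G v w → Adj G w u → B ≤ ω u v + (ω v w + ω w u)) where

    weight : V → V → ℕ
    weight u v = b2n (adj G u v) * ω u v

    share : Fin F → V → ℕ
    share x u = ∑ (λ v → weight u v * Words.δ x (face u v))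

    share≥ : ∀ {x u v} → Adj G u v → face u v ≡ x → ω u v ≤ share x u
    share≥ {x} {u} {v} a refl = ≤-trans (≤-reflexive (sym
      (trans (cong₂ _*_ (cong (λ b → b2n b * ω u v) a) (Words.δ-refl x)) (trans (*-identityʳ _) (+-identityʳ _)))))
      (≤∑ (λ v → weight u v * Words.δ x (face u v)) v)

    same-face : ∀ {u v} → Adj G u v → face v (next v u) ≡ face u v
    same-face {u} {v} a = sym (proj₂ (proj₁ (proj₂ faces) u v v (next v u) a (next-adj v u (flipAdj a))) (1 , refl))

    -- Let `u`, `v`, `w`, `z` be the tails of four successive darts of the face. Tails one or two
    -- steps apart differ; hence either all four are distinct, or `z = u` and the first three darts
    -- form a triangle. Distinct tails put the darts into different summands of the load.
    load : ∀ x → B ≤ ∑ (share x)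
    load x with proj₂ (proj₂ faces) x
    ... | u , v , a , e = loads
      where
      w z t : V
      w = next v u
      z = next w v
      t = next z w
      b : Adj G v w
      b = next-adj v u (flipAdj a)
      c : Adj G w z
      c = next-adj w v (flipAdj b)
      d : Adj G z t
      d = next-adj z w (flipAdj c)
      u≢w : u ≢ w
      u≢w p = next-≢ (flipAdj a) (sym p)
      v≢z : v ≢ z
      v≢z p = next-≢ (flipAdj b) (sym p)
      e₁ : face v w ≡ x
      e₁ = trans (same-face a) e
      e₂ : face w z ≡ x
      e₂ = trans (same-face b) e₁
      e₃ : face z t ≡ x
      e₃ = trans (same-face c) e₂
      loads : B ≤ ∑ (share x)
      loads with z ≟ u
      ... | yes z≡u = ≤-trans (triangles a b (subst (Adj G w) z≡u c)) (≤-trans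
              (+-mono-≤ (share≥ a e) (+-mono-≤ (share≥ b e₁) (share≥ (subst (Adj G w) z≡u c) (subst (λ y → face w y ≡ x) z≡u e₂))))
              (Picking.three (share x) (adj⇒≢ a) u≢w (adj⇒≢ b)))
      ... | no z≢u = ≤-trans B≤4 (≤-trans
              (+-mono-≤ (≤-trans (positive a) (share≥ a e)) (+-mono-≤ (≤-trans (positive b) (share≥ b e₁))
                (+-mono-≤ (≤-trans (positive c) (share≥ c e₂)) (≤-trans (positive d) (share≥ d e₃)))))
              (Picking.four (share x) (adj⇒≢ a) u≢w (λ p → z≢u (sym p)) (adj⇒≢ b) v≢z (adj⇒≢ c)))

    -- Every dart lies on exactly one face, so the loads of all faces add up to the weight of all
    -- darts.
    total-load : (n + 2) * B ≤ ∑ (λ u → ∑ (weight u))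
    total-load = begin
      (n + 2) * B                              ≤⟨ *-monoˡ-≤ B faces≥ ⟩
      F * B                                    ≡⟨ sym (∑-const F B) ⟩
      ∑ {F} (λ _ → B)                          ≤⟨ ∑-mono load ⟩
      ∑ (λ x → ∑ (λ u → share x u))            ≡⟨ sum-swap (λ x u → share x u) (allFin F) (allFin n) ⟩
      ∑ (λ u → ∑ (λ x → ∑ (λ v → weight u v * Words.δ x (face u v))))
        ≡⟨ sum-cong (λ u → trans (sum-swap (λ x v → weight u v * Words.δ x (face u v)) (allFin F) (allFin n))
             (sum-cong (λ v → Sums.∑δ* (weight u v) (face u v)) (allFin n))) (allFin n) ⟩
      ∑ (λ u → ∑ (weight u)) ∎
      where open ≤-Reasoning

-- The exceptional graphs.

-- K₅, the octahedron, K̄₃ + 2K₂ and K₄,₄.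
exceptions : ℕ → Exceptional
exceptions 0 = record { size = 5 ; adjacent = λ i j → not (i ≡ᵇ j) }
exceptions 1 = record { size = 6 ; adjacent = λ i j → not (i / 2 ≡ᵇ j / 2) }
exceptions 2 = record { size = 7 ; adjacent = λ i j →
  if (i <ᵇ 4) ∧ (j <ᵇ 4) then (i / 2 ≡ᵇ j / 2) ∧ not (i ≡ᵇ j) else not (i <ᵇ 4) ∧ (j <ᵇ 4) ∨ (i <ᵇ 4) ∧ not (j <ᵇ 4) }
exceptions _ = record { size = 8 ; adjacent = λ i j → not (i <ᵇ 4) ∧ (j <ᵇ 4) ∨ (i <ᵇ 4) ∧ not (j <ᵇ 4) }

module Exclude {n : ℕ} (G : Graph n) (quartic : Quartic G) where
  open Words {n}
  open Sums {n}
  open Check G exceptions using (Embeds; Exc)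
  open Embeds

  order : ∀ {h} → Embeds h → n ≡ size h
  order {h} m = ≤-antisym
    (injective⇒≤ {f = λ v → fromℕ< (proj₁ (proj₂ (surj m v)))} λ {u} {v} e →
      trans (sym (proj₂ (proj₂ (surj m u)))) (trans (cong (f m) (trans (sym (toℕ-fromℕ< (proj₁ (proj₂ (surj m u)))))
        (trans (cong toℕ e) (toℕ-fromℕ< (proj₁ (proj₂ (surj m v))))))) (proj₂ (proj₂ (surj m v)))))
    (injective⇒≤ {f = λ i → f m (toℕ i)} λ {i} {j} e → toℕ-injective (inj m (toℕ i) (toℕ j) (toℕ<n i) (toℕ<n j) e))

  degree-sum : ∑ (λ u → ∑ (λ v → b2n (adj G u v) * 1)) ≡ n * 4
  degree-sum = trans (sum-cong (λ u → trans (sum-cong (λ v → *-identityʳ (b2n (adj G u v))) (allFin n)) (quartic u)) (allFin n)) (∑-const n 4)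

  uniform : Planar G → ∀ B → B ≤ 4 → (∀ {u v w} → Adj G u v → Adj G v w → Adj G w u → B ≤ 3) → (n + 2) * B ≤ n * 4
  uniform (ρ , F , hf , eq) B B≤4 tri = ≤-trans
    (Faces.total-load G quartic ρ hf eq (λ _ _ → 1) B B≤4 (λ _ → ≤-refl) tri) (≤-reflexive degree-sum)

  -- At least 7 faces with 3 darts each would need 21 darts; there are 20.
  no-K₅ : Planar G → ¬ Embeds (exceptions 0)
  no-K₅ p m = 1+n≰n (subst (λ k → (k + 2) * 3 ≤ k * 4) (order m) (uniform p 3 (s≤s (s≤s (s≤s z≤n))) (λ _ _ _ → ≤-refl)))

  labelled : ∀ {h} (m : Embeds h) {u v} → Adj G u v →
             adjacent h (proj₁ (surj m u)) (proj₁ (surj m v)) ≡ true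
  labelled m {u} {v} a = trans (sym (adjf m _ _ (proj₁ (proj₂ (surj m u))) (proj₁ (proj₂ (surj m v)))))
    (trans (cong₂ (adj G) (proj₂ (proj₂ (surj m u))) (proj₂ (proj₂ (surj m v)))) a)

  -- A bipartite graph has no triangle, so at least 10 faces with 4 darts each would need 40 darts;
  -- there are 32.
  no-K₄₄ : ∀ e → Planar G → ¬ Embeds (exceptions (suc (suc (suc e))))
  no-K₄₄ e p m = 1+n≰n (≤-trans (m≤n+m 33 7) (subst (λ k → (k + 2) * 4 ≤ k * 4) (order m) (uniform p 4 ≤-refl λ a b c →
    ⊥-elim (odd (proj₁ (surj m _) <ᵇ 4) (proj₁ (surj m _) <ᵇ 4) (proj₁ (surj m _) <ᵇ 4) (labelled m a) (labelled m b) (labelled m c)))))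
    where
    odd : ∀ x y z → (not x ∧ y ∨ x ∧ not y) ≡ true → (not y ∧ z ∨ y ∧ not z) ≡ true → (not z ∧ x ∨ z ∧ not x) ≡ true → ⊥
    odd true  true  _     () _ _
    odd false false _     () _ _
    odd true  false true  _ _ ()
    odd true  false false _ () _
    odd false true  true  _ () _
    odd false true  false _ _ ()

  -- Every triangle of K̄₃ + 2K₂ contains an edge of 2K₂, whose four darts are counted twice.
  no-K̄₃+2K₂ : Planar G → ¬ Embeds (exceptions 2)
  -- At least 9 faces of weight 4 give 36, against 28 darts and 4 for those counted twice.
  no-K̄₃+2K₂ (ρ , F , hf , eq) m = 1+n≰n (≤-trans (m≤n+m 33 3)
      (subst (λ k → (k + 2) * 4 ≤ k * 4 + 4) (order m)
        (≤-trans (Faces.total-load G quartic ρ hf eq ω 4 ≤-refl (λ _ → s≤s z≤n) triangle) bounded)))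
    where
    p : ℕ → V
    p = f m
    extra ω : V → V → ℕ
    extra u v = δ u (p 0) * δ v (p 1) + (δ u (p 1) * δ v (p 0) + (δ u (p 2) * δ v (p 3) + δ u (p 3) * δ v (p 2)))
    ω u v = suc (extra u v)
    product : ∀ a b → ∑ (λ u → ∑ (λ v → δ u a * δ v b)) ≡ 1
    product a b = trans (sum-cong (λ u → ∑δ* (δ u a) b) (allFin n)) (∑δ a)
    ∑∑-+ : ∀ (g h : V → V → ℕ) → ∑ (λ u → ∑ (λ v → g u v + h u v)) ≡ ∑ (λ u → ∑ (g u)) + ∑ (λ u → ∑ (h u))
    ∑∑-+ g h = trans (sum-cong (λ u → sum-+ (g u) (h u) (allFin n)) (allFin n)) (sum-+ (λ u → ∑ (g u)) (λ u → ∑ (h u)) (allFin n))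
    four-darts : ∑ (λ u → ∑ (extra u)) ≡ 4
    four-darts = trans (∑∑-+ (λ u v → δ u (p 0) * δ v (p 1)) _) (cong₂ _+_ (product (p 0) (p 1))
                (trans (∑∑-+ (λ u v → δ u (p 1) * δ v (p 0)) _) (cong₂ _+_ (product (p 1) (p 0))
                (trans (∑∑-+ (λ u v → δ u (p 2) * δ v (p 3)) _) (cong₂ _+_ (product (p 2) (p 3)) (product (p 3) (p 2)))))))
    bounded : ∑ (λ u → ∑ (λ v → b2n (adj G u v) * ω u v)) ≤ n * 4 + 4
    bounded = begin
      ∑ (λ u → ∑ (λ v → b2n (adj G u v) * ω u v))       ≤⟨ ∑-mono (λ u → ∑-mono (λ v → pointwise (adj G u v) (extra u v))) ⟩
      ∑ (λ u → ∑ (λ v → b2n (adj G u v) * 1 + extra u v)) ≡⟨ ∑∑-+ (λ u v → b2n (adj G u v) * 1) extra ⟩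
      ∑ (λ u → ∑ (λ v → b2n (adj G u v) * 1)) + ∑ (λ u → ∑ (extra u)) ≡⟨ cong₂ _+_ degree-sum four-darts ⟩
      n * 4 + 4 ∎
      where
      open ≤-Reasoning
      pointwise : ∀ b k → b2n b * suc k ≤ b2n b * 1 + k
      pointwise true  k = ≤-reflexive (+-identityʳ (suc k))
      pointwise false k = z≤n
    special : ∀ i j → (i <ᵇ 4) ≡ true → (j <ᵇ 4) ≡ true → adjacent (exceptions 2) i j ≡ true → 1 ≤ extra (p i) (p j)
    special 0 1 _ _ _ rewrite δ-refl (p 0) | δ-refl (p 1) = s≤s z≤n
    special 1 0 _ _ _ rewrite δ-refl (p 0) | δ-refl (p 1) =
      ≤-trans (m≤m+n 1 _) (m≤n+m _ (δ (p 1) (p 0) * δ (p 0) (p 1)))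
    special 2 3 _ _ _ rewrite δ-refl (p 2) | δ-refl (p 3) =
      ≤-trans (≤-trans (m≤m+n 1 _) (m≤n+m _ (δ (p 2) (p 1) * δ (p 3) (p 0)))) (m≤n+m _ (δ (p 2) (p 0) * δ (p 3) (p 1)))
    special 3 2 _ _ _ rewrite δ-refl (p 2) | δ-refl (p 3) =
      ≤-trans (≤-trans (m≤n+m 1 (δ (p 3) (p 2) * δ (p 2) (p 3))) (m≤n+m _ (δ (p 3) (p 1) * δ (p 2) (p 0)))) (m≤n+m _ (δ (p 3) (p 0) * δ (p 2) (p 1)))
    special 0 0 _ _ ()
    special 0 2 _ _ ()
    special 0 3 _ _ ()
    special 1 1 _ _ ()
    special 1 2 _ _ ()
    special 1 3 _ _ ()
    special 2 0 _ _ ()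
    special 2 1 _ _ ()
    special 2 2 _ _ ()
    special 3 0 _ _ ()
    special 3 1 _ _ ()
    special 3 3 _ _ ()
    special (suc (suc (suc (suc i)))) _ () _ _
    special _ (suc (suc (suc (suc j)))) _ () _
    label : V → ℕ
    label u = proj₁ (surj m u)
    extra≥ : ∀ {u v} → (label u <ᵇ 4) ≡ true → (label v <ᵇ 4) ≡ true → Adj G u v → 1 ≤ extra u v
    extra≥ {u} {v} hu hv a = subst₂ (λ x y → 1 ≤ extra x y) (proj₂ (proj₂ (surj m u))) (proj₂ (proj₂ (surj m v)))
      (special (label u) (label v) hu hv (labelled m a))
    crossing : ∀ {u v} → (label u <ᵇ 4) ≡ false → (label v <ᵇ 4) ≡ false → ¬ Adj G u v
    crossing {u} {v} hu hv a with label u <ᵇ 4 | label v <ᵇ 4 | labelled m a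
    crossing refl refl a | false | false | ()
    triangle : ∀ {u v w} → Adj G u v → Adj G v w → Adj G w u → 4 ≤ ω u v + (ω v w + ω w u)
    triangle {u} {v} {w} a b c = ≤-trans (s≤s (s≤s (s≤s inner))) (≤-reflexive (lem (extra u v) (extra v w) (extra w u)))
      where
      lem : ∀ x y z → suc (suc (suc (x + (y + z)))) ≡ suc x + (suc y + suc z)
      lem = solve-∀
      inner : 1 ≤ extra u v + (extra v w + extra w u)
      inner with label u <ᵇ 4 in eu | label v <ᵇ 4 in ev | label w <ᵇ 4 in ew
      -- Of three vertices two lie on the same side of the join. On the side of 2K₂ they span a
      -- heavy edge; on the other side they cannot be adjacent.
      ... | true  | true  | _     = ≤-trans (extra≥ eu ev a) (m≤m+n _ _)
      ... | _     | true  | true  = ≤-trans (≤-trans (extra≥ ev ew b) (m≤m+n _ _)) (m≤n+m _ (extra u v))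
      ... | true  | _     | true  = ≤-trans (≤-trans (extra≥ ew eu c) (m≤n+m _ (extra v w))) (m≤n+m _ (extra u v))
      ... | false | false | _     = ⊥-elim (crossing eu ev a)
      ... | _     | false | false = ⊥-elim (crossing ev ew b)
      ... | false | _     | false = ⊥-elim (crossing ew eu c)

  is-octahedron : Embeds (exceptions 1) → Isomorphic G octahedron
  is-octahedron m = index , ((λ {u} {v} → injective {u} {v}) , surjective) , λ u v → trans
      (cong₂ (adj G) (sym (proj₂ (proj₂ (surj m u)))) (sym (proj₂ (proj₂ (surj m v)))))
      (trans (adjf m _ _ (proj₁ (proj₂ (surj m u))) (proj₁ (proj₂ (surj m v))))
        (cong₂ (λ i j → not (i / 2 ≡ᵇ j / 2)) (sym (to-index u)) (sym (to-index v))))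
    where
    label : V → ℕ
    label u = proj₁ (surj m u)
    index : V → Fin 6
    index u = fromℕ< (proj₁ (proj₂ (surj m u)))
    to-index : ∀ u → toℕ (index u) ≡ label u
    to-index u = toℕ-fromℕ< (proj₁ (proj₂ (surj m u)))
    injective : ∀ {u v} → index u ≡ index v → u ≡ v
    injective {u} {v} e = trans (sym (proj₂ (proj₂ (surj m u))))
      (trans (cong (f m) (trans (sym (to-index u)) (trans (cong toℕ e) (to-index v)))) (proj₂ (proj₂ (surj m v))))
    surjective : ∀ y → ∃[ x ] (∀ {z} → z ≡ x → index z ≡ y)
    surjective y = f m (toℕ y) , λ { refl → toℕ-injective (trans (to-index _)
      (inj m _ _ (proj₁ (proj₂ (surj m _))) (toℕ<n y) (proj₂ (proj₂ (surj m (f m (toℕ y))))))) }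

  excluded : Planar G → ¬ Isomorphic G octahedron → ¬ Exc
  excluded p ¬oct (0 , m)               = no-K₅ p m
  excluded p ¬oct (1 , m)               = ¬oct (is-octahedron m)
  excluded p ¬oct (2 , m)               = no-K̄₃+2K₂ p m
  excluded p ¬oct (suc (suc (suc e)) , m) = no-K₄₄ e p m

-- Without vertices Euler's formula would still demand two faces, but each face carries a dart.
nonempty : ∀ {n} (G : Graph n) → Planar G → Fin n
nonempty {zero}  G (ρ , .2 , (_ , _ , onto) , refl) with onto zero
... | () , _
nonempty {suc n} G _ = zero

-- The trees of cases.

-- The tree below `root₃` in preorder, in the codes of `check`. It opens with `HC`, which locates
-- the second occurrence of the letter 2, and `FA`, which uncovers the left end of the first hidden
-- segment.
certificate₃ : List String
certificate₃ =
    "HCFAABGAHDGAACGAFAABFADCDCGAIEGIFHDCDCBDHHKABCDEHIEGIEHIFIBDHEFBJLKFBCEDBEFAIFICBDHGGAIFJIFICBDC"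
  ∷ "EDBDIGICCEIFKCBDJMMCBCFBABFBFAIEFDBCBBCBCGAFAIEHIFIBDBDHIHFCBEGAIEHIEIBDIFJBDBDCCEIEHIEIBDIFKBDF"
  ∷ "ACBECCECCEFBIEHBDHIGAJLKGACIDCDIGAHGGACIDCDIBDJJKGBIEHBDCCEIEHBDCCEFBABFBFAHDGAIDHBBBBIDHBBBBGBF"
  ∷ "AIFHIEGBCBCBCIDIBBBBGAFAIDHIFIIEGIFHBCBCBCIEGCBCBCIEGIFIDCDCHEIFIBCKABCDEFGAIDHIFIIDJIEGIFJBCBCB"
  ∷ "CIEGBCBCHDHECBFHGIEGIFJIGIIEJIFIDCDCHJHFIEJDBDBHFCBCIFIIFJDBCBCBCHJIDHIFIIDJIEGIFKBCGAIEHCBCBCID"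
  ∷ "KIEHCBCBCHEBCFADBCEFAIGJIJICDEBDCCECCEFBDBCEFBIGKIKICDEJLMIHICECJLOCCEBCFAIEHIFKIGIIEGIEKIFHIGKD"
  ∷ "CDCBDBCIFHIHIDCDCCBEBCBCIEKBDHFKBBFCEDGHEIHICBFKBBFCHDEIFKBCHIKBBFCEDIIEGIEHCBCCBCCBCHDFAIEHIEGI"
  ∷ "GKDCDCBDCBFHKKBBKCEDFFAIELBDIGKDCDCCBDIELIEMBDIHKCBDFABDFAIGLCHDBDCECGAIGKDCDCCGDDBFDFBBDFBIELBD"
  ∷ "IGKDCDCJLMIELBDDCEBHEJLKBCFAHGFACECCCEFBJLKFBCECCCEIEGIFICBCIEJIGKCBDFABDGACBDIELCGDJMMFAHKKBBKC"
  ∷ "EDFIGKDCECJMMCBDFBIDHIFIIEGIJIBCBCIJIIFHBCBCGABCGADCJCDCJCIEGBCGABCDCFCIFIIEGIJIBCFACBCIKGCBCGAB"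
  ∷ "CCCKHIGAJJKGACICBIGAHFGACICCBICBDGBIDHIFIIDKIEGIJIBCBCIJIIFKBCBCGABCDCECIEGBCIJIBCGABCGACBJCDJGA"
  ∷ "IDKIJGDCFCBCCDFIDKDCFCCDFIGIIEKCBDFAIJGIFICBCHJCBCIKGIFICBCDDFDFACKCILICKCJKMCBCIDHIFIIDKIEGIJIB"
  ∷ "CBCIJIIFLBCGABCGBFAIDLDCEBBBFAIDMDCEBBBIDMDCEBBBFAILIDCFBIDJCLCJOMIDJIDLDCECFABBGAINJBDBDINJBDCN"
  ∷ "DBDFABCGAGAIMKCJCDCECDCECDCECFBIEGIJIIFLBCFAIHICDFBDIEHIKGCBCIHICBDBDCDEIELCBDFAAEIKGCBCFABCGAIF"
  ∷ "HCKCBCCJDIHICBDCBDFAIEGIEHCBCCBCCBCIEGIEHCBCCBCDCEBGAGAIDJIDKIELDCFBIJGCBCBCIELCBDIJHDCDCCBCBBID"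
  ∷ "JIDKIELDCFBIDMIJGCBCBCGAIJKDCDCEJFDEIJLDCDCJMMFAIEMCBDIJGCBCBCIENCBDIJGCBCBCBBGBIDLIDKDCFCIELCBD"
  ∷ "FAIMHDCDCCMCDBECCDFIDLIDNDCFCFADCFBDCFBCDFIGIIEKCBDFAIJGCBCCBCIMGCBCCBDCBC"
  ∷ []

-- The tree below `root₄`. Here a visible recurrence after three steps closes a branch as
-- contradictory, the flag being set.
certificate₄ : List String
certificate₄ =
    "HCGAABGBABFBABHDGAABFBHEGCBCFAABIFGIFJBCIIGBDGBDCDBFBILHDCDBFAABFABBBEDDEBBDGBGACCDFAIIGCCDHFIKF"
  ∷ "IIGCCDCIEFAIIGCCDBIILGECEKDJKMFAGAIFGIIJCCDHGHIKBBDCIEFIFGCBEECDBEGBIFGIKFIIJCCDFAHFCIEHGGAEBCKG"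
  ∷ "FBGAEBCKGDBEGFBGAEBCKGIIJDBEGEBCKGGAEBCKGFBINJIIJDBEGEBCKGEBCKGINJIPJDBEGEBCKGEBCKGHJGAFAAGJJOFB"
  ∷ "AGDBEJDCFCIFGCBEDCFCFAFBFAIFGIIHCCDBCHIKBBDCEIFIFGBCDCBEGAFAIFJIFGIIHCCDBCHIBDEBICDBEGAIHGCBECCE"
  ∷ "IIJIIKBEFACDICDICDIFBIIJBEIFGBCJMMIIJBEFBCDICDIIIGIJFBDFBFAABIKHCDEGBFABDDDJDGBFABDDDJDCBEBCFBGB"
  ∷ "GAIJHCCDHFIKHIJFCCDGACCDDDJDGAHJKCCJEIBDKDCEKGBGAIFKIJHCCDHKCBEIJFILHIFKCCDCBEGAHJHFDDIBFAILHCCD"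
  ∷ "DCELDDJDIHKCBEIJFCCDFBABFBCBECCHGCBCIFLBCFCFAEBDEFGAEBDEFDCBECBEFBGAHEIJGBCFABBECDEDFACDBGAIJKIJ"
  ∷ "GCDEHIEBIDECBCIIKCBCFAIJLCDECBECDIFBFAIIHIFGIJGCCDHICCBIJGBIEBEBIGAIFGIJGBCIIKIIHCCEBIDCBECEFIFG"
  ∷ "IJGBCGAIILIIKCCEIFLBIBCDCBEIILIIMCCECDIDCBECEFGAFAIFGIIHIJGIFKCCDBEHIEBCIJIJKBICEJIIKCEFCDEIIHCB"
  ∷ "CBEFBIIKBEIJGCDECCEIIKBECBCFAIEFIIGBDFAIEHBBIKFCDEBDGAIKHCCDIELBCHJIKHIFMCCDGACCDIEMDCDBEBDEFIEL"
  ∷ "IFMBCFABCECDKIGAHMCMCCBECBEIJGBCGABBDEJBIEFILJIIGBDGBIEHBBFAILFCDECLDCDBIKHIFMCCDGBABIEMDCDBGAGA"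
  ∷ "CBEEBDEFDDIBFBIEMBCGAHLDCLDDCEKIENIFMBCGAFABCECDKIIEODDIBFAABFABBBEGBGAHLDCLDHJDDIBCBEGBIEHBBCDE"
  ∷ "FBIFGIEHIEMBCFAIIGBDIKHCCDDCEKIIGIMHCDEDDLDDDLDIIGCDEFACCDDDLDFABDIEHINMIEMCCBINHCDEJKOBNCDEFAII"
  ∷ "GBDGAIKHIFMCCDCCDIENIFMBCBCDDLDGAIKHIFMCCDIKOIKNCICIEHIEOCCKDBIECBEIEHIENCCKCBECBECICIKOIKPCICIF"
  ∷ "MCCDDDLDIFMCCDIEHIENCCKCBEJQQGAIEKDDLDBBIEKIEPDDLDFABBIOKBEIFGIFMBCDBCLDBCLIOIBEIFGIFMBCDBCLDBCL"
  ∷ "IJGBCGBBBDEJBHEFAABGDBBFBIIGILJBDFAABFABBDDLBIFMBCGAABGABBBEGAABGABBFBILJIIGBDDDIDFABEDDLBIIGILJ"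
  ∷ "BDFABEDDLBDDIBGCGBBCFABBBBFAGAFAIFGBCDBECIFGIFKBCIJGDBDEDBDCDBEFFBIIHCBCDBDIIIHCBCDBDIGBIFGIFKBC"
  ∷ "IIGILJCBDDBDCGADBDEGAGAABGABCDBEFDDIDILJCBDDBDCFCIFGIMGBCGBDBEMILJCBDCBEDCFCIIGILJCBDCBEIFKBCCBE"
  ∷ "GCFAGBBBGAIIFBEBCIIFBEBCGCBBFAFAIIGCBDIFMBCDBDEIIGBDIFMBCBEIFGIFMBCGBILJIIGCBDDBDEFACEDDDLBBEGBI"
  ∷ "LJCBDFACBDDDLBBEFAFBGAGABBFAIIHCBCBEIILIIFBECBCCBCIILBECDIGAFAGABBFAIIHCBCBEIIHCBCBEGBBBFBIIHCBC"
  ∷ "BEIIHCBCBEFBIIMBECDIIIMBECDIFCGBFAIIGCBDGABBIFNBCCBEIMJIIGCBDGBBBIFOBCCBEFACEMDDMBIMJIIGBDGCBBIF"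
  ∷ "OBCCBEFAABIOLBEFCBBCBCGBFAIIGCBDGBBBIFOBCCBEIIGIMJCBDFACBDDDMBGCBBIFPBCCBEFAIIGBDGCBBIFPBCCBEIIG"
  ∷ "IMJBDIPNBECDEGDBBIFQBCCBEGBIKGBCGBBCDCKBFABEIMHBEIIGBDBCGAGBCDBFBIILCBCIJGCDEJLMCBCFAIIGBDGBILFC"
  ∷ "DEJLMGBCCDCBEGCFAIJGIMFIIGCDECDEIIGBDCMDBDFAIJGIKGIMFCDEECEMDCDBBDIJGIMFIIGCDECDBIIGBDCDBBDFCIIG"
  ∷ "IMJBDFABDDDMDGAIMNCICCCDDDIBIMOCBCIIGBDCBEGAFCGAFAIIFIIHIFGIKGCCDCEKCBCIJGBIEBEBIBDGADCBEIFMIHGD"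
  ∷ "CBEBCDDBCGBIIHIJGIKGCDECCDCCDIJGBIJMMIHGIFMDCBEDDBCBCGBFBIIHCBCDBDIIIHCBCBEFCIILBECBCIILBECBCFAF"
  ∷ "CIIGBDFBILHCCDJMMBCIIGBDGCGBILHCICHMJMOCMCCMCJLOIFMBCCEFGBGBCBEIHNCBECBCIFNBCCBEFDFCIMJIIGBDGAIL"
  ∷ "HCCDHMDCMDDCMDJMODDIBFADDMDDDMDGBIIGIMJBDFABDDDMDBCIIGIMJBDFABDDDMDBCGCGCIMJIIGBDGAIFNILHCCDHNJN"
  ∷ "OCNCCNCCNCCBEDDIBFADDMDDDMDFAIIGIMJBDBDIHOCBECBCIMJIIGBDDDIBDDMBGBFAIMJIIGBDGBIFNBCCEFIFPBCCBEDD"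
  ∷ "MDIMJIIGBDGCDDIBDDIBDDMDFDIMJIIGBDIFNBCCEFFADDMDDDMDIIGIMJBDFABDDDMBGDCBEIFRBCCBEFCFBGADBCBFAIFG"
  ∷ "DBCBCBCFAIJHIEFCBCBBIFGIIGBCHEKBBDCIEJCBCIEFIJHIEIIKHCBCFACBCDCKCGABBIJFIKFBEDBCDDCDCHEGABBFBIKI"
  ∷ "BEFAABDEJCIKMBEFAABIMGCJECMCGABBIKFBEDBDEIJHBEECDCEGAGAIEHDBCBCDCGAIFJIHGCDCBDIEHIEIBCHGKBBDCEFG"
  ∷ "CBCIEHIEIIFJDBCBHEFBEBCFEBEDEBCFAIFJIHGIFKCDCCCFBHHGEBCBGFAIHGIFJIFKCDCILGCCFBDCDEIFJBHEBCBHIHGI"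
  ∷ "FJIFKCDCCDECDEIFJBHJNMCDBFBGAIEHIFGIJIDBCBBCIJICBFHEIJIIFGCDEHJHGKBBDCJEGIFGIEHIJGBCFAIEFIKIIKHC"
  ∷ "BCBCHEBBGAIKIIEFIKHILICBJHEBCILHBECCLCCKIEFCDJILHBECCLFAIKICBCEDEBCILICBCEDEBCGAIKHIKICBCHEEDEBC"
  ∷ "CBFIEHCDFFAILICBCEDEBCIMICBCJKMGAIEHIFGIEIBCGAIFKIHGIJKCDCHGBDBCFAIFLIHGIJLIFKCDCBCHGBHCCFIHGCBE"
  ∷ "IFLBHCCFGAIJKCDCEBFDCIJLCDCEBFDCFAIFKIJKCDCHGEBGDCCBCIFGCBEGAIJLCDCEBFDCIJMCDCJNMIEHIFGIEIBCIJGB"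
  ∷ "CFAILHCBCBCGACDJCDJGBGACDFCDFGACDFCDFFAFAILICBCDBELCBEFBIFGCBECDFCBEFCGBFAIFIDCDCHEFAIFIIJIIFGDC"
  ∷ "DCHEHECBCIJIIEFCBDGABBIJHBEDCJBIFGDCDCGACBCIKHIELCBCFABBBEGADBKCECKBDGBFAIEHIFIIHGDCDCBDHEIFICDC"
  ∷ "HGFAIEHIFIIHGIKJIKIIFGDCDCHEHEIFGDBCBHEIKIBDHEHEIKJIFICDEHJDEKEIEHIKICBDIHGIFGDCDCGACBCIEMILHCBC"
  ∷ "FACBCECLBDFABBBECBDIKJCBCDEKEFAIFIBDHEFAEBFDCILGCDCJMMGAIHGCDEJMMBEGAIHGCDEHJBEILIBDFAHEFACDECDE"
  ∷ "FBGAIFKIHGCDEHFCFECBCIFKBEEBCDFIHGCLEGAHFJOOCFECFEJNOIFMBECCFGAIFJIHGCDEHFCBCIFJBEEBCDFFAIEFCBCB"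
  ∷ "BGAFAIEFIENIMHCBCCBCBBBEIEFIMHIENCBCBBIENCBCBBBEFAFAIEFIEOIMHCBCIENDCMBBBBEBEIEFIMHIEOCBCBEIENDC"
  ∷ "MBBBBEFBIEFIMHIEOCBCIFGBCBEIENDCMBBBBEIEFIEOIMHCBCIENDCMBBBIFGBCBEBEGBFAGAIFIIHGIFJDCDCHEIEJIFJE"
  ∷ "HDBCHEHIIHGIEJCFCHHHEKBBDCEFHIFIIHGIFJIHKDCDCGACHDGAIFKIIGCHDCHDEBCDFIEKEHDBCEDBEHFAIHKCFDCFCIEL"
  ∷ "IHKCFCFAHEIIGCFDECDCIGAIHKIIGCFDBFHGKCBFDHCEGDBEFHEFAIFKEHEBCHIDDEDFBIFKEHEBCJMMGAIFJDDEDCFDFBIF"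
  ∷ "LIFKBEDDEDDDEDIFLIFNBEDDEDDDEDHFFAHICFDFBJMMCFDDBCBGBHEGAABFBFABBIKFIMFBEIKIIHGCBDCBDFAABFABEDBC"
  ∷ "MIHGCBDCBDFABBFBIKHINHCBCIKICBDBECBDIHGIKICBDINMBECBCCBCFAABFABBIKHBEDCKBFAIFIIHGIKIDCDCIFGEKCBE"
  ∷ "HHDBEBCFDIHGIKIILIDDEDFAIFGIKHCLCCLDEBDEFFAIKHIMGIFGCLCDBDFDCDCECBEKIKHIMGINGCLCDBCNDCDCECBEKDCD"
  ∷ "CDBEBFAIFIIHGIKIIFJIHLDCDCGACHDGAIFLIKLIIGCHDCHDIFGEBCDKEBFHDDBDFIFGIELEHDBCEDBEHIKLCHDEBFHDFAIH"
  ∷ "LCFDCBDIEMIHLCFCFAHEIIGCFDECDCIGAIHLIIGCFDBFHGDBEBDBEFHEFAIFLEKCBEHGCEKGAFAIFLEKCBEHGCEKFBIHLIFM"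
  ∷ "DDEDGAHGBEGAHGCEGBECFDIFMCHDDHKEIFNBECEKGAIFGEKCBEHJIFLDDEDGAHGGAHLCFDCFDHEFAIKIIFLEHEBCHKHFKCCH"
  ∷ "EKBDFIKIDDEDCEKFBIKIIFLEHEBCHKFAECHEKFAECHEKCKDFBJNOFBECHEKCKDFAHLHJIFLEBHKEJOOGAIKIIFMEHEBCIKJD"
  ∷ "DEDCEKCEKFBIKMIKLIFMBEDDFDEBCEKEBCEKIKMIKOIFMBEFBIKLDDFDDDEDGAFAIKLEEBDHDDEDGAIKLEEBDHDDEDIKLEEB"
  ∷ "DHDDEDFBIKLEEBDHDDEDGBIKLEEBDHDDEDIKLEEBDHDDEDEHEBCDEKBHKHFFBJNOGADDFDGADDFDCFDFACKDFACKDDDKDFBC"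
  ∷ "KDFBCKDFBIFMCKDDDKDGADDKDGAIFJDDKDCKDIFMIFNCKDDDKDDDKDFACFDCFDGBIELIEFIEJIKIIHGCBDCCHDDKDIKIIHLI"
  ∷ "MIIHGDDEDCCHFAIFLIKHIFGCMDIKLEBCEFEBKMCIFGCMDDBDFEEDFMIHGIKHDCDCECBEKCCHCBDIHGIHLDCDCCBECCHFABBI"
  ∷ "KHBEDCKBIKJIHGIKIIMJDDEDFAIFGIKHCMCCMCIKHDCDCDBDFFAIFIIKHINGIFGCMCDBDFDCDCECBEKCFCGAEMDBEEMDBEIF"
  ∷ "JDCDCGAHHGAHNDNEFCFDHKHMHJGACJDGACJDGAIOICJDDDODFBFBAKIOIIPICJDDDPDDDODFBFBAKIRIDDJDCJDIOIIPICJD"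
  ∷ "DDPDDDODGBGAAMGAAMFBFBIFIDDJDJKSINIIOICJDDDODDDNDFBFBIFIDDJDCCHIQIDDJDCJDINIIOICJDDDODDDNDGBGAAM"
  ∷ "IOICJDDDODGBIOICJDDDODFCFCIFIDDJDJNQIOIIPICJDDDPDDDODFCFCIFIDDJDCCHIRIDDJDCJDIOIIPICJDDDPDDDODGC"
  ∷ "GBAKGBINICJDDDNDFAAMFCDDJDFCIFIDDJDCCHIPIDKJDCPDGCGBAKIOICJDDDODGCIOICJDDDODFDDDJDFDIFIDDJDCCHIO"
  ∷ "IIPICJDDDPDDDODHIFBFBAKCIDCIDFCFCJKQFCDDIDCIDFCFCDDIDCIDCIDFDAIFDDDIDFDDDIDCIDHJGACJDGACJDGAIOIC"
  ∷ "JDDDODFBFBAKIOIIPICJDDDPDDDODFBFBAKIRIDDJDCJDIOIIPICJDDDPDDDODGBGAAKGAABFBFBIFIDDJDJKSFAEKJDMIQI"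
  ∷ "DKJDCQDFBFBIFIDDJDCCHIQIDDJDCJDFAFBINFBMCJNFBIOIINICJDIOFBMCKOCMOIOIINICJDFBIOPCKNBMIOPCKNBMCMOI"
  ∷ "RIDKJDCRDGBGAAKIOICJDDDODGBIOICJDDDODFCFCIFIDDJDCCHIOIIPICJDDDPDDDODFCFCIFIDDJDCCHIRIDDJDCJDIOII"
  ∷ "PICJDDDPDDDODGCGBAKGBINICJDDDNDFCDDJDFCIFIDDJDCCHINIIOICJDDDODDDNDGCGBAKIOICJDDDODGCIOICJDDDODFD"
  ∷ "DDJDFDIFIDDJDCCHIOIIPICJDDDPDDDODHIFBFBAKCIDCIDFCFCDDIDFCDDIDCIDFCFCDDIDCIDCIDFDAIFDDDIDFDDDIDCI"
  ∷ "DHJGACJDGACJDGAIOICJDDDODFBFBAKIOIIPICJDDDPDDDODFBFBAKIRIDDJDCJDIOIIPICJDDDPDDDODGBGAAKGAABFBINI"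
  ∷ "IOICJDDDODJJSFBDDJDFABMIRIDKJDCRDGBGAAKIOICJDDDODGBIOICJDDDODFCIOIIPICJDDDPDDDODFCDDJDIOIIPICJDD"
  ∷ "DPDDDODFAAKFAABDDMDCMDHMHJGACJDGACJDGAIOICJDDDODFBFBAKIOIIPICJDDDPDDDODFBFBAKIRIDDJDCJDIOIIPICJD"
  ∷ "DDPDDDODGBGAAMGAAMFBINIIOICJDDDODJJSFBDDJDINIIOICJDDDODDDNDGBGAAMIOICJDDDODGBIOICJDDDODFCIOIIPIC"
  ∷ "JDDDPDDDODFCDDJDIOIIPICJDDDPDDDODFAAKFAABDDMDCMDHMHJGADDJDGADDJDCJDGBGAAMCJDCJDJKOHJGAFAAJJKQGAD"
  ∷ "DJDCJDFAIMGIFGCKDDCDCIFIDCDCCFCIMGINGCKDEBDKNEBCEMIELIEFIENIKIIHGCBDCCHGACBCIEOIMHCBCIFJDCDCGACB"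
  ∷ "CCFDDDKDGBGAIFIIHGIKHIMIIFJIHLDCDCIIGCHDCHDIKIIHLIIGCFDBFIIGDBCHDBEBHGDGEFIFLCMDDBDFIMJDCECDBDMC"
  ∷ "CHCFDIFIIHGIKHINIIFJIHLDCDCIIGCHDCHDIKIIHLDCECIIGDBCHJJOGAHGCGCDGEFIHLCFDDBCHIFLCNDEBDEFIMJIFLDC"
  ∷ "ECGAIMGDBDFCMCIIGDDEDCEFIIGECBEKFADBDMDBDMCCHCFDHGFAGAIKHIFNEBCEGDGEFCBGIKHIFNEBCEGDGEFCBGGBIKNI"
  ∷ "OHCGCCGDIFLEBCEGGADGFEGADGFECEFIKNIOHCGCCGDIFLEBCEGGADGFEGADGFECEFGAFAGAIFIIKHIFJIHLDCDCIFNCHDDB"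
  ∷ "CHIMIIKIIHLCFCCFDDDKDDMCGCDKCBDIFIIKHIFJIHLDCDCIFNCHDDBCHIMIIKIIHLCFCCFDDDKDDMCGCDKCBDIKLIMNIOHC"
  ∷ "GCCGDIKHIFLEBCEGGADGFEGAIPIDCDCCPDCEFCDKIMNDCECEBKMCFBIONIHLDBEGIFNCHDDBCHDCGCFBGAIFLIKLIMLCEGIO"
  ∷ "NDBEGDCGCIPNDBDGGADBEGDBEGIONCGCGAIKJCGEDGOEIKQCGEDGOEIFLIONDBEGDCGCIONCGCGBIKJCGEFADGOECKCIKRCG"
  ∷ "EFADGOECKCFBGAIQLIONIFLIKLIMLCEGDBEGDBEGIPHCGCCBCIFLIKLIMLCEGDCGCDBDGGAIKJCGEDGOEIKRCGEDGOEGAION"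
  ∷ "IPHCGCBQIKJCGECQCIONIPHCGCBQIKRCGECQCIQLIONIFLDBEGIPHCGCCBCGBIFLDCGCIKJCGEFADGOECKCGBIFLDCGCIKSC"
  ∷ "GEFADGOECKCIFLDCGCIKSCGEFADGOECKCGBIONIPHCGCBQIKJCGECQCIONIPHCGCBQIKSCGECQCGAIQLIONIRLIKLIMLCEGD"
  ∷ "BEGDBEGIPHCGCCGDGBIRLDCGCIKJCGECRCGBIRLDCGCIKSCGECRCIRLDCGCIKSCGECRCGBIONIPHCGCCGDIKJCGECQCIONIP"
  ∷ "HCGCCGDIKSCGECQCIQLIONIRLDBEGIPHCGCCGDIRLDCGCGCIKJCGECRCIKTCGECRCGCIONIPHCGCCGDIKJCGECQCIONIPHCG"
  ∷ "CCGDIKTCGECQCGAIKHIKLEBCEGIMIDCDCCMCCDKDCGCCCGDBDGFBIKLIMLBEIKNCBMCEKCBKIKIIINDBDGGBABIKPIHLCGEC"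
  ∷ "EGIMLCKDDCDCIMNIHLCGECEGFBCEGFAIFLCMDCEFFBCEGFAIPLIRLCEGCMCCMCIPLIRLCEGCMCCMCFCIKLIMLBEIKNCBMCEK"
  ∷ "CBKFCGBDBEGDBEGGBFBIJNDBEGDBEGIILIKIIJNDBDGGBIKQCGEIMLCKDDEKGIKRCGEIMLCKDDEKGIMNCGEFAIFLCMDCEFDB"
  ∷ "CGCEGFCIQNDBEGGBDBEGDBEGGBIPLIQNIRLDBEGIKIDBDGIMNCGECMCGBEBGQEGBIRLEBGQEBEITLEBGQEBEGBBEIKIIQNDB"
  ∷ "DGIKSCGECKCIMNCGECMCIPLIQNIRLDBEGIKIDBDGIMNCGECMCGCEBGQEIHLIKTDDEDIMLCKCDEKGCEGGCBEIKIIQNDBDGIKT"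
  ∷ "CGECKCIMNCGECMCFABBIKHBEDCKBGAGAIFIIHGIKHIMIIFJDCDCIKICFCDCECIFNCMCDCECCDKDDHBIKHCFDCDCIFIIHGIKH"
  ∷ "IMIIFJDCDCIKICFCDCKCFAIFOIFNCMCDCFCIKNDCECCKCFAIFPIFOCMCIKNDCECCKCIKNIKODCECCKCCKCIFPIFQCMCFAIKN"
  ∷ "IKODCECCKCCKCFAIKNIKODCECCKCCKCIKNIKODCECCKCCKCFAIKNIKODCECCKCCKCIKNIKODCECCKCCKCCDKDDHBFAIKHCFD"
  ∷ "CDCIKHCFDCDCGBIFIIHGIKHIOIIFJDCDCGAIMIIKICFCDDKDIKNDCECIOGCKCEBCEOGAIPIIMICFCIKNDCECIPGCKCDEMPIK"
  ∷ "NIMNDCECIOGCMCCEOIMGCKCEBCEMIPIIQICFCGAIKNIMNDCECIPGCMCIKOCEPCEPIMGCKCEBCEMGAIKNIMNDCECIRGCMCEBC"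
  ∷ "ERIMGIRGCKCDDQDDDQDIKNIMNDCECFAISGIRGCMCCERDDQDFAITGISGCMCIKRCESCESDDQDITGIUGCMCFAIKSCEUCEUIKVCE"
  ∷ "UCEUDDQDFAIMGISGCKCDDQDDDQDIMGITGCKCDDQDDDQDGAIKNIMNDCECIQGCMCEBCEQIMGIQGCKCDCPCDCPCIKNIMNDCECFA"
  ∷ "IRGIQGCMCCEQDCPCFAISGIRGCMCIKQCERCERDCPCISGITGCMCFAIKRCETCETIKUCETCETDCPCFAIMGIRGCKCDCPCDCPCIMGI"
  ∷ "SGCKCDCPCDCPCIFNCODGAIKJDCECIMGDCFCEBCEMIKJDCECIMGCKCDCFCCDKDDHBIKHCFDCDKHHCDHFAIKICDHDCDCIKNIKF"
  ∷ "EDBCHIOGCCHDBDOCDHFBGAIFGIMIDCDHCHCCEFGAIFIIFJDCDCCHCCBCIFGIOGDCDHCEOCEFGAIMFIKIIQGDDCHFAIOICHCC"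
  ∷ "EQIMNCQCCCHDDKDGAIOGCCHCEOIOIDCDCCCHIFGIRIIOGDCDHIKFCEOCDHGAIMFCDHIQJCHCDCDCGAISFCDHIQJCHCDCDCIS"
  ∷ "FCDHDCDCCEFGBFBIKIIJGDDCHCEJDCDCIFQIJGDDCHCEJIIGCHDBIFCIFPIQGIKIDDCHDCKCCEQIOIDCDCCCHIQGIFRIKIDD"
  ∷ "CHDCKCIOIDCDCCCHCEQGBIJGIFNDDCHIOGCCHCODBJIFNIKIIONCDHIFGCCHCEFDCKCIOGCCHGADCDCCEOIKIDDCHDCKCDDH"
  ∷ "BFCFAGAIEHIFIIHGIFJIHJIKGDCDCDBDBBDHEIFJCHDHEHEHGHKDBEBIFIIKGCDCCDCIKGCFCBFIEJIFIIKGBDBDHEFAILGC"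
  ∷ "DCCLDCFEGAIHJIKGCDECDCHGGAJNOGADDGDCGDGADDGDGADDGDCGDJLOBEGAIHJIKGCDECDCHGKCCFEGBDHBEFAIFIIHGILG"
  ∷ "DCECCLEIFKCHDBHHGHLCGDDBEBIFIIKGILGDDEDCLECKEHGJMMCGDCGDCGDJLMGBFAIEHIFIIHGILKILIIFJIHJIKGDCDCDC"
  ∷ "DCBDHEHEIFGIKGELCBEDBEBHHIFGIFJDBCBHECBFIFJILKILJCHDEBCDLBHHEIHJILKIHGCFDHEHLIEJCCFIHGCFDKCBHDFC"
  ∷ "ELBDILKIFIIKGCDECDEIKGCFCBFDELEIEHIEJILIIKGCBDCBDGAIEFCBCBBIEFIENIMHCBCIFJIKGDCDCCCDFACBCIKGECMB"
  ∷ "DCCKFABBIMFBEIKGDBCDCCDBEILIIKGIMIIHGDDEDDBCHFAIFGILKCMDEDEDLEBDEFFAIHGEMDBEILKCMDDBCHIHGEMDBEIL"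
  ∷ "KCMDJLOCCDIHGIKGDCDCCCDCHDILKCBCDELEIEJILIIKGBDBDFAHEFAIKGCDECDCIKGCDECCDGAFAIFMIHJIKGCDECDCHGHK"
  ∷ "DDGDDDLBCBCIFGIHJCLEHFCBCCFECFECFEIHJCDEJOOFBIFMBEIKGEBCDFIHJCLCJLQIFOBECCFGAIFKIHJIKGCDECDCHGHK"
  ∷ "DDLBCBCIFKBEEBCDFGAIEFCBCBBIEFIEOINHCBCFACBCIEPDCNBBBIFGIFJBCFABBBEFABBBEBEGAILIIKGIFIIMGDDEDCME"
  ∷ "EDBCFIFICCECCDIFGIKGELCBECCDJMMIFGINGBCGAILIDCECDCDCGAIFIILKDCDCIOICLCEBCENILKCFDCLCIOIDBENCDOFA"
  ∷ "ILKINIDCDCEBDEFINICLCJMODCBEGAGAGAIEHIFIIHGIFJIHLIKGDCDCHEIFLEKEBCHHIHJEKEBCCKECHDIHLIKLCFDBDHEI"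
  ∷ "FLIFJCHDHEHKEBCDFHEHGCGDHLIHJIKGEFCBEHHIKGCFCKCCFEKBDHIFIIKGCDCEDBKEIKGCFCEDCKEIEHIFIIHGIFJIHMIK"
  ∷ "GDCDCHEIHLDDEDFAHIFAHMEBCEMCHDCHDFAIFMIHJEKEBCCKEHHDCDCIHNDDEDFAHJFAHIBECIECHDFBIFMEEBDKHHCHDFAH"
  ∷ "JCHDFBJOOCHDFBIFNIFMBEIHNDDEDJOODDEDIFNIFOBEFBEBFDKGAIHODBCFDCFHIHODBCFDCFHDDEDEEBDKGAIFLIIGCHDC"
  ∷ "HDEBCDFGAIEMEHDBCEDBEHIEMEHDBCEDBEHIELIHMIKGCFCFAIHLCFDDDHDGAIHLIHNCFDDDHDDDHDIHLIHNCFDDDHDDCKFG"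
  ∷ "AHEIIGCHDECDCIGAIHMIIGCFDBFHGDBEBDBEFGAIFMIFLCHDIEMEBCDFHKEBCDFIFMIFNCHDIEMEBDFHHKBDFBJOOCDKEBCD"
  ∷ "FHEHGCGDHMHHFBFAAHJPQFBDDHDCHDHHJROFBFBAMCHDCHDFCDDHDFCDDHDCHDHMCMDGAAGGAABDDMDHHFBFBAMFBAMGADDH"
  ∷ "DGADDHDIKNIKOCHDDDHDDDHDFBFBAMIKOCHDDDHDFBIKOCHDDDHDGADDHDGADDHDIKOIKPCHDDDHDDDHDFCCHDFCCHDFCIKO"
  ∷ "CHDDDHDGBGAAGIKOIKPCHDDDHDDDHDGBGAAGIKRDDHDCHDIKOIKPCHDDDHDDDHDHMCMDGBAGGBABDDMDHHFBFBAGFBABGADD"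
  ∷ "HDGADDHDFBBMGBIKRDHDGCHDIKSDHDGCHDFBFBAGIKOCHDDDHDFBIKOCHDDDHDGADDHDGADDHDIKOIKPCHDDDHDDDHDFCCHD"
  ∷ "FCCHDFCIKOCHDDDHDGBGAAGIKOIKPCHDDDHDDDHDGBGAAGIKRDDHDCHDIKOIKPCHDDDHDDDHDHHHKGAAHGADDKDGADDKDCKD"
  ∷ "GBGADDKDGADDKDCKDGBGADDKDCKDCKDGCGBAGCKDCKDFBFBAGFBIKNCHDDDHDGADDHDGAIKLDDHDCEFIKNIKOCHDDDHDDDHD"
  ∷ "FBFBAGIKOCHDDDHDFBIKOCHDDDHDGADDHDGAIKLDDHDCEFIKOIKPCHDDDHDDDHDFCFCAGFCABGBGAIKLDDHDJTSFBEHDGMGB"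
  ∷ "IKQDHDGCHDIKRDHDGCHDGBGAIKLDDHDCEFIKQDDHDCHDFCGAILNBMCHLGAIKOIKNCHDILOBMCGKCKDIKOIKNCHDGAIPOCGKB"
  ∷ "MIPOCGKBMCKDGCIKRDHDGCHDIKSDHDGCHDFCFCAGIKOCHDDDHDFCIKOCHDDDHDGBGAIKLDDHDCEFIKOIKPCHDDDHDDDHDGBG"
  ∷ "AIKLDDHDCEFIKRDDHDCHDIKOIKPCHDDDHDDDHDFDCHDFDCHDFDIKOCHDDDHDGCGBAGIKOIKPCHDDDHDDDHDGCGBAGIKRDDHD"
  ∷ "CHDIKOIKPCHDDDHDDDHDHHHKGAAHGADDKDGADDKDCKDGBGAJTQGADDKDCKDGBGADDKDCKDCKDGCGBAGCKDCKDFBFBAGFBIKN"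
  ∷ "CHDDDHDGCAMGADDHDGAIKLDDHDCEFIKPDHDGCHDFBFBAGIKOCHDDDHDFBIKOCHDDDHDGADDHDGAIKLDDHDCEFIKOIKPCHDDD"
  ∷ "HDDDHDFCFCAMFCAMGBGAIKLDDHDJTSIKNIKOCHDDDHDDDHDGBGAIKLDDHDCEFIKQDDHDCHDIKNIKOCHDDDHDDDHDFCFCAMIK"
  ∷ "OCHDDDHDFCIKOCHDDDHDGBGAGBAMGBAMIKLDDHDJYQIKOIKPCHDDDHDDDHDGBGAIKLDDHDCEFIKRDDHDCHDIKOIKPCHDDDHD"
  ∷ "DDHDFDCHDFDCHDFDIKOCHDDDHDGCGBAGIKOIKPCHDDDHDDDHDGCGBAGIKRDDHDCHDIKOIKPCHDDDHDDDHDFAIHJIKGEFCBEH"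
  ∷ "JIKGCFCDBDBIHJCEFIKGCFCJQOFBGAIHLIKGEFCBEEBKFEDDHDIHNIKGEFCBEEBKFEECEHFBEIHGIKGDCECEBKFECHDIFIIK"
  ∷ "GCDCEDBKEIKGCFCJPMIEJIELIFIIKGBDGBDDKDIFMIHNCDCGBDDKDIENDDKDCEKGAABGAIHNCDCIEOCCFJQODCFDFAIEHIEM"
  ∷ "CCFDDFBCDBIEHIENCCFDDFBCDBHJFBIHGCJDHIGAJMOCIDGBIHNIIGCJDBJIIGEDBCJJLODBEJFBFAECECJECECJFBFAIFII"
  ∷ "FNIKGCDJDCDCIMGDCDCDDEDDDJDIFNIIGECECJCDJIOGDCDCDDEDGBIFIIFNIFOCEJFAIKGCDJDCDCIOGDCDCFACDJFAIPIC"
  ∷ "DJBDDDEJFAIMGDCDCCMDIPGDCDCCPDDDFBIFIIFNIFOCEJFBFAIKGCDJDCDCIQGDCDCCQDINGCCFFACDJFACDJFAISICDJBD"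
  ∷ "DBCFCCFDDFBGAFBIHGIFIDCECDCFJIFKCHDDCJFFAFAIFNIIGIHGEDBEJIFICHECHDCEJIHGIKGCDJCJDCJDGAIFNIFIIFOC"
  ∷ "EJIHGDCDCCDJDDFBIKGIHOCDJIIGCJDCDICJDGAIFNIFIIFOCEJIKGIHNCDJIIGCJDCDIIMNCJDDDJDDDFBCCFIFNIFOIFIC"
  ∷ "EJDDFBINGCCFCDJCCFFBIHGIFIIFKIHNDCDCIOGIIGCJDBHDDEDIHNFACDJFAIPICDJBDDCECIIGDDEDJMQIHNDCFJFAECBD"
  ∷ "FECBDFIFNIFKCHDCHECJDGBIFNIFIIFPIHKCEJFACDJFAIQICDJBDDCDCIHGDCDCFACDJFAIPICDJBDDDEJDDFBIIGIOPCJD"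
  ∷ "FAIKGCDJDCDCFADDEDFADDEDDDEDCDIIFNIFPIHKIFICEJDDFBFACDJIFIFAIRICDJBDDCDCDCFJFBIKGFAIHNCDJIIGCJDC"
  ∷ "DIDDEJFADDKDDDKDINGCCFCJDCCFGAFBFAIHGEDBEJIFKCHDDCJFFAIHGEDBEJIFKCHDDCJFIHGIFIINGDCECCNEECBDFIFK"
  ∷ "CHDDCJFFAFAIFOIHGIIGEDBEJCEJIFICDJCHDINGIKGCDJIHICJDDCDCIHICJDCDHGAIHIIFOIFPCEJIKGDDEJIMOCJDDCDC"
  ∷ "IMPIIGCJDCDICDJIKGCDHDCDCIHIIFOIFPCEJFAIKGDDEJIMOCJDDDJDIOGCCFCDJCCFIKGCDHDCDCFBIHIIKGIFPIIGDDEJ"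
  ∷ "INOCDJBNCCFFAIPOCJDDDJDIPOIQOCJDFADDJDFAIFIDCDCDCFJIFICQEDCFJFADJPEIFICPEDCFJIKGCDHDCDCIFOIHIINK"
  ∷ "IFQCEJFBIKGDDEJFADCDCDCDCFBIKGDDEJFADDKDDDKDIOGCCFCJDIIQIFPDDEJCCFBEIKGCDHDCDCFBIIGIKQDDEDCKDCDI"
  ∷ "CCFFCFAHIECBDIEDBEJIHGIKGCDIDCDCCDJFBIKGBDCEKGAAIFAIQGEJDBCCQEIFKIPGCIDCJDDDEJFBIHGEDBEJIFICDJCH"
  ∷ "DHIECBDIECECIIHGDCECCDJGAFAIPGIKGCDIDCDCCDJIPGIKGCDICIDCDJFBIRGIKGCDIDCDCCDJIRGIKGCDICIDCDJGAIPG"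
  ∷ "IKGCDIDCDCCDJIRGIKGCDIDCDCCDJFCIKGBDCEKGBIQGEJDBCCQEIFKIRGCIDCJDDDEJHIFCFBECBDIECBDICEIIKGCDIDCD"
  ∷ "CGAIHPIKGCDIDDIDFAFBEDBEIDCECFCFBEDBEIEDBEIIFQCEICJDFBIQPIKGCDIDDIDFCGADCECGAIHGDCECCDJIKGINGCDJ"
  ∷ "DCECCQDIKRDDEDCDJIQPIKGCDIDDIDGAIFKCIDDCEFIFKCIDDCEFGAIHPIKGCDIDDIDFBEDBEIDCECIQPIKGCDIDDIDFCING"
  ∷ "CQEDCECFCIKRDDEDCDJIKRDDEDCDJFCIKGBDCIDGBAIIFKIQPCIDFBFCFBIRGCJDCREFBIRGCJDCREIRGCJDCREIRSCJDCEI"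
  ∷ "FDFCISGCJDCSEFCISGCJDCSEISGCJDCSEISTCJDDDEDDDEJGCIFPBECDJFDIKGIPGCDIDCECDCDCIKGIPRCDIFCABINRCDJC"
  ∷ "EJDDKDFCINPCDJBNCDIIFIIKGBDGBCDCIHLCDCDCDCCCFGBAEGBABFBFBIKNCJEIFOBECBFIFPCJEBEFCFBIFNIKGDEJEDDK"
  ∷ "DECJEFIFNIKGDEJEDDKDECJEFFCHICEIIKGDDEIDCDCGAIFQIKNCJEDDEJCEJFBIKGBDCIDIRPIKGCDIDDIDGAIFKCIDCEII"
  ∷ "FKCIDCEIGBIFPBECCFFCFBIKGDDEIDDKDIKGIPODDEIIKSDDEDCEIDDKDIKGIPSCDIFBABISQCDJCEJDDKDFBIFPBECCFIKG"
  ∷ "IPNDDEIDDEJDDKDCDIHICEIIKGDDEIDCDCGAIFQIKNCJEDDEJCEJFBIKGBDCIDISPIKGCDIDDIDGAIFKCIDCEIIFKCIDCEIG"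
  ∷ "BIFPBECCFFCFBIKGDDEIDDKDIKGIPODDEIIKTDDEDCEIDDKDIKGIPTCDIFBABITQCDJCEJDDKDFBIFPBECCFIKGIPNDDEIDD"
  ∷ "EJDDKDFCIKGIPGCDIDCECDCDCIKGIPRCDIFBCDJIRQCDJCIEDDKDGCFCIKGIPGCDIDCECDCDCIKGIPSCDIFBCDJISQCDJDDE"
  ∷ "DDDKDFDIKGIPGCDIDCECDCDCIKGIPTCDIFBCDJITQCDJCEJDDKDCDIFBAEGBABFBIFICDEBEIFODEJECEJHIGBHGCGDGACGD"
  ∷ "GAIHLCGDDDGDGAIOLIHLCGDDDGDDDODIOLIPLCGDDDPDDDODGACGDGADDGDGADDGDINLIOLCGDDDODDDNDHLJKOFBDDLDFBD"
  ∷ "DLDCLDDDIBGBFADDEIIKGDDEIDCDCFADDEIIKGDDEIDCDCFBGAIFMFAIKGDDEICIDIKGDDEIGAIMLCIDDCDCDCDCBFIFMINL"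
  ∷ "DDEIFBIFKCIDBFIFKCIDBFCCFGAGBHFCCFGAINGCCFIHLCDIJOQIOGCCFGAIHLCDIDDEDGAIHLCDICHDIHLCDICHDGAINGCC"
  ∷ "FIHLCDIDDEDIOGCCFGAIHLCDIDDEDGAIHLCDICHDIHLCDICHDIHLIHGCDICHEDDEDIHGIKGCDIDCDCJNOFBHFCCFGAFAINGC"
  ∷ "CFDFNCINGCCFDFNCFBIPGCCFGADFPCDFPCIPGCCFGADFPCDFPCGAIHKCEICCFIPGCCFDFPCDBCFIHOIKGCDIDCDCDDEDIHLI"
  ∷ "KGCDIDCDCINGCHDJNQHFCCFGAFAINGCCFDFNCINGCCFDFNCFBIQGCCFGADFQCGBDFQCDFQCIQGCCFGCGADFQCDFQCGADFQCD"
  ∷ "FQCGAIHKCEICCFIHKCEICDIDBCFCCFFBIHLIKGCDIDCFKINOCHDDCDCILGCCFCDIFCGBIHKIHMCEICFCCDIIHKIHMCEICFCC"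
  ∷ "DIGBIPGCCFGBCCFDFPCIRGCCFGCCCFDFRCIHKIHMCEIIKGCDIDCDCCDIHFGAABFBGAIPGCCFGBBPCFCIPGCCFGCGADCDFDCD"
  ∷ "FDCDFGADBCBIPGCCFGDGADCDFDCDFDCDFGAABDCDFCCFGBFBINGCCFGBDCDFCIDINGCCFGCDCDFCIDFCIPGCCFGCGBCIDGBD"
  ∷ "CDFDCDFDCDFIPGCCFGDGBCIDGBDCDFDCDFDCDFGBINGCCFFBDCDFCIDIPGCCFDCDFGCIMLDDEDCMEDBCFFCINGCIDCDIFCIN"
  ∷ "PCIDFBIKGCDIDCDCFBIKGCDIDCDCIKGCDICNECCFFDFBGBGAIHLEBCEFCIDFAIHLEBCEFCIDIHLEBCEFCIDGAIOKDEDICDII"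
  ∷ "OKDEDICDIFAGBIHLEBCEFCIDIOKDEDIDDEIFCGAIHLEBCEFCIDIHLEBCEFCIDIOKDEDIGADDEIDDEIFDFCFBIHLEBCEFCIDI"
  ∷ "HLEBCEFCIDIOKDEDIGADDEIDDEIGCILGCCFCDIIRGCCFGDCCFDFRCGBABFBFBIKGCDIDCDCFBIKNIFOIMNCIECIEDEDIGADD"
  ∷ "EDDDEDIKNIMNIKLCIECBEDDEDGADDEDDDEDFCHFGAABFBGADBCBIPGCCFCDIFADBCBIPGCCFCDIGAABIKGCEIGACCFCCFDED"
  ∷ "ICCFFBILGCCFCCFILGCCFDBDFGBFBIOGCCFCCFIOGCCFCEIFCIPGCCFCCFIPGCCFCDIIHGCFDCDIHFGAABFBGADBCBIQGCCF"
  ∷ "GCDCDFDCDFIRGDCDFGDGACCFCCFGACCFCCFGAABGADBCBIQGCCFDCDFDEDICCFFBILGCCFFBDBDFCDIILGCCFFCDBDFCDIGB"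
  ∷ "FBIOGCCFGBCDIDFOCIOGCCFGCCDIDFOCFCIQGCCFGCDFQCDFQCIQGCCFGDDFQCDFQCGBDBCFDBCFFCDEDIFCDEDICCFFDIKP"
  ∷ "DEDIFCCDIDDEIFDIKPDEDIFCCDIDDEIGCIPGCCFCDIISGCCFGDCCFDFSCGBABGBCDICDIGCFAGAIEHIFIIHGIMKIMIIFJIHL"
  ∷ "IKGDCDCHEIFLEKEBCHMIHJEKEBCCKEIMJCHDIFGEBCDMEBFHDIHLIKLCFDBDHEHEIFLIKGEMCBEHFHGHHIFGIHJIKGEMCBEH"
  ∷ "HIKGCMCDBDBHJDCDCIFGIFLDBCBCBFCBFIFLIMKIMLIFJCHDHEHMEBCDMIFJBHIELCCFDBCBIMKECDFHCCHIHJIMKIHLCFDH"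
  ∷ "EHMIEJCCFIHLCFDDBCBIMLCCFCMDIMKIFIIKGCDEHMHFHJEBEKMEBEKMIKGCFCEBEKFDEMEIEJIELIMIIKGBDDDKDDDMBIMJ"
  ∷ "IKGIMIIFJINGDDEDCNEEDBCFIFGECBDMHJJMOCJDCJDIMIIFJDCECCFDEBMKCIFGCMDDCDCIKLIMIIKGIFIINLDDEDCNEIML"
  ∷ "EDBCFCFDIFIIHLDCDCFAHMBCFAHFBCCHDGAIHLCFDDFKCIHLCFDDFKCIKGIFLEMCBEHGJMOGAECDFGCGDGAECDFGCGDIFLEB"
  ∷ "MKCJLOGACKDCKDFBIEHIELIEJINIIKGCBDIHJCCKCBDDDNDFAINIIKLIMIIHLIKGDDEDCCKDBCHIFLINKIFGCMDINHINLEBC"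
  ∷ "EFEBNMCCMDEDEDNEEDFMCBDIFLIKGENCBECCKDDFDINIIKLIOIIHLIKGDDEDCCKDBCHFAIMLINKIMGIFLCODDDFDIHLDCDCC"
  ∷ "HDEDEDNDBEMFAIPLINKIPGIMLCODDBEMIHLDCDCCHDEDEDNDBEPIPLINKIPGIQLCODDBEQIHLDCDCCHDEDEDNDBEPCBDIFLI"
  ∷ "KGENCBECCKGAIOGDDFDDCDCGAIHGIKGDCDCCCKCCHIHGIKGDCDCCCKCCHFAINJIKGINIIMJIHGDDEDDBCHIFGINKCMDEDEDN"
  ∷ "EBDEFIHGIFJDCDCHHIFJCHDDBCHIHJCCKINICKEDBDBIMGIFGCNDDCDCEBCEMINJIKGINIIOJIHGDDEDDBCHFAIHGEODBEIN"
  ∷ "KCODDBCHFAIHGEODBEINKCODDBCHIHGEODBEINKCODDBCHIHGIFJDCDCGAHHCHCCFDIFJCHDDBCHIHJCCKINICKEJKOFAIOG"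
  ∷ "IMGCNDEBDNMEBCEOIOGIPGCNDEBDNPEBCEOINKCBCDENEIEJIELINIIKGBDDDKDFAIEFCBCBBFAIEMDDNBBBIEQDDNBBBIFG"
  ∷ "IMGBCGAINJINIDCECIFJDCDCJNOEBCEMGAIFIINKIFJDCDCDMEFIPJIPICNCCDPEBCEMIPKCFCEDCPFIPJDBEMDCBEFAINKI"
  ∷ "MIDCDCCDMEBDEFDCBEIFGIMGIFLBCFADCBEGAIPGDCBEINICPCDCDCFAIPGIQGDCBEIPICQCEBDEQINICPEDCDCGAIPGIRGD"
  ∷ "CBEIPIIQHCRCBCEBDERINICPEDCDCIPGIRGDCBEDCFBINICPEDCDCGAINIIHLDCECDBCHEBCEMGAIFIINKIHLDCDCCHDIPII"
  ∷ "HLCNCDBCHEBCEMDDEFIPIIHLDBEMDBCHDCMCGAINKIMIIHLDCDCCHDGAINLINOEECFMEDEMNEBNMCINLINPEECFMEBCEFJOO"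
  ∷ "EBCEFDCFCFAGAIEHIFIIHGIMKIMIIFJIHNIKGDCDCHEIHLDDEDFAHMDMCHFAHMDMCHCMDCHDFAIFNIHJEKEBCCKEHMECKEMI"
  ∷ "MJIHODDEDFAHJFAHJCHDCHDCEMFBIFNEEBDKHMFAIHLECKEMHIIHLCMDDCKMFAECKEMFAIHNECKEMHJIHNCMDDCKMFBECKEM"
  ∷ "FBIHNECKEMJPQIHNCMDDCKMFBIMOIMNIFOBEDEBCEBMDKEBMDKIMOIMPIFOBEGAFAIMNDEBCCMDGAIMLIMJDDEDIHLCEMDCF"
  ∷ "HCEMFAIMLIMJDDEDIHLCEMDCFHCEMIMLIMJDDEDIHLCEMDCFHCEMFBIMNDEBCCMDGAGAIMQIMLDDEDIHQCEMDCFHCEMFAIMQ"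
  ∷ "IMLDDEDIHQCEMDCFHCEMIMQIMLDDEDIHQCEMDCFHCEMGBIMQIMSDDEDIHQCEMDCFHCEMFBIMQIMSDDEDIHQCEMDCFHCEMIMQ"
  ∷ "IMSDDEDIHQCEMDCFHCEMGAFAEBMDKIFLIHPDBCMDDEDIHOCFDDBEFFBEBMDKIFPIHQDBCMDDEDIHOCFDDBEFDEMBEEBDKGAI"
  ∷ "FLIMLIIGCHDCHDIFGEBCDMEBFHDDBDFGAIFGIENEHDBCEDBEHIMNCHDEBFHDIFGIENEHDBCEDBEHIMNCHDEBFHDIELIHNIKG"
  ∷ "CFCFAIHLCFDECDHFGAIHLIHOCFDIENDCFHDDHDECDHFIHLIHOCFDFAIEPDCFHDDHDDCKFDCKFGAHEIKLIIGCFDECDCIBDGAI"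
  ∷ "HNIIGCFDBFHMDBEFHECEMFAIFNIHJIKGEMCBEHFIKGCMCDBDBHGHHKDBDFHCEMGIHJCEMCEMFBGAIFLIFNIHNIKGDCECEBKM"
  ∷ "ECHDIKGDDEDHHCCKHJHHCCMDHMEIFOIFNIHNIKGDCECEBKMECHDIKGDDEDHHJQQCHDCHDJPQGAHHCCMIKNCHDCEKDHMEIHNC"
  ∷ "FDDEMHIFOBEIHJCEMCCMGAIKGIFLDDEDHHCCMEBKMEIKGIFNDDEDGAHHCCMCHDCFDEBKMEIFGIFNDBCBCBFCBFGAIFNIMKIM"
  ∷ "NIFLCHDIENDDFDEDBEHIFJEBCDMIKLCFDBDIFLBHCMFIMKECDFHCCHIFNIMKIMNIFOCHDGAIENIELDBCFDDFDEDBEHIENIEO"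
  ∷ "DBCFDDFDEDBEHIFJEBCDMIKLCFDBDIFOBHIENCCFJPOIMKECDFHCCHIHJIMKIHLCFDIEJIKGCFCECDHFDBEFIEJCCFIHLCFD"
  ∷ "JAOECDHFIMKIFIIKGCDEHMHFDBCFDBCFJPODBCMFAEBEKMDBCMGAFAEBEKMIFJDBCMEBEKMGAFAEBEKMFAIFNEBEKMDBCMIF"
  ∷ "LIFJDBCMEBEKMEBEKMFBEBEKMGAFAIFNEBEKMDBCMIFPIFLDBCMEBEKMEBEKMFBIFNEBEKMDBCMIFPIFRDBCMEBEKMEBEKME"
  ∷ "BEKMIKGCFCEBEKFDEMEIEJIELIMIIKGBDGBIENDDKDCEKIFOIHNCDCIEPDDKDCEKGAABGAIHNCDCIEQBCCBCFADCFDDCFDGB"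
  ∷ "IENDDMBIFGDDBECDEIENIEPDDMBFBIFLIKGCDEIFNCEKDBFDCCMIFLIFPECBDMCCMCCMFBIFGIJGDDBECEJCDEIFGIJGDDBE"
  ∷ "CEJCDEFBFAIFIIHGIMKIMIIFJIHNIOGDCDCIMJIFNCOEDDEDIFNCMDEBDMFIKGIIGCHDBHHJCJDCCDIHNIIGCFDBFIIGEDBC"
  ∷ "FCDFIFNECBDMHGIHJECDFGHKHJHOCEMIFJIONIIGDDEDDDEDIIGCOECCEIIGEDBCFCDFIFNIMKIMNCHDIFJDDEDCFDIFJCHE"
  ∷ "EDBCFIMKECDFHDDEDIMNCCFDCEFIFIIHGIMKIMIIFJIHNIPGDCDCIFNIHJCPDCPEIMJDDEDEBDMFFAIOGIKGIIGCHDBHHJCJ"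
  ∷ "DCJDCCDDDODFAIQGIOGIIGCHDBHDDODIMJDDEDCMDIQGIRGIIGCHDBHFAIMJDDEDCMDIMJDDEDCMDIMJDDEDCMDIHNIIGCFD"
  ∷ "BFIIGEDBCFCDFIFNECBDMHGIHJECDFGJNQGAIPJCGDDCFGIQJCGDDCFGGAIPJCGDDCFGIQJCGDDCFGHJJMQCJDCJDJLQIFJI"
  ∷ "ONIIGDDEDDDEDIIGCOECCEIIGEDBCFCDFIFNIMKIMNCHDEBCEMIFJCHEEBDMHIMKECDFHDCHMIMNCCFDCEFHFGAABFBGABCI"
  ∷ "MKIQGCCFFAIMRIHNCFCDBCFBCIMSDBCFBCDBDMFBGABCIMOIMKIQGCCFFAIMSIHNCFCDBCFBCIMTDBCFBCDBDMFAIHKIKGDB"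
  ∷ "DMIHNCMCCHDISGCMCCSDIHKIKGDBDMIHNCMCCHDITGCMCCTDGABCFBIMSIMOIQGCCFFAIMTIHNCFCDBCFBCIMUDBCFBCFAIH"
  ∷ "KIKGDBDMIHNCMCCHDITGCMCCTDIHKIKGDBDMIHNCMCCHDIUGCMCCUDFAIHOIKGDBDMIHNCMCCHDITGCMCCTDIHOIKGDBDMIH"
  ∷ "NCMCCHDIUGCMCCUDIMSIMUIQGCCFFAIMTIHNCFCDBCFBCIMVDBCFBCFBFAIHOIKGDBDMIHNCMCCHDITGCMCCTDIHOIKGDBDM"
  ∷ "IHNCMCCHDIUGCMCCUDFAIHUIKGDBDMIHNCMCCHDITGCMCCTDIHUIKGDBDMIHNCMCCHDIVGCMCCVDFAIHUIKGDBDMIHNCMCCH"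
  ∷ "DITGCMCCTDIHUIKGDBDMIHNCMCCHDIVGCMCCVDGAABGABCIMIIQGCCFFAIMRDBCFBCIMSDBCFBCIHJCEMDDMBFABCIMQEBCD"
  ∷ "FBCIMPCCFEBFDCIMKIIGIHPCFDDBEFCDIDBCMFBCCFFBIMNCCFIHGCMEDMFCFBIMQIMNCCFFAIJGDMFCCMCIJGDMFCCMCIHN"
  ∷ "CMEDMFCIMQIMRCCFFBIHNIIGCMDCDIEBMFCECBEFIHRCMEFAIOGCMCGADMFCGADMFCCODIQGCMCGBDMFCGBDMFCCQDFCGBCC"
  ∷ "FCCFFCGBIMNIPGCCFCCFFAIPGDMFCBMIPGDMFCBMIMNIRGCCFCCFFAIHGIOGCMCCMDIOQCFDDCHFIHGISGCMCCMDISQCFDDC"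
  ∷ "HFGBFBIMRIMNIPGCCFDFPCFAIPGDMFCCMCIPGDMFCCMCFAIHNIIGCMDCDIIOQCFEEMEFOIHNIIGCMDCDIIRQCFEEMEFRIMRI"
  ∷ "MSIPGCCFFAIMODBCFBCIMTDBCFBCFBIHNIIGCMDCDIFAIOQCFEIKGDCHFDDEDISQCFEFAIPGDMFCDCHFIPGDMFCDCHFIHSII"
  ∷ "GCMDCDIFAIOGCMCCFDISGCMCCFDFAIHSIIGCMDCDIIOGCMCCFDIHSIIGCMDCDIITGCMCCFDFCIMRIMNISGCCFDFSCFAIHGIO"
  ∷ "GCMCCMDIOQCFDDCHFIHGITGCMCCMDITQCFDDCHFFAIHNIIGCMDCDIIOQCFEEMEFOIHNIIGCMDCDIITQCFEEMEFTIMRIMTISG"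
  ∷ "CCFFAIMODBCFBCIMUDBCFBCFCIHNIIGCMDCDIFAIOQCFEIKGDCHFDDEDITQCFEFAISGDMFCDCHFISGDMFCDCHFIHTIIGCMDC"
  ∷ "DIFAIOGCMCCFDITGCMCCFDFAIHTIIGCMDCDIIOGCMCCFDIHTIIGCMDCDIIUGCMCCFDFAIHGIMKIMIIOGDCDCGAEBCEFGAIMP"
  ∷ "EBCDFDBDMGAIMRIMPEBCDFDBDMIHQDBCMDBDMFAIMRIMSEBCDFIHRDBCMDBDMIHQDBCMDBDMIMRIMSEBCDFGAIHRDBCMDBDM"
  ∷ "IHRDBCMDBDMIHQDBCMDBDMIHJCEMDDMBDBCMIMKECDFHDBCMIHGIMKIMIIQGDCDCGBEBCEFGBIMPEBCDFDBDMGBIMSIMPEBC"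
  ∷ "DFDBDMIHRDBCMDBDMIMSIMTEBCDFGBIHSDBCMDBDMIHSDBCMDBDMIHRDBCMDBDMIHJCEMDDMBDBCMIMKECDFHDBCMGBFAIMP"
  ∷ "IMOEBCDFCBFIHNDCDCDDEDIMPIMQEBCDFCBFIHNDCDCDDEDFAIMKIMIIHNDCDCIMQCHDEBFHDIHJCEMDDMBDBCMIMKIMIIHN"
  ∷ "DCDCIMQCHDEBFHDIHJCEMDDMBDBCMHMGAIFGIFNBCIHGCBFCCHCBFGAFADBCMDBCMGAFAIHODBCMIFGCCMCMCIHRDBCMDBCM"
  ∷ "FBHFCCMFAABGABCIPIIHLDCEMDEHEDCDMFABCIPIIHLDCEMDEHEDBEFCCMCCMCCMCCMFAIHODBCMEBMHCIHODBCMEBMHCDMC"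
  ∷ "FHFCCMFAABIHLIQGDCEFGABCDCFQDEHEFABCIPIIHLDCEMDEHEDBEFCCMCCMCCMCCMCCMCCMIHSDBCMFAEBMHCISGCMCDCSM"
  ∷ "DMCFHFGBAFGBFAABGABCIHIIPIDCDMIHKCEPCDPCEHGBFAABGABCIHLIOIDCEMCCDDEHECCMDCDMCCFGBGABCCCMGABCCCMG"
  ∷ "AIHGCBFCCHFADBCMIHKDBCMEBMCFFACBFDMCFDBDMCEMFBHFFBGAABGABCDBCFGAABGABCDBCFGAABGABCDBCFDCEFCFDIHN"
  ∷ "DCDCDDEDDEMEGBFBHFGAABGABCDBCFGAABGABCDBCFGABCIOGCCFDBCFDBEFIHNDCDCEBFHDIIPIHLDEMEFBIFIDBCMDBEFI"
  ∷ "FIDBCMDBEFCBEGBFBIFGIHNCMEHFFBGAABGABCDBCFGAABGABCDBCFGAABGABCDBCFDCEFCFDDMFCIHNDCDCEBFHDFBIFLIH"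
  ∷ "QDBCMDEMEIHQCMEFAIOGCMCDMFCIQGCMCDMFCFBIFLIHQDBCMDEMEECBEFIFLIHQDBCMDEMEECBEFFCHFGAABGABCDBCFGAA"
  ∷ "BGABCDBCFGABCIOGCCFIHNCMCDBCFDBEFFBIKGEBCDFDDEDCCFFCIIGIHNCMDFAEBCEMEBCEMCDIDBCFFAGAIIGIHNCMDEBC"
  ∷ "EMCDIIHPIOPCFEIHNCMEEMEFOCMEGBIHPIQPCFEIHNCMEEMEFQCMEIIPIHNCMEIQPCFEEMEFQCFDIHNDCDCEBFHDHFCCMCCM"
  ∷ "CCMCCMGBECBEFCCMGCIIGIHRCMDFADMHCDMHCCDICCMFAIHPIOPCFEIHRCMECMCCMEIHPISPCFEIHRCMECMCCMECCMIHRDBC"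
  ∷ "MDEMEGCIHNDCDCCHDDMCFGBHFGAABGABCDBCFGAABGABCDBCFGABCDBCFDBEFFAIIGIHGCMDGAIFLEBCEMDMFCIFLEBCEMFA"
  ∷ "DMFCCCFCDIIHGIIGCMDCDIGBIFIEBCDMCFDIFIEBCDMCFDFBGBIEHIENIELIOIIKGCBDIEJDDKBCBEIEJDDODCBEFAIFIIHG"
  ∷ "IOKIMIIFJIHNIKGDCDCIHJCCKCCKIIGCHDCHDIOIIHNIIGCFDCCEIIGDBCHCDFHHDBCHIFNIHJCMDCMCIKGDDEDIHJCCKCCK"
  ∷ "IMJIFNIHNDCECIIGDBCHDBCHIHJDBDFCBDIIGEDEDODBDMCCHIHJIOKCFDEDEOFIKGCBDCCKIFIIHGIOKIMIIFJIHNIKGDCD"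
  ∷ "CIHJCCKCCKIIGCHDCHDGAIOIIHNIKGDCECCCKIIGDBCHCDFHHCHCDBCHGAIOIIHNIKGDCECCCKIIGDBCHCDFIHNCFDDBCHIO"
  ∷ "IIHNIKGDCECCCKIIGDBCHCDFIHNCFDDBCHIFNIHJCMDCMDIKGEBDEFIHJCCKJIQIPJIFNIHNDCECIIGDBCHDBCHIIGDDEDCE"
  ∷ "FIIGEDEDODBDPCCHIHJIOKCFDDDOFIKGCBDCCKFAIFIIHGIOKIMIIFJIKGDCDCDDKBIOLIKGDCECIHLCCKDCDHIIGCFDBOIF"
  ∷ "LIHJCMDCMCIKGDCECIHJCCKCCMCDODBCHIHJIOKIHLCFDIKGCDHDCDHCDOIKGBDCCKIFIIHGIOKIMIIFJIKGDCDCDDKBGAIO"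
  ∷ "LIPLIKGDCECIHLCCKDCDHIOIIIGCFDBPDDODIPIIIGCFDBOIMGCODEBCEMGAIOLIPLIKGDCECIHLCCKDCDHIQIIIGCFDBPIM"
  ∷ "GCPDCEMIIGEOCBEBOIOLIPLIKGDCECIHLCCKDCDHIOIEPCBECFDFAIIGEOCBEBOIIGEOCBEBOIFLIHJCMDCMDGAIOJIKGDCE"
  ∷ "CIHJCCKCCMIPGDDFDEBCEPIOJIKGDCECIHJCCKJJQIPGCODDCFCCDODBCHIHJIOKIHLCFDIKGCDHDCDHCDOIKGBDCCKIOKCB"
  ∷ "CDEOEIEHIENIKGIOIIEPCBDHKCDKGAIOFCDKFAABFACCKFAIQHIMGCCKIHNCEMCHDCBCIQHIMGIRHCCKFABCIQMCDRISICRC"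
  ∷ "IPJCKCCPDIHNCEMCHDIPMCDQCKCGAIOHIPFCDKFAABFACCKFAIRHIMGCCKIONIHNCEMCHDDBCMCBCIHJIMGIRHISHCCKFABC"
  ∷ "IRMCDSITICSCIQJCKCCQDIQMCDRCKCIONIHNCEMCHDDBCMBDIPFDDCKIMGCCOCEMGAIQHIOHIPFCDKIMGIHJDCDKBDDBCMIQ"
  ∷ "GDCOCCQCIPGDCQCIFNCCQCPCIQHIPFIRHCDKDDCKFBABFBIMGCCKGBISLCBMCDSISTCBMCDSHHCDHGAIOMCDHCCHIUMCDHCC"
  ∷ "HGAIMGCCHIONCEMDBDMIQIIMGCCKFAIONIUNCEMDBCMDBCMIONIVNCEMDBCMDBCMISJCQDIMGCCHFAIONIUNCEMDBCMDBCMI"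
  ∷ "ONIVNCEMDBCMDBCMFBCBCISMCDHCKCFCCBCGBITMCDHIUICHCISJCKCCSDIVMCDHCCHBDFCCDHIMUCDHCCHFDCDHIMUCDHCC"
  ∷ "HIIGCHDCCKCCHIPGDDCQIFNCCKCPCIFGIFNBCIHGCECCBCGACBCIHNCDFBHBDFCIHNIHGCDKCCHIIGCHDCCKFCIHNIFPCDKG"
  ∷ "BIHJIMGCCKGAIOLCFDDCDCIPLCFDDCDCBDIHGGBDCECDCECCCHIIGIFPCHDIMGCCKDBCHIJPCCKDBDIGBFBIHQIFPCDKIHJI"
  ∷ "IGCKDCCKBDIFLIIGCKDIFNCCHCEFIMGCCHGAIOJCFCDCDCDCDCIHQIFPIHRCDKIIGIFLCKDFBIMGCCHGAIOJCFCDCDCDCDCI"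
  ∷ "MQCHDIIRCCHCCKIFNCCHCEFIHJIIGCKDCCKBDIIGIFLCKDIMPCHDCCKIFNCCHCEFFCIHQIFPCDKGBIHLIHJIIGCKDCCKBDIM"
  ∷ "RCDHDCDCGBIMGIHJDCDKBDGAIORCFDIHSIHLCKDCDHCDHITRCFDIHSIHLCKDCDHCDHIMGIHJDCDKBDGAIORCFDIHSIHTCKDC"
  ∷ "DHCDHIURCFDIHSIHTCKDCDHCDHIIGIFRCKDIMGCCHDCDCIFNCCHCEFIHQIHSIFPCDKGBIMGIHJIHLIIGCKDCCKIMRCDHDCDC"
  ∷ "BDGAIORCFDIHLIHJCKDBDCDHITRCFDIHLIHJCKDBDCDHGBIHJIMGDCDKGAIORCFDIHTIHLCKDCDHCDHIURCFDIHTIHLCKDCD"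
  ∷ "HCDHBDIHTIHUIIGCKDCCKIMTCDHDCDCIMRCDHDCDCIFRIIGCKDIFNCCHCEFFCIMGCCHDCDCIMGIIRCCHIJPCCKIMQCHDCMCC"
  ∷ "HDIFRIIGCKDIFNCCHCEFIMPIIGCHDCCHCCKIFGCDKGBIHLIHJCKDBDCDHGBIHPIHLCKDIMPCDHFADCDCCKECDHIHPIHQCKDI"
  ∷ "MPCDHFADCDCCKECDHIEJIELDDODFACBCIQHCBCFACBCECBDQCBEGBIHPIHLCCKIEJDDKBCBCIEFIEMCBCDDKBFABBBEIHPIH"
  ∷ "QCCKIEJIELDDKBCBCCBCIEFIEMCBCDDKBFABBBEHKCDKGAIOFIOICDKDDODIHGFAABDCECCCKGAIOHIOIIQFCDKFAABFACCK"
  ∷ "FAISHIMGCCKCEMCCQIHGIMIDCDCGAIRJCKCCMDIRJCKCCMDCCKDDODEDBCOGAIRHIOHIOIIQFCDKFAABIHGIMIDCDCGACCKF"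
  ∷ "AITHCCKBCISJCKCCMDCHDDDODEDBCOIOPEDBCRIQGCOCCCRIRHIOIISHIQFCDKFBABIHGIMIDCDCGBCCKFBIUHCCKBCITJCK"
  ∷ "CCMDCHDIRGDDCSGACCSITICCSCRCDDODIOIIQGDDCRCCKDCOCIFGBCGACEFCEFIOIBDFBIFJCKDFAIMGCCDCCFGAIMGCCDCF"
  ∷ "CCFDCKDFCIOIIFPIHGCDKCHDIHGDCECCCKDDODGBFBIHPIOIIFQCDKIHJIIGCKDCCKBDDDODIOIDDCHIFLCKDIMGCCHGADCD"
  ∷ "CGACFCCEMIHJIFLIIGCKDCCKFBIHGIMIGADCDCDCDCCCKCHDIHGIMIGADCDCDCDCCCKCHDIOIBDFAIMPCDEIFGCCOCDKISPC"
  ∷ "DEFAIFQCDKIMGCCOCOCIFQCDKIMGCCOCEMFCIHPIOIIFQCDKGBIHGIMIDCDCGAIOHCMCBCISHCMCBCCHDGBIHGIMIDCDCGAI"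
  ∷ "OHCMCBCITHCMCBCCHDIHGIMIDCDCGAIOHCMCBCIUHCMCBCCHDDDODIOIDDCHIFRCKDIMGCCHDCDCGBFBIHSIOIIFQIHPCDKD"
  ∷ "DCHIHGIMIDCDCGAIOHCMCBCITHCMCBCCHDDDODIFRIIGCKDCCHIOIDDCKDCDCIHSIOIIFQIHTCDKDDCKIHGIMIDCDCGAIOHC"
  ∷ "MCBCIUHCMCBCCHDDDODIFRIIGCKDCCHIMIDCDCCCHFCGBIHSIOIIFQIHPCDKDDCHIHGIMIDCDCGAIOHCMCBCIUHCMCBCCHDD"
  ∷ "DODIFRIIGCKDCCHIMIDCDCCCHIHSIOIIFQIHPCDKDDCHIHGIMIDCDCGAIOHCMCBCIVHCMCBCCHDDDODIFRIIGCKDCCHIMIDC"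
  ∷ "DCCCHGBIHSIOIIFQIHUCDKDDCKIHGIMIDCDCGAIOHCMCBCIVHCMCBCCHDDDODIFRIIGCKDCCHIMIDCDCCCHIHTIHVIIGIFRC"
  ∷ "KDIHGIMIDCDCDDCKCHDDBDIIOIIFQCDKIMTCDHDCDCDCOCIOIIFQCDKIMRCDHDCDCDCOCIHGIOICDKDDEDCCKDDKBIOKCBCD"
  ∷ "EOEIEJIELIOIIKGBDGBIHNCDCIEPBCCBCIFQIHNCDCIEPBCCBCIEHIEPBCDDKDCBEGBIEPIEHDDODCBCFACBCIPHCBCIKGCD"
  ∷ "EFACBCCEPGBIEQIEPDDODFACBCIRHCBCIKGCDEFACBCCERFACBCIQKBECBCIEQIERDDODFACBCIRQBECBCFACBCISKBECBCI"
  ∷ "FGIMGIFNBCGAGBDCBEIOQDCFBCBCGCFAIQGDCBEIOJCQCEBDEQFAIRGIQGDCBEIRJCQCIOKIMIDCDCEBDEQEBDEQIOJIQHCR"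
  ∷ "CBCEBDERGAIRGISGDCBEIRJIQHCSCBCIOKIMIDCDCEBDESEBDESDCFBIRGISGDCBEDCFBDCFBIOIIKGCBDCBEFAIQHCBCBCI"
  ∷ "SHCBCIJGCBECEOGCGAIOJIOIIHNDCECDBCHEBMDOEBCEMGAIFIIOKIFJIHNDCDCCHDIONDMEFIQICFDJOQGAIQJEBDOMEBCE"
  ∷ "MIQJEBDOMEBCEMIQJIOJCCFCODIHNCFCIOKCFDJNSIQJIHNDBEMDBCHDCMCIOICBDFACBCIRHCBCIJNCBECEOGAGBIOKIMII"
  ∷ "HNDCDCCHDIONCDMCMCEBCEFIOICBDCBCDCFCIOIIKGCBDIFNBCCBECBE"
  ∷ []

-- Replay of the certificates and conclusion.

-- The letter A encodes 0.
decode : List String → List ℕ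
decode = concatMap (λ l → map (λ c → charCode c ∸ 65) (toList l))

extract : ∀ {A : Set} (m : Maybe A) → is-just m ≡ true → A
extract (just x) _ = x

module Certified {n : ℕ} (G : Graph n) (quartic : Quartic G) (conn : EdgeConnected 3 G) (v₀ : Fin n) where
  open Check G exceptions using (check; Refuted; Exc)
  open EulerWords G quartic exceptions
  open Cut conn

  -- Here `refl` runs the checker with `G` a variable; the fuel 60 bounds the depth of the trees.
  -- Being abstract, the results are not unfolded again.
  abstract
    refuted₃ : Refuted occ2 (long v₀) nocut false root₃
    refuted₃ = proj₁ (extract (check occ2 (long v₀) nocut 60 false root₃ (decode certificate₃)) refl)

    refuted₄ : Refuted occ2 (long v₀) nocut true root₄
    refuted₄ = proj₁ (extract (check occ2 (long v₀) nocut 60 true root₄ (decode certificate₄)) refl)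

theorem5 : ∀ {n} (G : Graph n) → Quartic G → EdgeConnected 3 G → Planar G →
    ¬ Isomorphic G octahedron →
    Σ (Circuit G) λ c → Eulerian c × LocallySelfAvoiding 4 c
theorem5 G quartic conn planar ¬oct
  with Descent.gapless G quartic conn exceptions v₀ (Certified.refuted₃ G quartic conn v₀) (Certified.refuted₄ G quartic conn v₀)
  where
  v₀ = nonempty G planar
... | inj₁ exc = ⊥-elim (Exclude.excluded G quartic planar ¬oct exc)
-- A `Circuit` has positive length by definition, so the empty word has to be excluded.
... | inj₂ ([] , E , _) = ⊥-elim (n≮0 (EulerWords.long G quartic exceptions (nonempty G planar) [] E))
... | inj₂ (x ∷ xs , E , gapless) = circuit x xs E gapless , eulerian x xs E gapless , avoiding x xs E gapless
  where open ToCircuit G quartic exceptions
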